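{- There is a static data structure (called sarray) which, for every ordered set $S\subset\{0,1,\ldots,n-1\}$ with $m\ge 1$ elements, stores a representation of $S$ in $m\log_2\frac{n}{m}+2m+o(m)$ bits in the worst case, and which, on the word RAM, answers each query $\mathrm{rank}(x,S)$ in $O\!\left(1+\log\frac{n}{m}+\frac{\log^4 m}{\log n}\right)$ worst-case time and each query $\mathrm{select}(i,S)$ in $O\!\left(1+\frac{\log^4 m}{\log n}\right)$ worst-case time.
   Context: For $S\subset\{0,1,\ldots,n-1\}$: $\mathrm{rank}(x,S)$ is the number of elements of $S$ which are no greater than $x$, and $\mathrm{select}(i,S)$ is the $i$-th smallest element of $S$. Word RAM model: logical and arithmetic operations on two $O(\log n)$-bit integers take constant time, and any consecutive $O(\log n)$ bits of memory at any address can be read or written in constant time; the number of ones in a word of $O(\log n)$ bits (popcount) is also taken to be computable in constant time. Here $\log^4 m=(\log m)^4$, and the term $o(m)$ is as $m\to\infty$. -}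

module Defs where

open import Data.Bool using (Bool; true; false; if_then_else_; _∧_; _∨_; _xor_)
open import Data.Fin using (Fin; zero; suc; toℕ) renaming (_≤?_ to _≤ᶠ?_)
open import Data.Fin.Subset using (Subset; inside; outside; ∣_∣; _∩_)
open import Data.List using (List; []; _∷_; length; lookup)
open import Data.Maybe using (Maybe; just; nothing)
open import Data.Nat using (ℕ; zero; suc; _+_; _*_; _∸_; _^_; _/_; _%_; _≤_; _≤ᵇ_; _<ᵇ_; _≡ᵇ_; NonZero)
open import Data.Nat.Logarithm using (⌊log₂_⌋)
open import Data.Nat.Properties using (m^n≢0)
open import Data.Product using (_×_; _,_; ∃-syntax)
open import Data.Vec using (_∷_; tabulate)
open import Function using (_∘_)
open import Relation.Binary.PropositionalEquality using (_≡_)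
open import Relation.Nullary.Decidable using (⌊_⌋)

-- Rank and select on subsets of {0, …, n-1}.

rank : ∀ {n} → Fin n → Subset n → ℕ
rank x S = ∣ S ∩ tabulate (λ y → ⌊ y ≤ᶠ? x ⌋) ∣

-- Zero-based: select S i is the (i+1)-th smallest element of S.
select : ∀ {n} (S : Subset n) → Fin ∣ S ∣ → Fin n
select (inside  ∷ S) zero    = zero
select (inside  ∷ S) (suc i) = suc (select S i)
select (outside ∷ S) i       = suc (select S i)

-- Words of w bits are naturals below 2 ^ w, least significant bit first.

bit : ℕ → ℕ → Bool
bit a zero    = a % 2 ≡ᵇ 1
bit a (suc i) = bit (a / 2) i

fromBits : ℕ → (ℕ → Bool) → ℕ
fromBits zero    b = 0
fromBits (suc w) b = (if b 0 then 1 else 0) + 2 * fromBits w (b ∘ suc)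

popcount : ℕ → ℕ → ℕ
popcount zero    a = 0
popcount (suc w) a = a % 2 + popcount w (a / 2)

truncate : ℕ → ℕ → ℕ
truncate w a = _%_ a (2 ^ w) {{m^n≢0 2 w}}

-- The word RAM. Memory is addressed by the bit, so that a word can be read
-- or written at any bit position. Register names and jump targets are
-- literals of the program: a program is finite and only memory is
-- addressed indirectly.

Register Address : Set
Register = ℕ
Address  = ℕ

data Op : Set where
  add sub mul div mod and or xor shl shr lt : Op

data Instr : Set where
  const : Register → ℕ → Instr                       -- const r k      : r ← k
  op    : Op → Register → Register → Register → Instr -- op o r a b     : r ← a o b
  pop   : Register → Register → Instr                -- pop r a        : r ← number of ones in a
  load  : Register → Register → Instr                -- load r a       : r ← w bits at address a
  store : Register → Register → Instr                -- store a v      : w bits at address a ← v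
  jump  : ℕ → Instr
  jz    : Register → ℕ → Instr                       -- jz r l         : if r = 0 goto l
  halt  : Register → Instr                           -- halt r         : stop with answer r

Program : Set
Program = List Instr

Memory : Set
Memory = Address → Bool

record Config : Set where
  constructor ⟨_,_,_⟩
  field
    pc  : ℕ
    reg : Register → ℕ
    mem : Memory

fetch : Program → ℕ → Maybe Instr
fetch []       _       = nothing
fetch (i ∷ _)  zero    = just i
fetch (_ ∷ is) (suc k) = fetch is k

bitwise : ℕ → (Bool → Bool → Bool) → ℕ → ℕ → ℕ
bitwise w _⊕_ a b = fromBits w (λ i → bit a i ⊕ bit b i)

-- Arithmetic is modulo 2 ^ w; division and remainder by 0 give 0.
evalOp : ℕ → Op → ℕ → ℕ → ℕ
evalOp w add a b       = truncate w (a + b)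
evalOp w sub a b       = truncate w (a + (2 ^ w ∸ b))
evalOp w mul a b       = truncate w (a * b)
evalOp w div a zero    = 0
evalOp w div a (suc b) = truncate w (a / suc b)
evalOp w mod a zero    = 0
evalOp w mod a (suc b) = truncate w (a % suc b)
evalOp w and a b       = bitwise w _∧_ a b
evalOp w or  a b       = bitwise w _∨_ a b
evalOp w xor a b       = bitwise w _xor_ a b
evalOp w shl a b       = truncate w (a * 2 ^ b)
evalOp w shr a b       = truncate w (_/_ a (2 ^ b) {{m^n≢0 2 b}})
evalOp w lt  a b       = truncate w (if a <ᵇ b then 1 else 0)

setReg : (Register → ℕ) → Register → ℕ → Register → ℕ
setReg ρ r v s = if s ≡ᵇ r then v else ρ s

readWord : ℕ → Memory → Address → ℕ
readWord w μ a = fromBits w (λ i → μ (a + i))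

writeWord : ℕ → Memory → Address → ℕ → Memory
writeWord w μ a v j = if (a ≤ᵇ j) ∧ (j <ᵇ a + w) then bit v (j ∸ a) else μ j

-- run p w t c executes at most t instructions of p, each of unit cost
-- (the final halt included), and returns the answer and the final memory
-- if the program has halted by then.
run : Program → ℕ → ℕ → Config → Maybe (ℕ × Memory)
exec : Program → ℕ → ℕ → Maybe Instr → Config → Maybe (ℕ × Memory)

run p w zero    c = nothing
run p w (suc t) c = exec p w t (fetch p (Config.pc c)) c

exec p w t nothing             c           = nothing
exec p w t (just (halt r))     ⟨ k , ρ , μ ⟩ = just (ρ r , μ)
exec p w t (just (const r v))  ⟨ k , ρ , μ ⟩ = run p w t ⟨ suc k , setReg ρ r (truncate w v) , μ ⟩
exec p w t (just (op o r a b)) ⟨ k , ρ , μ ⟩ = run p w t ⟨ suc k , setReg ρ r (evalOp w o (ρ a) (ρ b)) , μ ⟩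
exec p w t (just (pop r a))    ⟨ k , ρ , μ ⟩ = run p w t ⟨ suc k , setReg ρ r (truncate w (popcount w (ρ a))) , μ ⟩
exec p w t (just (load r a))   ⟨ k , ρ , μ ⟩ = run p w t ⟨ suc k , setReg ρ r (readWord w μ (ρ a)) , μ ⟩
exec p w t (just (store a v))  ⟨ k , ρ , μ ⟩ = run p w t ⟨ suc k , ρ , writeWord w μ (ρ a) (ρ v) ⟩
exec p w t (just (jump l))     ⟨ k , ρ , μ ⟩ = run p w t ⟨ l , ρ , μ ⟩
exec p w t (just (jz r l))     ⟨ k , ρ , μ ⟩ = run p w t ⟨ (if ρ r ≡ᵇ 0 then l else suc k) , ρ , μ ⟩

-- The representation occupies the addresses 0, …, length bs - 1.
Holds : Memory → List Bool → Set
Holds μ bs = (i : Fin (length bs)) → μ (toℕ i) ≡ lookup bs i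

-- The query argument and the parameters n and m are passed in registers.
initRegs : (q n m : ℕ) → Register → ℕ
initRegs q n m 0 = q
initRegs q n m 1 = n
initRegs q n m 2 = m
initRegs q n m _ = 0

-- Memory outside the representation is arbitrary, so only the bits of the
-- representation carry information about the set; a query may use the rest
-- as working space but must leave the representation intact.
Answers : Program → (w n m : ℕ) → List Bool → (q a t : ℕ) → Set
Answers p w n m bs q a t =
  (μ : Memory) → Holds μ bs →
  ∃[ μ′ ] (run p w t ⟨ 0 , initRegs q n m , μ ⟩ ≡ just (a , μ′) × Holds μ′ bs)

-- The two programs and the factor in the word length are fixed once for
-- all n and S.
record RankSelectStructure : Set where
  field
    wordFactor         : ℕ
    {{wordFactor≢0}}   : NonZero wordFactor
    encode             : ∀ {n} → Subset n → List Bool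
    rankProgram        : Program
    selectProgram      : Program

  -- At least the length of the binary expansion of n, so that n, m and
  -- every query argument fit in one word.
  wordLength : ℕ → ℕ
  wordLength n = wordFactor * suc ⌊log₂ n ⌋

  size : ∀ {n} → Subset n → ℕ
  size S = length (encode S)

  AnswersRank : ∀ {n} (S : Subset n) → Fin n → (t : ℕ) → Set
  AnswersRank {n} S x t =
    Answers rankProgram (wordLength n) n ∣ S ∣ (encode S) (toℕ x) (rank x S) t

  -- select(i,S) is indexed from 1, whence the suc.
  AnswersSelect : ∀ {n} (S : Subset n) → Fin ∣ S ∣ → (t : ℕ) → Set
  AnswersSelect {n} S i t =
    Answers selectProgram (wordLength n) n ∣ S ∣ (encode S) (suc (toℕ i)) (toℕ (select S i)) t

-- f(m) = o(m) as m → ∞: for every k, eventually k f(m) ≤ m.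
IsLittleO : (ℕ → ℕ) → Set
IsLittleO f = ∀ k → ∃[ m₀ ] (∀ m → m₀ ≤ m → k * f m ≤ m)

-- The inequality b ≤ k log₂ (n / m) + e between real numbers, for m > 0,
-- exponentiated to base 2 and multiplied by m ^ k.
infix 4 _≤_log₂[_/_]+_
_≤_log₂[_/_]+_ : (b k n m e : ℕ) → Set
b ≤ k log₂[ n / m ]+ e = 2 ^ b * m ^ k ≤ n ^ k * 2 ^ e

-- 1 + log (n/m) + log⁴ m / log n and 1 + log⁴ m / log n, to be multiplied by
-- the constant of the O. Rounding logarithms and quotients down, and the
-- suc in the denominator (which makes n = 1 meaningful), change the values
-- by at most a constant factor for 1 ≤ m ≤ n, n ≥ 2.
selectTime : (n m : ℕ) → ℕ
selectTime n m = 1 + ⌊log₂ m ⌋ ^ 4 / suc ⌊log₂ n ⌋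

rankTime : (n m : ℕ) → .{{NonZero m}} → ℕ
rankTime n m = 1 + ⌊log₂ (n / m) ⌋ + ⌊log₂ m ⌋ ^ 4 / suc ⌊log₂ n ⌋

{-# OPTIONS --safe #-}
-- Elias–Fano coding, iterated. A block of N elements of span s stores the
-- lowest ⌊log₂ (s / N)⌋ bits of every element, and a representation of the
-- sequence of the high parts, which is monotone and stays below 2 N. To
-- represent it, it is cut into segments, which are blocks again: first of 8 ^ e
-- elements, then of 2 ^ e, where 4 ^ e ≈ log₂ m. The high parts of the smallest
-- blocks are written in unary, with so few bits that a table of o(m) bits
-- decodes them. A segment of b elements of span t takes little more than b + t
-- bits, so its address can be computed from the values of the sequence, and
-- select takes constant time.
--
-- Binary search over select answers rank in O(1 + log m) steps. This is within
-- the bound: if log m exceeds log (n / m), then log n ≤ 2 log m + O(1), hence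
-- (log m)⁴ / log n is at least of the order of log m.
--
-- The main term m log₂ (n / m) + 2 m comes from 2 ^ t ≤ 1 + t on [0, 1], an
-- instance of the inequality of arithmetic and geometric means.
module Submission where

open import Data.Bool using (Bool; true; false; if_then_else_; _∧_; _∨_; not; T)
open import Data.Fin using (Fin; zero; suc; toℕ; fromℕ<) renaming (_≤?_ to _≤ᶠ?_)
open import Data.Fin.Properties using (toℕ<n; toℕ-fromℕ<)
open import Data.Fin.Subset using (Subset; inside; outside; ∣_∣; _∩_)
open import Data.Fin.Subset.Properties using (∣p∣≤n)
open import Data.List using (List; []; _∷_; _++_; length; lookup; applyUpTo)
open import Data.List.Properties using (length-applyUpTo; lookup-applyUpTo)
open import Data.Maybe using (just)
open import Data.Nat
open import Data.Nat.DivMod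
open import Data.Nat.Logarithm using (⌊log₂_⌋; ⌊log₂⌋-mono-≤; ⌊log₂⌊n/2⌋⌋≡⌊log₂n⌋∸1; ⌊log₂[2^n]⌋≡n)
open import Data.Nat.Properties
open import Data.Nat.Tactic.RingSolver using (solve-∀)
open import Data.Product using (Σ-syntax; ∃-syntax; _×_; _,_; proj₁; proj₂)
open import Data.Sum using (_⊎_; inj₁; inj₂)
open import Data.Unit using (⊤; tt)
open import Data.Vec using ([]; _∷_; tabulate)
open import Data.Vec.Properties using (tabulate-cong)
open import Function using (_∘_)
open import Relation.Binary.PropositionalEquality
open import Relation.Nullary using (Dec; yes; no; contradiction; ¬_)
open import Relation.Nullary.Decidable using (⌊_⌋)
open import Algebra.Properties.CommutativeSemigroup *-commutativeSemigroup using (x∙yz≈y∙xz)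
open import Defs

-- Powers, logarithms and division

infixl 7 _/2^_

_/2^_ : ℕ → ℕ → ℕ
a /2^ k = _/_ a (2 ^ k) {{m^n≢0 2 k}}

2^-pos : ∀ k → 1 ≤ 2 ^ k
2^-pos k = m^n>0 2 k

n<2^n : ∀ n → n < 2 ^ n
n<2^n zero    = s≤s z≤n
n<2^n (suc n) = begin-strict
  suc n          ≤⟨ n<2^n n ⟩
  2 ^ n          <⟨ m<m+n (2 ^ n) (2^-pos n) ⟩
  2 ^ n + 2 ^ n  ≡⟨ cong (2 ^ n +_) (+-identityʳ (2 ^ n)) ⟨
  2 ^ suc n      ∎
  where open ≤-Reasoning

2^-cancel-< : ∀ {i j} → 2 ^ i < 2 ^ j → i < j
2^-cancel-< {i} {j} p = ≰⇒> (λ j≤i → <⇒≱ p (^-monoʳ-≤ 2 j≤i))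

private
  2*⌊n/2⌋≤n : ∀ n → 2 * ⌊ n /2⌋ ≤ n
  2*⌊n/2⌋≤n zero          = z≤n
  2*⌊n/2⌋≤n (suc zero)    = z≤n
  2*⌊n/2⌋≤n (suc (suc n)) =
    ≤-trans (≤-reflexive (*-suc 2 ⌊ n /2⌋)) (s≤s (s≤s (2*⌊n/2⌋≤n n)))

  n<2*[1+⌊n/2⌋] : ∀ n → n < 2 * suc ⌊ n /2⌋
  n<2*[1+⌊n/2⌋] zero          = s≤s z≤n
  n<2*[1+⌊n/2⌋] (suc zero)    = s≤s (s≤s z≤n)
  n<2*[1+⌊n/2⌋] (suc (suc n)) =
    ≤-trans (s≤s (s≤s (n<2*[1+⌊n/2⌋] n))) (≤-reflexive (sym (*-suc 2 (suc ⌊ n /2⌋))))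

  log-suc : ∀ n → ⌊log₂ suc (suc n) ⌋ ≡ suc ⌊log₂ suc ⌊ n /2⌋ ⌋
  log-suc n =
    trans (sym (m+[n∸m]≡n {1} (⌊log₂⌋-mono-≤ {2} {suc (suc n)} (s≤s (s≤s z≤n)))))
          (cong suc (sym (⌊log₂⌊n/2⌋⌋≡⌊log₂n⌋∸1 (suc (suc n)))))

  log-bounds : ∀ k n → n ≤ k → 2 ^ ⌊log₂ suc n ⌋ ≤ suc n × suc n < 2 ^ suc ⌊log₂ suc n ⌋
  log-bounds k       zero    _       = s≤s z≤n , s≤s (s≤s z≤n)
  log-bounds (suc k) (suc n) (s≤s p) =
    subst (λ z → 2 ^ z ≤ suc (suc n) × suc (suc n) < 2 ^ suc z) (sym (log-suc n))
      (let lo , hi = log-bounds k ⌊ n /2⌋ (≤-trans (⌊n/2⌋≤n n) p) in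
       ≤-trans (*-monoʳ-≤ 2 lo) (2*⌊n/2⌋≤n (suc (suc n))) ,
       <-≤-trans (n<2*[1+⌊n/2⌋] (suc (suc n))) (*-monoʳ-≤ 2 hi))

2^log≤ : ∀ n .{{_ : NonZero n}} → 2 ^ ⌊log₂ n ⌋ ≤ n
2^log≤ (suc n) = proj₁ (log-bounds n n ≤-refl)

<2^[1+log] : ∀ n → n < 2 ^ suc ⌊log₂ n ⌋
<2^[1+log] zero    = s≤s z≤n
<2^[1+log] (suc n) = proj₂ (log-bounds n n ≤-refl)

[qb+r]/b : ∀ q b r .{{_ : NonZero b}} → r < b → (q * b + r) / b ≡ q
[qb+r]/b q b r r<b = begin
  (q * b + r) / b     ≡⟨ cong (_/ b) (+-comm (q * b) r) ⟩
  (r + q * b) / b     ≡⟨ +-distrib-/ r (q * b) (subst (λ z → r % b + z < b) (sym (m*n%n≡0 q b))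
                           (subst (_< b) (sym (+-identityʳ (r % b))) (m%n<n r b))) ⟩
  r / b + q * b / b   ≡⟨ cong₂ _+_ (m<n⇒m/n≡0 r<b) (m*n/n≡m q b) ⟩
  q                   ∎
  where open ≡-Reasoning

[qb+r]%b : ∀ q b r .{{_ : NonZero b}} → r < b → (q * b + r) % b ≡ r
[qb+r]%b q b r r<b = begin
  (q * b + r) % b  ≡⟨ cong (_% b) (+-comm (q * b) r) ⟩
  (r + q * b) % b  ≡⟨ [m+kn]%n≡m%n r q b ⟩
  r % b            ≡⟨ m<n⇒m%n≡m r<b ⟩
  r                ∎
  where open ≡-Reasoning

m≡[m/n]*n+m%n : ∀ m n .{{_ : NonZero n}} → m ≡ m / n * n + m % n
m≡[m/n]*n+m%n m n = trans (m≡m%n+[m/n]*n m n) (+-comm (m % n) _)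

-- Bits

private
  2y/2 : ∀ y → 2 * y / 2 ≡ y
  2y/2 y = trans (cong (_/ 2) (trans (*-comm 2 y) (sym (+-identityʳ (y * 2))))) ([qb+r]/b y 2 0 (s≤s z≤n))

  2y%2 : ∀ y → 2 * y % 2 ≡ 0
  2y%2 y = trans (cong (_% 2) (trans (*-comm 2 y) (sym (+-identityʳ (y * 2))))) ([qb+r]%b y 2 0 (s≤s z≤n))

  [1+2y]/2 : ∀ y → suc (2 * y) / 2 ≡ y
  [1+2y]/2 y = trans (cong (_/ 2) (trans (cong suc (*-comm 2 y)) (+-comm 1 (y * 2)))) ([qb+r]/b y 2 1 (s≤s (s≤s z≤n)))

  [1+2y]%2 : ∀ y → suc (2 * y) % 2 ≡ 1
  [1+2y]%2 y = trans (cong (_% 2) (trans (cong suc (*-comm 2 y)) (+-comm 1 (y * 2)))) ([qb+r]%b y 2 1 (s≤s (s≤s z≤n)))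

  1+2y<2z : ∀ {y z} → y < z → suc (2 * y) < 2 * z
  1+2y<2z {y} {z} p = ≤-trans (≤-reflexive (sym (*-suc 2 y))) (*-monoʳ-≤ 2 p)

fromBits< : ∀ w b → fromBits w b < 2 ^ w
fromBits< zero    b = s≤s z≤n
fromBits< (suc w) b with b 0
... | true  = 1+2y<2z (fromBits< w (b ∘ suc))
... | false = <-trans (n<1+n _) (1+2y<2z (fromBits< w (b ∘ suc)))

fromBits-cong : ∀ w {b c} → (∀ i → i < w → b i ≡ c i) → fromBits w b ≡ fromBits w c
fromBits-cong zero    p = refl
fromBits-cong (suc w) p =
  cong₂ (λ x y → (if x then 1 else 0) + 2 * y) (p 0 (s≤s z≤n)) (fromBits-cong w (λ i q → p (suc i) (s≤s q)))

fromBits-bit : ∀ w v → v < 2 ^ w → fromBits w (bit v) ≡ v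
fromBits-bit zero    v v<1 = sym (n<1⇒n≡0 v<1)
fromBits-bit (suc w) v v<  = begin
  (if v % 2 ≡ᵇ 1 then 1 else 0) + 2 * fromBits w (bit (v / 2))
    ≡⟨ cong₂ (λ x y → x + 2 * y) (bit0 (v % 2) (m%n<n v 2))
         (fromBits-bit w (v / 2) (m<n*o⇒m/o<n (<-≤-trans v< (≤-reflexive (*-comm 2 (2 ^ w)))))) ⟩
  v % 2 + 2 * (v / 2)  ≡⟨ cong (v % 2 +_) (*-comm 2 (v / 2)) ⟩
  v % 2 + v / 2 * 2    ≡⟨ m≡m%n+[m/n]*n v 2 ⟨
  v                    ∎
  where
  open ≡-Reasoning
  bit0 : ∀ r → r < 2 → (if r ≡ᵇ 1 then 1 else 0) ≡ r
  bit0 0 _ = refl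
  bit0 1 _ = refl
  bit0 (suc (suc _)) (s≤s (s≤s ()))

bit-fromBits : ∀ w b i → i < w → bit (fromBits w b) i ≡ b i
bit-fromBits (suc w) b zero i<w with b 0
... | true  = cong (_≡ᵇ 1) ([1+2y]%2 (fromBits w (b ∘ suc)))
... | false = cong (_≡ᵇ 1) (2y%2 (fromBits w (b ∘ suc)))
bit-fromBits (suc w) b (suc i) (s≤s i<w) with b 0
... | true  = trans (cong (λ x → bit x i) ([1+2y]/2 (fromBits w (b ∘ suc)))) (bit-fromBits w (b ∘ suc) i i<w)
... | false = trans (cong (λ x → bit x i) (2y/2 (fromBits w (b ∘ suc)))) (bit-fromBits w (b ∘ suc) i i<w)

fromBits-++ : ∀ v w b → fromBits (v + w) b ≡ fromBits w (b ∘ (v +_)) * 2 ^ v + fromBits v b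
fromBits-++ zero    w b = sym (trans (+-identityʳ _) (*-identityʳ _))
fromBits-++ (suc v) w b = begin
  β + 2 * fromBits (v + w) (b ∘ suc)       ≡⟨ cong (λ z → β + 2 * z) (fromBits-++ v w (b ∘ suc)) ⟩
  β + 2 * (hi * 2 ^ v + lo)                ≡⟨ regroup β hi (2 ^ v) lo ⟩
  hi * 2 ^ suc v + (β + 2 * lo)            ∎
  where
  open ≡-Reasoning
  regroup : ∀ β h p l → β + 2 * (h * p + l) ≡ h * (2 * p) + (β + 2 * l)
  regroup = solve-∀
  β  = if b 0 then 1 else 0
  hi = fromBits w (b ∘ (suc v +_))
  lo = fromBits v (b ∘ suc)

truncate< : ∀ k a → truncate k a < 2 ^ k
truncate< k a = m%n<n a (2 ^ k) {{m^n≢0 2 k}}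

truncate-id : ∀ {k a} → a < 2 ^ k → truncate k a ≡ a
truncate-id {k} = m<n⇒m%n≡m {{m^n≢0 2 k}}

/2^-truncate : ∀ k a → a ≡ truncate k a + a /2^ k * 2 ^ k
/2^-truncate k a = m≡m%n+[m/n]*n a (2 ^ k) {{m^n≢0 2 k}}

truncate-fromBits : ∀ {v w} b → v ≤ w → truncate v (fromBits w b) ≡ fromBits v b
truncate-fromBits {v} {w} b v≤w = begin
  truncate v (fromBits w b)              ≡⟨ cong (λ z → truncate v (fromBits z b)) (m+[n∸m]≡n v≤w) ⟨
  truncate v (fromBits (v + (w ∸ v)) b)  ≡⟨ cong (truncate v) (fromBits-++ v (w ∸ v) b) ⟩
  truncate v (hi * 2 ^ v + fromBits v b) ≡⟨ [qb+r]%b hi (2 ^ v) _ {{m^n≢0 2 v}} (fromBits< v b) ⟩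
  fromBits v b                           ∎
  where
  open ≡-Reasoning
  hi = fromBits (w ∸ v) (b ∘ (v +_))

popcount≤ : ∀ w a → popcount w a ≤ w
popcount≤ zero    a = z≤n
popcount≤ (suc w) a = +-mono-≤ (s≤s⁻¹ (m%n<n a 2)) (popcount≤ w (a / 2))

popcount-even : ∀ w y → popcount (suc w) (2 * y) ≡ popcount w y
popcount-even w y = cong₂ (λ r q → r + popcount w q) (2y%2 y) (2y/2 y)

popcount-odd : ∀ w y → popcount (suc w) (suc (2 * y)) ≡ suc (popcount w y)
popcount-odd w y = cong₂ (λ r q → r + popcount w q) ([1+2y]%2 y) ([1+2y]/2 y)

popcount-ones : ∀ w → popcount w (2 ^ w ∸ 1) ≡ w
popcount-ones zero    = refl
popcount-ones (suc w) = begin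
  popcount (suc w) (2 * 2 ^ w ∸ 1)            ≡⟨ cong (λ z → popcount (suc w) (2 * z ∸ 1)) (m+[n∸m]≡n (2^-pos w)) ⟨
  popcount (suc w) (2 * suc x ∸ 1)            ≡⟨ cong (popcount (suc w)) (cong (_∸ 1) (*-suc 2 x)) ⟩
  popcount (suc w) (suc (2 * x))              ≡⟨ popcount-odd w x ⟩
  suc (popcount w x)                          ≡⟨ cong suc (popcount-ones w) ⟩
  suc w                                       ∎
  where
  open ≡-Reasoning
  x = 2 ^ w ∸ 1

-- Adding 1 to a number with exactly ℓ trailing ones turns them into zeros and
-- the zero above them into a one, which reveals ℓ as a difference of popcounts.
popcount-suc : ∀ ℓ w b → ℓ < w → (∀ i → i < ℓ → b i ≡ true) → b ℓ ≡ false →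
               suc (fromBits w b) < 2 ^ w ×
               popcount w (fromBits w b) + 1 ≡ popcount w (suc (fromBits w b)) + ℓ
popcount-suc zero (suc w) b _ _ b0 rewrite b0 =
  1+2y<2z (fromBits< w (b ∘ suc)) , (begin
    popcount (suc w) (2 * y) + 1        ≡⟨ cong (_+ 1) (popcount-even w y) ⟩
    popcount w y + 1                    ≡⟨ +-comm (popcount w y) 1 ⟩
    suc (popcount w y)                  ≡⟨ popcount-odd w y ⟨
    popcount (suc w) (suc (2 * y))      ≡⟨ +-identityʳ _ ⟨
    popcount (suc w) (suc (2 * y)) + 0  ∎)
  where
  open ≡-Reasoning
  y = fromBits w (b ∘ suc)
popcount-suc (suc ℓ) (suc w) b (s≤s ℓ<w) ones bℓ rewrite ones 0 (s≤s z≤n)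
  with popcount-suc ℓ w (b ∘ suc) ℓ<w (λ i p → ones (suc i) (s≤s p)) bℓ
... | y< , eq =
  subst (_< 2 ^ suc w) (*-suc 2 y) (<-trans (n<1+n _) (1+2y<2z y<)) , (begin
    popcount (suc w) (suc (2 * y)) + 1            ≡⟨ cong (_+ 1) (popcount-odd w y) ⟩
    suc (popcount w y + 1)                        ≡⟨ cong suc eq ⟩
    suc (popcount w (suc y) + ℓ)                  ≡⟨ +-suc _ ℓ ⟨
    popcount w (suc y) + suc ℓ                    ≡⟨ cong (_+ suc ℓ) (popcount-even w (suc y)) ⟨
    popcount (suc w) (2 * suc y) + suc ℓ          ≡⟨ cong (λ z → popcount (suc w) z + suc ℓ) (*-suc 2 y) ⟩
    popcount (suc w) (suc (suc (2 * y))) + suc ℓ  ∎)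
  where
  open ≡-Reasoning
  y = fromBits w (b ∘ suc)

-- Layout of bit strings in memory

T⇒true : ∀ {b} → T b → b ≡ true
T⇒true {true} _ = refl

¬T⇒false : ∀ {b} → ¬ T b → b ≡ false
¬T⇒false {false} _ = refl
¬T⇒false {true}  f = contradiction _ f

infix 4 _[_,_]≗_

record _[_,_]≗_ (μ : Memory) (A len : ℕ) (c : Memory) : Set where
  constructor agree
  field at : ∀ t → t < len → μ (A + t) ≡ c t

open _[_,_]≗_ public

cat : ℕ → Memory → Memory → Memory
cat k f g a = if a <ᵇ k then f a else g (a ∸ k)

-- Piece q occupies the addresses from s q to s (suc q).
glue : (Q : ℕ) (s : ℕ → ℕ) → (ℕ → Memory) → Memory
glue zero    s f a = false
glue (suc q) s f a = if s q ≤ᵇ a then f q (a ∸ s q) else glue q s f a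

array : (Q W : ℕ) → (ℕ → Memory) → Memory
array Q W = glue Q (_* W)

≗-weaken : ∀ {μ A len len′ c} → len′ ≤ len → μ [ A , len ]≗ c → μ [ A , len′ ]≗ c
≗-weaken p h .at t t< = h .at t (<-≤-trans t< p)

cat-left : ∀ {μ A len} k f g → k ≤ len → μ [ A , len ]≗ cat k f g → μ [ A , k ]≗ f
cat-left k f g k≤ h .at t t<k =
  trans (h .at t (<-≤-trans t<k k≤)) (cong (if_then f t else g (t ∸ k)) (T⇒true (<⇒<ᵇ t<k)))

cat-right : ∀ {μ A} k l f g → μ [ A , k + l ]≗ cat k f g → μ [ A + k , l ]≗ g
cat-right {μ} {A} k l f g h .at t t<l = begin
  μ (A + k + t)                                        ≡⟨ cong μ (+-assoc A k t) ⟩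
  μ (A + (k + t))                                      ≡⟨ h .at (k + t) (+-monoʳ-< k t<l) ⟩
  (if k + t <ᵇ k then f (k + t) else g (k + t ∸ k))    ≡⟨ cong (if_then f (k + t) else g (k + t ∸ k))
                                                            (¬T⇒false (λ p → m+n≮m k t (<ᵇ⇒< _ _ p))) ⟩
  g (k + t ∸ k)                                        ≡⟨ cong g (m+n∸m≡n k t) ⟩
  g t                                                  ∎
  where open ≡-Reasoning

module _ (s : ℕ → ℕ) (s-mono : ∀ {i j} → i ≤ j → s i ≤ s j) (f : ℕ → Memory) where

  glue-lookup : ∀ Q q t → q < Q → s q + t < s (suc q) → glue Q s f (s q + t) ≡ f q t
  glue-lookup (suc Q) q t (s≤s q≤Q) in-piece with m≤n⇒m<n∨m≡n q≤Q
  ... | inj₂ refl rewrite T⇒true (≤⇒≤ᵇ (m≤m+n (s q) t)) = cong (f q) (m+n∸m≡n (s q) t)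
  ... | inj₁ q<Q
    rewrite ¬T⇒false (λ p → <⇒≱ in-piece (≤-trans (s-mono q<Q) (≤ᵇ⇒≤ (s Q) (s q + t) p))) =
    glue-lookup Q q t q<Q in-piece

  glue-piece : ∀ {μ A len} Q q l → q < Q → s q + l ≤ s (suc q) → s Q ≤ len →
               μ [ A , len ]≗ glue Q s f → μ [ A + s q , l ]≗ f q
  glue-piece {μ} {A} Q q l q<Q fits Q≤ h .at t t<l =
    trans (cong μ (+-assoc A (s q) t))
      (trans (h .at (s q + t) (<-≤-trans in-piece (≤-trans (s-mono q<Q) Q≤)))
             (glue-lookup Q q t q<Q in-piece))
    where
    in-piece : s q + t < s (suc q)
    in-piece = <-≤-trans (+-monoʳ-< (s q) t<l) fits

array-entry : ∀ {μ A len} Q W f q → q < Q → Q * W ≤ len →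
              μ [ A , len ]≗ array Q W f → μ [ A + q * W , W ]≗ f q
array-entry Q W f q q<Q =
  glue-piece (_* W) (*-monoˡ-≤ W) f Q q W q<Q (≤-reflexive (+-comm (q * W) W))

readWord-field : ∀ {w W μ A v} → W ≤ w → v < 2 ^ W → μ [ A , W ]≗ bit v →
                 truncate W (readWord w μ A) ≡ v
readWord-field {w} {W} {μ} {A} {v} W≤w v< h = begin
  truncate W (readWord w μ A)      ≡⟨ truncate-fromBits _ W≤w ⟩
  fromBits W (λ i → μ (A + i))     ≡⟨ fromBits-cong W (h .at) ⟩
  fromBits W (bit v)               ≡⟨ fromBits-bit W v v< ⟩
  v                                ∎
  where open ≡-Reasoning

-- Splitting the elements of a monotone sequence into low and high parts

Monotone : (ℕ → ℕ) → Set
Monotone v = ∀ {i j} → i ≤ j → v i ≤ v j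

-- The number of low bits split off a block of b elements of span s.
lowWidth : (b s : ℕ) → ℕ
lowWidth zero    s = 0
lowWidth (suc b) s = ⌊log₂ (s / suc b) ⌋

lowWidth-< : ∀ b s .{{_ : NonZero b}} → s < b * 2 ^ suc (lowWidth b s)
lowWidth-< b@(suc _) s = begin-strict
  s                          <⟨ m<m/n*n+n ⟩
  s / b * b + b              ≡⟨ +-comm (s / b * b) b ⟩
  suc (s / b) * b            ≤⟨ *-monoˡ-≤ b (<2^[1+log] (s / b)) ⟩
  2 ^ suc (lowWidth b s) * b ≡⟨ *-comm _ b ⟩
  b * 2 ^ suc (lowWidth b s) ∎
  where
  open ≤-Reasoning
  m<m/n*n+n : s < s / b * b + b
  m<m/n*n+n = <-≤-trans (s≤s (≤-reflexive (m≡[m/n]*n+m%n s b)))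
                (≤-trans (≤-reflexive (sym (+-suc _ _))) (+-monoʳ-≤ (s / b * b) (m%n<n s b)))

lowWidth-≤ : ∀ b s .{{_ : NonZero b}} → lowWidth b s ≡ 0 ⊎ b * 2 ^ lowWidth b s ≤ s
lowWidth-≤ b@(suc _) s with s / b | m/n*n≤m s b
... | zero  | _ = inj₁ refl
... | suc q | p = inj₂ (begin
  b * 2 ^ ⌊log₂ suc q ⌋  ≤⟨ *-monoʳ-≤ b (2^log≤ (suc q)) ⟩
  b * suc q              ≡⟨ *-comm b (suc q) ⟩
  suc q * b              ≤⟨ p ⟩
  s                      ∎)
  where open ≤-Reasoning

2^lowWidth≤ : ∀ b s .{{_ : NonZero b}} → 2 ^ lowWidth b s ≤ 1 ⊔ s
2^lowWidth≤ b s with lowWidth-≤ b s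
... | inj₁ eq rewrite eq = m≤m⊔n 1 s
... | inj₂ p = ≤-trans (≤-trans (m≤n*m _ b) p) (m≤n⊔m 1 s)

/2^-< : ∀ {a} c k → a < c * 2 ^ k → a /2^ k < c
/2^-< c k p = m<n*o⇒m/o<n {{m^n≢0 2 k}} p

/2^-*-≤ : ∀ k a → a /2^ k * 2 ^ k ≤ a
/2^-*-≤ k a = m/n*n≤m a (2 ^ k) {{m^n≢0 2 k}}

/2^-mono : ∀ k → Monotone (_/2^ k)
/2^-mono k = /-monoˡ-≤ (2 ^ k) {{m^n≢0 2 k}}

high-< : ∀ b s .{{_ : NonZero b}} → s /2^ lowWidth b s < 2 * b
high-< b s = /2^-< (2 * b) l (subst (s <_) eq (lowWidth-< b s))
  where
  l = lowWidth b s
  eq : b * (2 * 2 ^ l) ≡ 2 * b * 2 ^ l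
  eq = trans (sym (*-assoc b 2 (2 ^ l))) (cong (_* 2 ^ l) (*-comm b 2))

low+high≤ : ∀ b s .{{_ : NonZero b}} → b * lowWidth b s + s /2^ lowWidth b s ≤ s
low+high≤ b s with lowWidth-≤ b s
... | inj₁ eq rewrite eq | *-zeroʳ b = ≤-reflexive (n/1≡n s)
... | inj₂ p = begin
  b * l + h                 ≤⟨ +-monoˡ-≤ h (*-monoˡ-≤ l b≤h) ⟩
  h * l + h                 ≡⟨ +-comm (h * l) h ⟩
  h + h * l                 ≡⟨ *-suc h l ⟨
  h * suc l                 ≤⟨ *-monoʳ-≤ h (n<2^n l) ⟩
  h * 2 ^ l                 ≤⟨ /2^-*-≤ l s ⟩
  s                         ∎
  where
  open ≤-Reasoning
  l = lowWidth b s
  h = s /2^ l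
  b≤h : b ≤ h
  b≤h = ≤-trans (≤-reflexive (sym (m*n/n≡m b (2 ^ l) {{m^n≢0 2 l}}))) (/2^-mono l p)

-- Unary codes

unaryCode : (v : ℕ → ℕ) (b : ℕ) → Memory
unaryCode v zero    a = false
unaryCode v (suc b) a = (v b + b ≡ᵇ a) ∨ unaryCode v b a

unaryCode-true : ∀ v b i → i < b → unaryCode v b (v i + i) ≡ true
unaryCode-true v (suc b) i (s≤s i≤b) with m≤n⇒m<n∨m≡n i≤b
... | inj₂ refl rewrite T⇒true (≡⇒≡ᵇ (v i + i) (v i + i) refl) = refl
... | inj₁ i<b with v b + b ≡ᵇ v i + i
...   | true  = refl
...   | false = unaryCode-true v b i i<b

unaryCode-false : ∀ v b a → (∀ i → i < b → v i + i ≢ a) → unaryCode v b a ≡ false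
unaryCode-false v zero    a _  = refl
unaryCode-false v (suc b) a ≢a
  rewrite ¬T⇒false (λ p → ≢a b ≤-refl (≡ᵇ⇒≡ (v b + b) a p)) = unaryCode-false v b a (λ i i<b → ≢a i (m<n⇒m<1+n i<b))

-- The number of zeros before the one of (zero-based) index j.
decode : (k : ℕ) → Memory → ℕ → ℕ
decode zero    g j       = 0
decode (suc k) g zero    = if g 0 then 0 else suc (decode k (g ∘ suc) zero)
decode (suc k) g (suc j) = if g 0 then decode k (g ∘ suc) j else suc (decode k (g ∘ suc) (suc j))

decode-correct : ∀ k g v j → Monotone v → v j + j < k →
                 (∀ i → i ≤ j → g (v i + i) ≡ true) →
                 (∀ a → a < v j + j → (∀ i → i ≤ j → v i + i ≢ a) → g a ≡ false) →
                 decode k g j ≡ v j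
decode-correct (suc k) g v j mono j<k ones zeros with v 0 in v0
decode-correct (suc k) g v zero mono j<k ones zeros | zero
  rewrite subst (λ z → g (z + 0) ≡ true) v0 (ones 0 z≤n) = sym v0
decode-correct (suc k) g v (suc j) mono j<k ones zeros | zero
  rewrite subst (λ z → g (z + 0) ≡ true) v0 (ones 0 z≤n) =
  decode-correct k (g ∘ suc) (v ∘ suc) j (mono ∘ s≤s)
    (subst (_≤ k) (+-suc (v (suc j)) j) (s≤s⁻¹ j<k))
    (λ i i≤j → trans (cong g (sym (+-suc (v (suc i)) i))) (ones (suc i) (s≤s i≤j)))
    (λ a a< ≢a → zeros (suc a) (subst (suc a <_) (sym (+-suc (v (suc j)) j)) (s≤s a<))
      λ { zero _ eq → contradiction (trans (sym eq) (trans (+-identityʳ (v 0)) v0)) (λ ())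
        ; (suc i) (s≤s i≤j) eq → ≢a i i≤j (suc-injective (trans (sym (+-suc (v (suc i)) i)) eq)) })
decode-correct (suc k) g v j mono j<k ones zeros | suc x = go j refl
  where
  v≥1 : ∀ i → v i ≡ suc (v i ∸ 1)
  v≥1 i = sym (m+[n∸m]≡n (≤-trans (s≤s z≤n) (≤-trans (≤-reflexive (sym v0)) (mono z≤n))))
  g0 : g 0 ≡ false
  g0 = zeros 0 (subst (λ z → 0 < z + j) (sym (v≥1 j)) (s≤s z≤n))
         (λ i _ eq → contradiction (trans (sym (cong (_+ i) (v≥1 i))) eq) λ ())
  rec : decode k (g ∘ suc) j ≡ v j ∸ 1
  rec = decode-correct k (g ∘ suc) (λ i → v i ∸ 1) j (λ p → ∸-monoˡ-≤ 1 (mono p))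
    (s≤s⁻¹ (subst (λ z → z + j < suc k) (v≥1 j) j<k))
    (λ i i≤j → trans (cong (λ z → g (z + i)) (sym (v≥1 i))) (ones i i≤j))
    (λ a a< ≢a → zeros (suc a) (subst (λ z → suc a < z + j) (sym (v≥1 j)) (s≤s a<))
      (λ i i≤j eq → ≢a i i≤j (suc-injective (trans (sym (cong (_+ i) (v≥1 i))) eq))))
  go : ∀ j′ → j′ ≡ j → decode (suc k) g j′ ≡ v j′
  go zero     refl rewrite g0 = trans (cong suc rec) (sym (v≥1 0))
  go (suc j′) refl rewrite g0 = trans (cong suc rec) (sym (v≥1 (suc j′)))

decode-unaryCode : ∀ k c v b j → Monotone v → j < b → v j + j < k →
                   (∀ a → a < b + v b → bit c a ≡ unaryCode v b a) →
                   decode k (bit c) j ≡ v j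
decode-unaryCode k c v b j mono j<b j<k same =
  decode-correct k (bit c) v j mono j<k
    (λ i i≤j → trans (same _ (in-code i (≤-<-trans i≤j j<b))) (unaryCode-true v b i (≤-<-trans i≤j j<b)))
    (λ a a< ≢a → trans (same a (<-trans a< (in-code j j<b)))
      (unaryCode-false v b a λ i i<b eq → case≤ i eq ≢a a<))
  where
  in-code : ∀ i → i < b → v i + i < b + v b
  in-code i i<b = ≤-trans (≤-reflexive (sym (+-suc (v i) i)))
                    (≤-trans (+-mono-≤ (mono (<⇒≤ i<b)) i<b) (≤-reflexive (+-comm (v b) b)))
  case≤ : ∀ i {a} → v i + i ≡ a → (∀ i → i ≤ j → v i + i ≢ a) → ¬ (a < v j + j)
  case≤ i refl ≢a a< with i ≤? j
  ... | yes i≤j = ≢a i i≤j refl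
  ... | no  i≰j = <⇒≱ a< (+-mono-≤ (mono (<⇒≤ (≰⇒> i≰j))) (<⇒≤ (≰⇒> i≰j)))

-- Straight-line programs, compiled from sequences of assignments

Store : Set
Store = Register → ℕ

data Exp : Set where
  var : Register → Exp
  lit : ℕ → Exp
  bin : Op → Exp → Exp → Exp
  pop ld : Exp → Exp

isVar : Exp → Bool
isVar (var _) = true
isVar _       = false

varsBelow : ℕ → Exp → Bool
varsBelow t (var r)     = r <ᵇ t
varsBelow t (lit k)     = true
varsBelow t (bin o a b) = varsBelow t a ∧ varsBelow t b
varsBelow t (pop a)     = varsBelow t a
varsBelow t (ld a)      = varsBelow t a

Block : Set
Block = List (Register × Exp)

-- The operand a is in register operand a t after running prepare a t, which
-- only writes to registers from t on.
operand : Exp → Register → Register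
operand (var r) t = r
operand _       t = t

prepare : Exp → Register → List Instr
compile : Exp → (d t : Register) → List Instr

prepare e@(var _)     t = []
prepare e@(lit _)     t = compile e t t
prepare e@(bin _ _ _) t = compile e t t
prepare e@(pop _)     t = compile e t t
prepare e@(ld _)      t = compile e t t

compile (var r)     d t = []
compile (lit k)     d t = const d k ∷ []
compile (bin o a b) d t = prepare a t ++ prepare b (suc t) ++ op o d (operand a t) (operand b (suc t)) ∷ []
compile (pop a)     d t = prepare a t ++ pop d (operand a t) ∷ []
compile (ld a)      d t = prepare a t ++ load d (operand a t) ∷ []

firstTemporary : Register
firstTemporary = 40

wellFormed : Block → Bool
wellFormed []            = true
wellFormed ((r , e) ∷ B) =
  (not (isVar e) ∧ varsBelow firstTemporary e) ∧ ((r <ᵇ firstTemporary) ∧ wellFormed B)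

compileBlock : Block → List Instr
compileBlock []            = []
compileBlock ((r , e) ∷ B) = compile e r firstTemporary ++ compileBlock B

avoids : Register → Block → Bool
avoids r []            = true
avoids r ((d , _) ∷ B) = not (r ≡ᵇ d) ∧ avoids r B

At : Program → ℕ → List Instr → Set
At p k []       = ⊤
At p k (i ∷ is) = fetch p k ≡ just i × At p (suc k) is

At-∷ : ∀ {i p k} is → At p k is → At (i ∷ p) (suc k) is
At-∷ []       _       = tt
At-∷ (_ ∷ is) (q , a) = q , At-∷ is a

At-suffix : ∀ pre code → At (pre ++ code) (length pre) code
At-suffix []        []         = tt
At-suffix []        (i ∷ code) = refl , At-∷ code (At-suffix [] code)
At-suffix (_ ∷ pre) code       = At-∷ code (At-suffix pre code)

At-++ : ∀ {p k} is {js} → At p k (is ++ js) → At p k is × At p (length is + k) js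
At-++         []       a       = tt , a
At-++ {p} {k} (i ∷ is) {js} (q , a) =
  let a₁ , a₂ = At-++ is a in (q , a₁) , subst (λ z → At p z js) (+-suc (length is) k) a₂

setReg-≡ : ∀ ρ r v → setReg ρ r v r ≡ v
setReg-≡ ρ r v rewrite T⇒true (≡⇒≡ᵇ r r refl) = refl

setReg-≢ : ∀ ρ {r v s} → s ≢ r → setReg ρ r v s ≡ ρ s
setReg-≢ ρ {r} {v} {s} s≢r rewrite ¬T⇒false (s≢r ∘ ≡ᵇ⇒≡ s r) = refl

∧-split : ∀ {a b} → a ∧ b ≡ true → a ≡ true × b ≡ true
∧-split {true} {true} _ = refl , refl

<ᵇ-true : ∀ {m n} → (m <ᵇ n) ≡ true → m < n
<ᵇ-true {m} {n} eq = <ᵇ⇒< m n (subst T (sym eq) tt)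

module Machine (w : ℕ) (μ : Memory) where

  val : Store → Exp → ℕ
  val σ (var r)     = σ r
  val σ (lit k)     = truncate w k
  val σ (bin o a b) = evalOp w o (val σ a) (val σ b)
  val σ (pop a)     = truncate w (popcount w (val σ a))
  val σ (ld a)      = readWord w μ (val σ a)

  effect : Instr → Store → Store
  effect (const r k)  ρ = setReg ρ r (truncate w k)
  effect (op o r a b) ρ = setReg ρ r (evalOp w o (ρ a) (ρ b))
  effect (pop r a)    ρ = setReg ρ r (truncate w (popcount w (ρ a)))
  effect (load r a)   ρ = setReg ρ r (readWord w μ (ρ a))
  effect _            ρ = ρ

  effects : List Instr → Store → Store
  effects []       ρ = ρ
  effects (i ∷ is) ρ = effects is (effect i ρ)

  effects-++ : ∀ is js ρ → effects (is ++ js) ρ ≡ effects js (effects is ρ)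
  effects-++ []       js ρ = refl
  effects-++ (i ∷ is) js ρ = effects-++ is js (effect i ρ)

  val-cong : ∀ t e {ρ σ : Store} → varsBelow t e ≡ true → (∀ r → r < t → ρ r ≡ σ r) → val ρ e ≡ val σ e
  val-cong t (var r)     ok h = h r (<ᵇ-true ok)
  val-cong t (lit k)     ok h = refl
  val-cong t (bin o a b) ok h =
    cong₂ (evalOp w o) (val-cong t a (proj₁ (∧-split ok)) h) (val-cong t b (proj₂ (∧-split ok)) h)
  val-cong t (pop a)     ok h = cong (truncate w ∘ popcount w) (val-cong t a ok h)
  val-cong t (ld a)      ok h = cong (readWord w μ) (val-cong t a ok h)

  varsBelow-suc : ∀ t e → varsBelow t e ≡ true → varsBelow (suc t) e ≡ true
  varsBelow-suc t (var r)     ok = T⇒true (<⇒<ᵇ (m<n⇒m<1+n (<ᵇ-true {r} ok)))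
  varsBelow-suc t (lit k)     ok = refl
  varsBelow-suc t (bin o a b) ok
    rewrite varsBelow-suc t a (proj₁ (∧-split ok)) | varsBelow-suc t b (proj₂ (∧-split ok)) = refl
  varsBelow-suc t (pop a)     ok = varsBelow-suc t a ok
  varsBelow-suc t (ld a)      ok = varsBelow-suc t a ok

  Computes : List Instr → (d t : Register) → ℕ → Store → Set
  Computes is d t v ρ = effects is ρ d ≡ v × (∀ r → r < t → r ≢ d → effects is ρ r ≡ ρ r)

  operand< : ∀ e t → varsBelow t e ≡ true → operand e t < suc t
  operand< (var r)     t ok = m<n⇒m<1+n (<ᵇ-true ok)
  operand< (lit _)     t ok = ≤-refl
  operand< (bin _ _ _) t ok = ≤-refl
  operand< (pop _)     t ok = ≤-refl
  operand< (ld _)      t ok = ≤-refl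

  compile-correct : ∀ e d t ρ → isVar e ≡ false → varsBelow t e ≡ true →
                    Computes (compile e d t) d t (val ρ e) ρ
  prepare-correct : ∀ e t ρ → varsBelow t e ≡ true →
                    effects (prepare e t) ρ (operand e t) ≡ val ρ e ×
                    (∀ r → r < t → effects (prepare e t) ρ r ≡ ρ r)

  compile-correct (lit k) d t ρ _ ok = setReg-≡ ρ d _ , λ r _ → setReg-≢ ρ
  compile-correct (bin o a b) d t ρ _ ok
    rewrite effects-++ (prepare a t) (prepare b (suc t) ++ op o d (operand a t) (operand b (suc t)) ∷ []) ρ
          | effects-++ (prepare b (suc t)) (op o d (operand a t) (operand b (suc t)) ∷ []) (effects (prepare a t) ρ)
    = trans (setReg-≡ ρ₂ d _) (cong₂ (evalOp w o) va vb)
    , λ r r<t r≢d → trans (setReg-≢ ρ₂ r≢d) (trans (keepb r (m<n⇒m<1+n r<t)) (keepa r r<t))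
    where
    ρ₁ = effects (prepare a t) ρ
    ρ₂ = effects (prepare b (suc t)) ρ₁
    oka = proj₁ (∧-split {varsBelow t a} ok)
    okb = proj₂ (∧-split {varsBelow t a} ok)
    corra = prepare-correct a t ρ oka
    keepa = proj₂ corra
    corrb = prepare-correct b (suc t) ρ₁ (varsBelow-suc t b okb)
    keepb = proj₂ corrb
    va : ρ₂ (operand a t) ≡ val ρ a
    va = trans (keepb (operand a t) (operand< a t oka)) (proj₁ corra)
    vb : ρ₂ (operand b (suc t)) ≡ val ρ b
    vb = trans (proj₁ corrb) (val-cong t b okb keepa)
  compile-correct (pop a) d t ρ _ ok
    rewrite effects-++ (prepare a t) (pop d (operand a t) ∷ []) ρ
    = trans (setReg-≡ (effects (prepare a t) ρ) d _) (cong (truncate w ∘ popcount w) (proj₁ corra))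
    , λ r r<t r≢d → trans (setReg-≢ (effects (prepare a t) ρ) r≢d) (proj₂ corra r r<t)
    where corra = prepare-correct a t ρ ok
  compile-correct (ld a) d t ρ _ ok
    rewrite effects-++ (prepare a t) (load d (operand a t) ∷ []) ρ
    = trans (setReg-≡ (effects (prepare a t) ρ) d _) (cong (readWord w μ) (proj₁ corra))
    , λ r r<t r≢d → trans (setReg-≢ (effects (prepare a t) ρ) r≢d) (proj₂ corra r r<t)
    where corra = prepare-correct a t ρ ok

  prepare-correct (var r) t ρ ok = refl , λ _ _ → refl
  prepare-correct e@(lit _) t ρ ok =
    let v , keep = compile-correct e t t ρ refl ok in v , λ r r<t → keep r r<t (<⇒≢ r<t)
  prepare-correct e@(bin _ _ _) t ρ ok =
    let v , keep = compile-correct e t t ρ refl ok in v , λ r r<t → keep r r<t (<⇒≢ r<t)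
  prepare-correct e@(pop _) t ρ ok =
    let v , keep = compile-correct e t t ρ refl ok in v , λ r r<t → keep r r<t (<⇒≢ r<t)
  prepare-correct e@(ld _) t ρ ok =
    let v , keep = compile-correct e t t ρ refl ok in v , λ r r<t → keep r r<t (<⇒≢ r<t)

  data Exec : Block → Store → Store → Set where
    []  : ∀ {σ} → Exec [] σ σ
    _∷_ : ∀ {σ τ r e v B} → val σ e ≡ v → Exec B (setReg σ r v) τ → Exec ((r , e) ∷ B) σ τ

  Exec-++ : ∀ {B C σ τ υ} → Exec B σ τ → Exec C τ υ → Exec (B ++ C) σ υ
  Exec-++ []       y = y
  Exec-++ (p ∷ x) y = p ∷ Exec-++ x y

  Exec-frame : ∀ {B σ τ} r → avoids r B ≡ true → Exec B σ τ → τ r ≡ σ r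
  Exec-frame r ok [] = refl
  Exec-frame {(d , _) ∷ _} {σ} r ok (_∷_ p x) with r ≡ᵇ d in eq
  ... | false = trans (Exec-frame r ok x) (setReg-≢ σ (λ r≡d → contradiction (trans (sym eq) (T⇒true (≡⇒≡ᵇ r d r≡d))) λ ()))

  _≈_ : Store → Store → Set
  ρ ≈ σ = ∀ r → r < firstTemporary → ρ r ≡ σ r

  compileBlock-correct : ∀ B {σ τ ρ} → wellFormed B ≡ true → Exec B σ τ → ρ ≈ σ → effects (compileBlock B) ρ ≈ τ
  compileBlock-correct [] ok [] h = h
  compileBlock-correct ((d , e) ∷ B) {σ} {τ} {ρ} ok (refl ∷ x) h
    rewrite effects-++ (compile e d firstTemporary) (compileBlock B) ρ =
    compileBlock-correct B okB x h′
    where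
    oke = ∧-split {not (isVar e)} (proj₁ (∧-split ok))
    okB = proj₂ (∧-split {d <ᵇ firstTemporary} (proj₂ (∧-split {not (isVar e) ∧ varsBelow firstTemporary e} ok)))
    not-true : ∀ b → not b ≡ true → b ≡ false
    not-true false _ = refl
    corr = compile-correct e d firstTemporary ρ (not-true (isVar e) (proj₁ oke)) (proj₂ oke)
    h′ : effects (compile e d firstTemporary) ρ ≈ setReg σ d (val σ e)
    h′ r r< with r ≟ d
    ... | yes refl = trans (proj₁ corr) (trans (val-cong firstTemporary e (proj₂ oke) h) (sym (setReg-≡ σ d _)))
    ... | no  r≢d  = trans (proj₂ corr r r< r≢d) (trans (h r r<) (sym (setReg-≢ σ r≢d)))

  data StraightLine : List Instr → Set where
    []     : StraightLine []
    constˢ : ∀ {r k is} → StraightLine is → StraightLine (const r k ∷ is)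
    opˢ    : ∀ {o r a b is} → StraightLine is → StraightLine (op o r a b ∷ is)
    popˢ   : ∀ {r a is} → StraightLine is → StraightLine (pop r a ∷ is)
    loadˢ  : ∀ {r a is} → StraightLine is → StraightLine (load r a ∷ is)

  StraightLine-++ : ∀ {is js} → StraightLine is → StraightLine js → StraightLine (is ++ js)
  StraightLine-++ []         y = y
  StraightLine-++ (constˢ x) y = constˢ (StraightLine-++ x y)
  StraightLine-++ (opˢ x)    y = opˢ (StraightLine-++ x y)
  StraightLine-++ (popˢ x)   y = popˢ (StraightLine-++ x y)
  StraightLine-++ (loadˢ x)  y = loadˢ (StraightLine-++ x y)

  compile-straight : ∀ e d t → StraightLine (compile e d t)
  prepare-straight : ∀ e t → StraightLine (prepare e t)

  compile-straight (var r)     d t = []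
  compile-straight (lit k)     d t = constˢ []
  compile-straight (bin o a b) d t =
    StraightLine-++ (prepare-straight a t) (StraightLine-++ (prepare-straight b (suc t)) (opˢ []))
  compile-straight (pop a)     d t = StraightLine-++ (prepare-straight a t) (popˢ [])
  compile-straight (ld a)      d t = StraightLine-++ (prepare-straight a t) (loadˢ [])

  prepare-straight (var r)       t = []
  prepare-straight e@(lit _)     t = compile-straight e t t
  prepare-straight e@(bin _ _ _) t = compile-straight e t t
  prepare-straight e@(pop _)     t = compile-straight e t t
  prepare-straight e@(ld _)      t = compile-straight e t t

  compileBlock-straight : ∀ B → StraightLine (compileBlock B)
  compileBlock-straight []            = []
  compileBlock-straight ((r , e) ∷ B) = StraightLine-++ (compile-straight e r firstTemporary) (compileBlock-straight B)

  run-straight : ∀ p is k ρ t → StraightLine is → At p k is →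
                 run p w (length is + t) ⟨ k , ρ , μ ⟩ ≡ run p w t ⟨ length is + k , effects is ρ , μ ⟩
  run-straight p [] k ρ t [] _ = refl
  run-straight p (i ∷ is) k ρ t sl (q , a)
    rewrite q | sym (+-suc (length is) k) = go sl
    where
    go : StraightLine (i ∷ is) →
         exec p w (length is + t) (just i) ⟨ k , ρ , μ ⟩ ≡ run p w t ⟨ length is + suc k , effects is (effect i ρ) , μ ⟩
    go (constˢ s) = run-straight p is (suc k) _ t s a
    go (opˢ s)    = run-straight p is (suc k) _ t s a
    go (popˢ s)   = run-straight p is (suc k) _ t s a
    go (loadˢ s)  = run-straight p is (suc k) _ t s a

  run-mono : ∀ p {t t′ c a} → t ≤ t′ → run p w t c ≡ just a → run p w t′ c ≡ just a
  exec-mono : ∀ p {t t′ c a} i → t ≤ t′ → exec p w t i c ≡ just a → exec p w t′ i c ≡ just a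
  run-mono p {c = c} (s≤s t≤) h = exec-mono p (fetch p (Config.pc c)) t≤ h
  exec-mono p (just (const r k))  t≤ h = run-mono p t≤ h
  exec-mono p (just (op o r a b)) t≤ h = run-mono p t≤ h
  exec-mono p (just (pop r a))    t≤ h = run-mono p t≤ h
  exec-mono p (just (load r a))   t≤ h = run-mono p t≤ h
  exec-mono p (just (store a v))  t≤ h = run-mono p t≤ h
  exec-mono p (just (jump l))     t≤ h = run-mono p t≤ h
  exec-mono p (just (jz r l))     t≤ h = run-mono p t≤ h
  exec-mono p (just (halt r))     t≤ h = h

  run-block : ∀ p B k {σ τ ρ} t → wellFormed B ≡ true → At p k (compileBlock B) → Exec B σ τ → ρ ≈ σ →
              ∃[ ρ′ ] (ρ′ ≈ τ × run p w (length (compileBlock B) + t) ⟨ k , ρ , μ ⟩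
                              ≡ run p w t ⟨ length (compileBlock B) + k , ρ′ , μ ⟩)
  run-block p B k {ρ = ρ} t ok here x h =
    effects (compileBlock B) ρ , compileBlock-correct B ok x h ,
    run-straight p (compileBlock B) k ρ t (compileBlock-straight B) here

infixl 6 _:+_ _:-_
infixl 7 _:*_ _:/_ _:%_

_:+_ _:-_ _:*_ _:/_ _:%_ : Exp → Exp → Exp
_:+_ = bin add
_:-_ = bin sub
_:*_ = bin mul
_:/_ = bin div
_:%_ = bin mod

pow2 : Exp → Exp
pow2 e = bin shl (lit 1) e

readField : (A W : Exp) → Exp
readField A W = ld A :% pow2 W

-- Reads off the length of a run of ones as in popcount-suc.
readUnary : Exp → Exp
readUnary A = (pop (ld A) :+ lit 1) :- pop (ld A :+ lit 1)

-- Evaluation without overflow on words of 64 * s bits. A judgement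
-- σ ⊢ e ⇓ v ∶ a bounds the value by 2 ^ (a * s), so that overflow is excluded
-- by looking at the literals a only.
module Evaluation (s : ℕ) (1≤s : 1 ≤ s) (μ : Memory) where

  w : ℕ
  w = 64 * s

  open Machine w μ public

  infix 4 _⊢_⇓_∶_

  record _⊢_⇓_∶_ (σ : Store) (e : Exp) (v a : ℕ) : Set where
    constructor ⇓
    field
      eval : val σ e ≡ v
      fits : v < 2 ^ (a * s)

  open _⊢_⇓_∶_ public

  ok : ∀ {k} {_ : T (k ≤ᵇ 64)} → k ≤ 64
  ok {k} {p} = ≤ᵇ⇒≤ k 64 p

  fits-≤ : ∀ {a b v} → a ≤ b → v < 2 ^ (a * s) → v < 2 ^ (b * s)
  fits-≤ a≤b p = <-≤-trans p (^-monoʳ-≤ 2 (*-monoˡ-≤ s a≤b))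

  fits-word : ∀ {a v} → a ≤ 64 → v < 2 ^ (a * s) → truncate w v ≡ v
  fits-word a≤ p = truncate-id {w} (fits-≤ a≤ p)

  fits-+ : ∀ {a b x y} → x < 2 ^ (a * s) → y < 2 ^ (b * s) → x + y < 2 ^ (suc (a ⊔ b) * s)
  fits-+ {a} {b} {x} {y} p q = begin-strict
    x + y                      <⟨ +-mono-< (fits-≤ (m≤m⊔n a b) p) (fits-≤ (m≤n⊔m a b) q) ⟩
    M + M                      ≡⟨ cong (M +_) (+-identityʳ M) ⟨
    2 * M                      ≤⟨ *-monoˡ-≤ M (^-monoʳ-≤ 2 1≤s) ⟩
    2 ^ s * M                  ≡⟨ ^-distribˡ-+-* 2 s ((a ⊔ b) * s) ⟨
    2 ^ (suc (a ⊔ b) * s)      ∎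
    where
    open ≤-Reasoning
    M = 2 ^ ((a ⊔ b) * s)

  fits-* : ∀ {a b x y} → x < 2 ^ (a * s) → y < 2 ^ (b * s) → x * y < 2 ^ ((a + b) * s)
  fits-* {a} {b} {x} {y} p q = begin-strict
    x * y                      <⟨ *-mono-< p q ⟩
    2 ^ (a * s) * 2 ^ (b * s)  ≡⟨ ^-distribˡ-+-* 2 (a * s) (b * s) ⟨
    2 ^ (a * s + b * s)        ≡⟨ cong (2 ^_) (*-distribʳ-+ s a b) ⟨
    2 ^ ((a + b) * s)          ∎
    where open ≤-Reasoning

  fits-lit : ∀ {a k} → k < 2 ^ a → k < 2 ^ (a * s)
  fits-lit {a} p = <-≤-trans p (^-monoʳ-≤ 2 (≤-trans (≤-reflexive (sym (*-identityʳ a))) (*-monoʳ-≤ a 1≤s)))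

  module _ {σ : Store} where

    ⇓-bound : ∀ {e v a} b → v < 2 ^ (b * s) → σ ⊢ e ⇓ v ∶ a → σ ⊢ e ⇓ v ∶ b
    ⇓-bound b q (⇓ p _) = ⇓ p q

    ⇓-cong : ∀ {e v v′ a} → v ≡ v′ → σ ⊢ e ⇓ v ∶ a → σ ⊢ e ⇓ v′ ∶ a
    ⇓-cong refl x = x

    ⇓var : ∀ {r v} a → σ r ≡ v → v < 2 ^ (a * s) → σ ⊢ var r ⇓ v ∶ a
    ⇓var a = ⇓

    ⇓lit : ∀ k a {_ : T (k <ᵇ 2 ^ a)} {_ : T (a ≤ᵇ 64)} → σ ⊢ lit k ⇓ k ∶ a
    ⇓lit k a {p} {q} = ⇓ (fits-word (≤ᵇ⇒≤ a 64 q) k<) k<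
      where k< = fits-lit {a} (<ᵇ⇒< k (2 ^ a) p)

    ⇓+ : ∀ {e f x y a b} → σ ⊢ e ⇓ x ∶ a → σ ⊢ f ⇓ y ∶ b → suc (a ⊔ b) ≤ 64 → σ ⊢ e :+ f ⇓ x + y ∶ suc (a ⊔ b)
    ⇓+ {a = a} {b} (⇓ refl p) (⇓ refl q) h = ⇓ (fits-word h pq) pq
      where pq = fits-+ {a} {b} p q

    ⇓* : ∀ {e f x y a b} → σ ⊢ e ⇓ x ∶ a → σ ⊢ f ⇓ y ∶ b → a + b ≤ 64 → σ ⊢ e :* f ⇓ x * y ∶ a + b
    ⇓* {a = a} {b} (⇓ refl p) (⇓ refl q) h = ⇓ (fits-word h pq) pq
      where pq = fits-* {a} {b} p q

    ⇓- : ∀ {e f x y a b} → σ ⊢ e ⇓ x ∶ a → σ ⊢ f ⇓ y ∶ b → y ≤ x → a ≤ 64 → σ ⊢ e :- f ⇓ x ∸ y ∶ a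
    ⇓- {x = x} {y} {a} (⇓ refl p) (⇓ refl q) y≤x h = ⇓ eq (≤-<-trans (m∸n≤m x y) p)
      where
      y≤2^w : y ≤ 2 ^ w
      y≤2^w = ≤-trans y≤x (<⇒≤ (fits-≤ h p))
      eq : truncate w (x + (2 ^ w ∸ y)) ≡ x ∸ y
      eq = begin
        truncate w (x + (2 ^ w ∸ y))            ≡⟨ cong (truncate w) (+-∸-assoc x y≤2^w) ⟨
        truncate w (x + 2 ^ w ∸ y)              ≡⟨ cong (truncate w) (+-∸-comm (2 ^ w) y≤x) ⟩
        truncate w ((x ∸ y) + 2 ^ w)            ≡⟨ [m+n]%n≡m%n (x ∸ y) (2 ^ w) {{m^n≢0 2 w}} ⟩
        truncate w (x ∸ y)                      ≡⟨ fits-word h (≤-<-trans (m∸n≤m x y) p) ⟩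
        x ∸ y                                   ∎
        where open ≡-Reasoning

    ⇓/ : ∀ {e f x y a b} .{{_ : NonZero y}} → σ ⊢ e ⇓ x ∶ a → σ ⊢ f ⇓ y ∶ b → a ≤ 64 → σ ⊢ e :/ f ⇓ x / y ∶ a
    ⇓/ {e} {f} {x} {y@(suc _)} (⇓ p p′) (⇓ q _) h = ⇓ (trans (cong₂ (evalOp w div) p q) (fits-word h xy)) xy
      where xy = ≤-<-trans (m/n≤m x y) p′

    ⇓% : ∀ {e f x y a b} .{{_ : NonZero y}} → σ ⊢ e ⇓ x ∶ a → σ ⊢ f ⇓ y ∶ b → b ≤ 64 → σ ⊢ e :% f ⇓ x % y ∶ b
    ⇓% {e} {f} {x} {y@(suc _)} (⇓ p _) (⇓ q q′) h = ⇓ (trans (cong₂ (evalOp w mod) p q) (fits-word h xy)) xy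
      where xy = <-trans (m%n<n x y) q′

    ⇓pow2 : ∀ {e x a} b → σ ⊢ e ⇓ x ∶ a → 2 ^ x < 2 ^ (b * s) → b ≤ 64 → σ ⊢ pow2 e ⇓ 2 ^ x ∶ b
    ⇓pow2 {e} {x} b (⇓ refl p) q h =
      ⇓ (trans (cong (λ z → truncate w (z * 2 ^ x)) (eval (⇓lit 1 1)))
           (trans (cong (truncate w) (*-identityˡ (2 ^ x))) (fits-word h q))) q

    ⇓lt : ∀ {e f x y a b} → σ ⊢ e ⇓ x ∶ a → σ ⊢ f ⇓ y ∶ b → σ ⊢ bin lt e f ⇓ (if x <ᵇ y then 1 else 0) ∶ 1
    ⇓lt {x = x} {y} (⇓ refl p) (⇓ refl q) = ⇓ (fits-word {1} ok b<) b<
      where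
      b< : (if x <ᵇ y then 1 else 0) < 2 ^ (1 * s)
      b< with x <ᵇ y
      ... | true  = fits-lit {1} (s≤s (s≤s z≤n))
      ... | false = 2^-pos (1 * s)

    ⇓window : ∀ {e f A W a b} c → σ ⊢ e ⇓ A ∶ a → σ ⊢ f ⇓ W ∶ b → 2 ^ W < 2 ^ (c * s) → c ≤ 64 →
              σ ⊢ readField e f ⇓ truncate W (readWord w μ A) ∶ c
    ⇓window {e} {f} {A} {W} c (⇓ p p′) W⇓ q h =
      ⇓% {{m^n≢0 2 W}} (⇓ {a = 64} (cong (readWord w μ) p) (fromBits< w _)) (⇓pow2 c W⇓ q h) h

    ⇓field : ∀ {e f A W v a b} c → σ ⊢ e ⇓ A ∶ a → σ ⊢ f ⇓ W ∶ b → 2 ^ W < 2 ^ (c * s) → c ≤ 64 →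
             v < 2 ^ W → μ [ A , W ]≗ bit v → σ ⊢ readField e f ⇓ v ∶ c
    ⇓field {W = W} c A⇓ W⇓ q h v< m =
      ⇓-cong (readWord-field {w} {W} (<⇒≤ (<-≤-trans (2^-cancel-< {W} q) (*-monoˡ-≤ s h))) v< m) (⇓window c A⇓ W⇓ q h)

  ⇓unary : ∀ {σ e A ℓ a} → σ ⊢ e ⇓ A ∶ a → ℓ < 2 ^ (1 * s) → ℓ < w → μ [ A , suc ℓ ]≗ (_<ᵇ ℓ) →
           σ ⊢ readUnary e ⇓ ℓ ∶ 1
  ⇓unary {σ} {e} {A} {ℓ} (⇓ refl _) ℓ<N ℓ<w m =
    ⇓-bound 1 ℓ<N (⇓-cong difference (⇓- (⇓+ (⇓ {a = 8} (count x) (small x)) (⇓lit 1 1) ok)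
                                       (⇓ {a = 8} (trans (cong (truncate w ∘ popcount w) x+1) (count (suc x))) (small (suc x)))
                                       (subst (popcount w (suc x) ≤_) (sym (proj₂ trailing)) (m≤m+n _ ℓ)) ok))
    where
    x = readWord w μ A
    trailing : suc x < 2 ^ w × popcount w x + 1 ≡ popcount w (suc x) + ℓ
    trailing = popcount-suc ℓ w (λ i → μ (A + i)) ℓ<w
      (λ i i<ℓ → trans (m .at i (m<n⇒m<1+n i<ℓ)) (T⇒true (<⇒<ᵇ i<ℓ)))
      (trans (m .at ℓ ≤-refl) (¬T⇒false (λ p → <-irrefl refl (<ᵇ⇒< ℓ ℓ p))))
    small : ∀ y → popcount w y < 2 ^ (8 * s)
    small y = ≤-<-trans (popcount≤ w y) (fits-* {7} {1} (fits-lit {7} {64} (<ᵇ⇒< 64 128 tt))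
                (subst (λ z → s < 2 ^ z) (sym (+-identityʳ s)) (n<2^n s)))
    count : ∀ y → truncate w (popcount w y) ≡ popcount w y
    count y = fits-word {8} ok (small y)
    x+1 : truncate w (x + truncate w 1) ≡ suc x
    x+1 = trans (cong (λ z → truncate w (x + z)) (fits-word {1} ok (fits-lit {1} (s≤s (s≤s z≤n)))))
            (trans (cong (truncate w) (+-comm x 1)) (truncate-id {w} (proj₁ trailing)))
    difference : popcount w x + 1 ∸ popcount w (suc x) ≡ ℓ
    difference = trans (cong (_∸ popcount w (suc x)) (proj₂ trailing)) (m+n∸m≡n (popcount w (suc x)) ℓ)

  infixr 5 _▸_

  _▸_ : ∀ {σ τ r e v a B} → σ ⊢ e ⇓ v ∶ a → Exec B (setReg σ r v) τ → Exec ((r , e) ∷ B) σ τ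
  ⇓ p _ ▸ x = p ∷ x

-- Representations of monotone sequences

highPart : (N : ℕ) → (ℕ → ℕ) → ℕ → ℕ
highPart N v i = v i /2^ lowWidth N (v N)

lowParts : (N : ℕ) → (ℕ → ℕ) → Memory
lowParts N v = array N l (λ i → bit (truncate l (v i)))
  where l = lowWidth N (v N)

block : (N : ℕ) → ((ℕ → ℕ) → Memory) → (ℕ → ℕ) → Memory
block N rest v = cat (N * lowWidth N (v N)) (lowParts N v) (rest (highPart N v))

segment : (b : ℕ) → (ℕ → ℕ) → ℕ → ℕ → ℕ
segment b u q r = u (q * b + r) ∸ u (q * b)

segmentWidth : (b : ℕ) → (ℕ → ℕ) → ℕ → ℕ
segmentWidth b u q = lowWidth b (segment b u q b)

-- A segment may use st bits plus its span. Thus its address is determined by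
-- q and u (q * b), and no pointer is stored.
segmentStart : (b st : ℕ) → (ℕ → ℕ) → ℕ → ℕ
segmentStart b st u q = q * st + u (q * b)

bases widths : (b W Q : ℕ) → (ℕ → ℕ) → Memory
bases  b W Q u = array Q W (λ q → bit (u (q * b)))
widths b W Q u = array Q W (λ q → bit (segmentWidth b u q))

contents : (b Q st : ℕ) → ((ℕ → ℕ) → Memory) → (ℕ → ℕ) → Memory
contents b Q st rep u = glue Q (segmentStart b st u) (λ q → rep (segment b u q))

segments : (b W Q st : ℕ) → ((ℕ → ℕ) → Memory) → (ℕ → ℕ) → Memory
segments b W Q st rep u =
  cat (Q * W) (bases b W Q u) (cat (Q * W) (widths b W Q u) (contents b Q st rep u))

blockLength : (N : ℕ) → (ℕ → ℕ) → ℕ → ℕ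
blockLength N v k = N * lowWidth N (v N) + k

segmentsLength : (b W Q st : ℕ) → (ℕ → ℕ) → ℕ
segmentsLength b W Q st u = Q * W + (Q * W + segmentStart b st u Q)

highPart-mono : ∀ N {v} → Monotone v → Monotone (highPart N v)
highPart-mono N {v} mono p = /2^-mono (lowWidth N (v N)) (mono p)

segment-mono : ∀ b q {u} → Monotone u → Monotone (segment b u q)
segment-mono b q {u} mono p = ∸-monoˡ-≤ (u (q * b)) (mono (+-monoʳ-≤ (q * b) p))

segmentStart-mono : ∀ b st {u} → Monotone u → Monotone (segmentStart b st u)
segmentStart-mono b st mono p = +-mono-≤ (*-monoˡ-≤ st p) (mono (*-monoˡ-≤ b p))

segmentWidth<2^ : ∀ {b u q} W .{{_ : NonZero b}} → Monotone u → u (q * b + b) < 2 ^ W → segmentWidth b u q < 2 ^ W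
segmentWidth<2^ {b} {u} {q} W mono u< with lowWidth-≤ b (segment b u q b)
... | inj₁ eq = subst (_< 2 ^ W) (sym eq) (2^-pos W)
... | inj₂ p  = begin-strict
  l                   <⟨ n<2^n l ⟩
  2 ^ l               ≤⟨ m≤n*m (2 ^ l) b ⟩
  b * 2 ^ l           ≤⟨ p ⟩
  segment b u q b     ≤⟨ m∸n≤m _ (u (q * b)) ⟩
  u (q * b + b)       <⟨ u< ⟩
  2 ^ W               ∎
  where
  open ≤-Reasoning
  l = segmentWidth b u q

module _ {μ : Memory} {A : ℕ} where

  block-low : ∀ N rest v {k i} → μ [ A , blockLength N v k ]≗ block N rest v → i < N →
              μ [ A + i * lowWidth N (v N) , lowWidth N (v N) ]≗ bit (truncate (lowWidth N (v N)) (v i))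
  block-low N rest v {i = i} m i<N =
    array-entry N l _ i i<N ≤-refl (cat-left (N * l) (lowParts N v) (rest (highPart N v)) (m≤m+n (N * l) _) m)
    where l = lowWidth N (v N)

  block-high : ∀ N rest v {k} → μ [ A , blockLength N v k ]≗ block N rest v →
               μ [ A + N * lowWidth N (v N) , k ]≗ rest (highPart N v)
  block-high N rest v m = cat-right (N * lowWidth N (v N)) _ (lowParts N v) (rest (highPart N v)) m

  segments-tail : ∀ b W Q st rep u → μ [ A , segmentsLength b W Q st u ]≗ segments b W Q st rep u →
                  μ [ A + Q * W , Q * W + segmentStart b st u Q ]≗ cat (Q * W) (widths b W Q u) (contents b Q st rep u)
  segments-tail b W Q st rep u m = cat-right (Q * W) _ (bases b W Q u) (cat (Q * W) (widths b W Q u) (contents b Q st rep u)) m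

  segments-base : ∀ b W Q st rep u {q} → μ [ A , segmentsLength b W Q st u ]≗ segments b W Q st rep u → q < Q →
                  μ [ A + q * W , W ]≗ bit (u (q * b))
  segments-base b W Q st rep u {q} m q<Q =
    array-entry Q W _ q q<Q ≤-refl
      (cat-left (Q * W) (bases b W Q u) (cat (Q * W) (widths b W Q u) (contents b Q st rep u)) (m≤m+n (Q * W) _) m)

  segments-width : ∀ b W Q st rep u {q} → μ [ A , segmentsLength b W Q st u ]≗ segments b W Q st rep u → q < Q →
                   μ [ A + Q * W + q * W , W ]≗ bit (segmentWidth b u q)
  segments-width b W Q st rep u {q} m q<Q =
    array-entry Q W _ q q<Q ≤-refl 
      (cat-left (Q * W) (widths b W Q u) (contents b Q st rep u) (m≤m+n (Q * W) _) (segments-tail b W Q st rep u m))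

  segments-segment : ∀ b W Q st rep u {q} → Monotone u →
                     μ [ A , segmentsLength b W Q st u ]≗ segments b W Q st rep u → q < Q →
                     μ [ A + Q * W + Q * W + segmentStart b st u q , st + segment b u q b ]≗ rep (segment b u q)
  segments-segment b W Q st rep u {q} mono m q<Q =
    glue-piece (segmentStart b st u) (segmentStart-mono b st mono) _ Q q _ q<Q fits ≤-refl
      (cat-right (Q * W) _ (widths b W Q u) (contents b Q st rep u) (segments-tail b W Q st rep u m))
    where
    fits : segmentStart b st u q + (st + segment b u q b) ≤ segmentStart b st u (suc q)
    fits = ≤-reflexive (begin
      q * st + u (q * b) + (st + segment b u q b)   ≡⟨ interchange (q * st) (u (q * b)) st (segment b u q b) ⟩
      st + q * st + (u (q * b) + segment b u q b)   ≡⟨ cong (st + q * st +_) (m+[n∸m]≡n (mono (m≤m+n (q * b) b))) ⟩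
      st + q * st + u (q * b + b)                   ≡⟨ cong (λ z → st + q * st + u z) (+-comm (q * b) b) ⟩
      st + q * st + u (b + q * b)                   ∎)
      where
      open ≡-Reasoning
      interchange : ∀ x y z t → x + y + (z + t) ≡ z + x + (y + t)
      interchange = solve-∀

-- Descending to an element

rE rW₂ rK rTable rA rl rj rAcc rScale rN rQ rW rb rst rLow rInner rq rBase rl′ rAnswer : Register
rAnswer = 9
rE      = 12
rW₂     = 14
rK      = 15
rTable  = 16
rA      = 17
rl      = 18
rj      = 19
rAcc    = 20
rScale  = 21
rN      = 22
rQ      = 23
rW      = 24
rb      = 25
rst     = 26
rLow    = 27
rInner  = 28
rq      = 29
rBase   = 30
rl′     = 31

readLow : Exp
readLow = readField (var rA :+ var rj :* var rl) (var rl)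

-- From the element of index j in a block to that of index j % b in segment
-- j / b of the high parts.
descend : Block
descend =
  (rLow   , readLow) ∷
  (rInner , var rA :+ var rN :* var rl) ∷
  (rq     , var rj :/ var rb) ∷
  (rBase  , readField (var rInner :+ var rq :* var rW) (var rW)) ∷
  (rl′    , readField (var rInner :+ var rQ :* var rW :+ var rq :* var rW) (var rW)) ∷
  (rA     , var rInner :+ var rQ :* var rW :+ var rQ :* var rW :+ (var rq :* var rst :+ var rBase)) ∷
  (rAcc   , var rAcc :+ var rScale :* (var rLow :+ var rBase :* pow2 (var rl))) ∷
  (rScale , var rScale :* pow2 (var rl)) ∷
  (rl     , var rl′ :+ lit 0) ∷
  (rj     , var rj :% var rb) ∷ []

lookupLeaf : Block
lookupLeaf =
  (rLow    , readLow) ∷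
  (rInner  , readField (var rA :+ var rE :* var rl) (var rK)) ∷
  (rBase   , readField (var rTable :+ (var rInner :* var rE :+ var rj) :* var rW₂) (var rW₂)) ∷
  (rAnswer , var rAcc :+ var rScale :* (var rLow :+ var rBase :* pow2 (var rl))) ∷ []

decodeTable : (E K W : ℕ) → Memory
decodeTable E K W = array (2 ^ K) (E * W) (λ c → array E W (λ j → bit (decode K (bit c) j)))

module Descent (s : ℕ) (1≤s : 1 ≤ s) (μ : Memory) (n x : ℕ) (1≤n : 1 ≤ n) (n< : n < 2 ^ (1 * s)) (x≤n : x ≤ n) where

  open Evaluation s 1≤s μ

  -- The registers describe the element of index j of the sequence v, whose
  -- representation starts at A; in terms of it, the answer x is acc + scale * v j.
  record Cursor (a : ℕ) (σ : Store) (N : ℕ) (v : ℕ → ℕ) (rest : (ℕ → ℕ) → Memory) (k : ℕ) (j : ℕ) : Set where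
    field
      A acc scale : ℕ
      A≡      : σ rA ≡ A
      l≡      : σ rl ≡ lowWidth N (v N)
      j≡      : σ rj ≡ j
      acc≡    : σ rAcc ≡ acc
      scale≡  : σ rScale ≡ scale
      A<      : A < 2 ^ (a * s)
      layout  : μ [ A , blockLength N v k ]≗ block N rest v
      mono    : Monotone v
      1≤scale : 1 ≤ scale
      scale≤n : scale ≤ n
      span≤n  : scale * v N ≤ n
      answer  : x ≡ acc + scale * v j

  module CursorProperties {a σ N v rest k j} .{{_ : NonZero N}} (a≤ : suc a ≤ 64) (2≤a : 2 ≤ a)
                          (c : Cursor a σ N v rest k j) (j<N : j < N) (j≤n : j ≤ n) where
    open Cursor c public

    l u : ℕ
    l = lowWidth N (v N)
    u = highPart N v j

    vN≤n : v N ≤ n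
    vN≤n = ≤-trans (m≤n*m (v N) scale {{>-nonZero 1≤scale}}) span≤n

    2^l≤n : 2 ^ l ≤ n
    2^l≤n = ≤-trans (2^lowWidth≤ N (v N)) (⊔-lub 1≤n vN≤n)

    2^l< : 2 ^ l < 2 ^ (1 * s)
    2^l< = ≤-<-trans 2^l≤n n<

    l< : l < 2 ^ (1 * s)
    l< = <-trans (n<2^n l) 2^l<

    j< : j < 2 ^ (1 * s)
    j< = ≤-<-trans j≤n n<

    acc< : acc < 2 ^ (1 * s)
    acc< = ≤-<-trans (≤-trans (m≤m+n acc _) (≤-trans (≤-reflexive (sym answer)) x≤n)) n<

    scale< : scale < 2 ^ (1 * s)
    scale< = ≤-<-trans scale≤n n<

    low : ℕ
    low = truncate l (v j)

    vj : v j ≡ low + u * 2 ^ l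
    vj = /2^-truncate l (v j)

    low⇓ : σ ⊢ readLow ⇓ low ∶ 1
    low⇓ = ⇓field 1 (⇓+ (⇓var a A≡ A<) (⇓* (⇓var 1 j≡ j<) (⇓var 1 l≡ l<) ok) (subst (λ z → suc z ≤ 64) (sym (m≥n⇒m⊔n≡m 2≤a)) a≤))
                  (⇓var 1 l≡ l<) 2^l< ok (truncate< l (v j)) (block-low N rest v layout j<N)

  module _ {σ : Store} {N b W Q st : ℕ} {v : ℕ → ℕ} {rest : (ℕ → ℕ) → Memory} {j q r : ℕ} (k i : ℕ) (i≤ : i ≤ 8)
           .{{_ : NonZero N}} .{{_ : NonZero b}}
           (N≡ : σ rN ≡ N) (Q≡ : σ rQ ≡ Q) (W≡ : σ rW ≡ W) (b≡ : σ rb ≡ b) (st≡ : σ rst ≡ st)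
           (N< : N < 2 ^ (10 * s)) (Q< : Q < 2 ^ (10 * s)) (W< : W < 2 ^ (10 * s))
           (b< : b < 2 ^ (10 * s)) (st< : st < 2 ^ (10 * s)) (2^W< : 2 ^ W < 2 ^ (8 * s))
           (c : Cursor (22 + i) σ N v (segments b W Q st (block b rest)) (segmentsLength b W Q st (highPart N v)) j)
           (j<N : j < N) (j≤n : j ≤ n) (j≡qb+r : j ≡ q * b + r) (r<b : r < b) (q<Q : q < Q)
           (end : v (q * b + b) ≤ v N) (u< : highPart N v N < 2 ^ W)
           (room : blockLength b (segment b (highPart N v) q) k ≤ st + segment b (highPart N v) q b) where

    private
      ok′ : ∀ k {_ : T (k ≤ᵇ 56)} → k + i ≤ 64
      ok′ k {p} = +-mono-≤ (≤ᵇ⇒≤ k 56 p) i≤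

    open CursorProperties (ok′ 23) (s≤s (s≤s z≤n)) c j<N j≤n

    private
      U : ℕ → ℕ
      U = highPart N v

      U-mono : Monotone U
      U-mono = highPart-mono N mono

      base l′ A₁ A₂ : ℕ
      base = U (q * b)
      l′   = segmentWidth b U q
      A₁   = A + N * l
      A₂   = A₁ + Q * W + Q * W + (q * st + base)

      U≤ : U (q * b + b) ≤ U N
      U≤ = /2^-mono l end

      base<2^W : base < 2 ^ W
      base<2^W = ≤-<-trans (≤-trans (U-mono (m≤m+n (q * b) b)) U≤) u<

      l′<2^W : l′ < 2 ^ W
      l′<2^W = segmentWidth<2^ {u = U} {q} W U-mono (≤-<-trans U≤ u<)

      quotient : j / b ≡ q
      quotient = trans (cong (_/ b) j≡qb+r) ([qb+r]/b q b r r<b)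

      remainder : j % b ≡ r
      remainder = trans (cong (_% b) j≡qb+r) ([qb+r]%b q b r r<b)

      high : μ [ A₁ , segmentsLength b W Q st U ]≗ segments b W Q st (block b rest) U
      high = block-high N (segments b W Q st (block b rest)) v layout

      q< : q < 2 ^ (1 * s)
      q< = subst (_< 2 ^ (1 * s)) quotient (≤-<-trans (m/n≤m j b) j<)

      A₁< : A₁ < 2 ^ ((23 + i) * s)
      A₁< = fits-+ {22 + i} {11} A< (fits-* {10} {1} N< l<)

      A₂< : A₂ < 2 ^ ((26 + i) * s)
      A₂< = fits-+ {25 + i} {12} (fits-+ {24 + i} {20} (fits-+ {23 + i} {20} A₁< QW<) QW<)
                                 (fits-+ {11} {8} (fits-* {1} {10} q< st<) (<-trans base<2^W 2^W<))
        where QW< = fits-* {10} {10} Q< W<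

      2^l*u≤ : ∀ i → 2 ^ l * U i ≤ v i
      2^l*u≤ i = ≤-trans (≤-reflexive (*-comm (2 ^ l) (U i))) (/2^-*-≤ l (v i))

      answer′ : x ≡ acc + scale * (low + base * 2 ^ l) + scale * 2 ^ l * segment b U q r
      answer′ = begin
        x                                  ≡⟨ answer ⟩
        acc + scale * v j                  ≡⟨ cong (λ z → acc + scale * z) vj ⟩
        acc + scale * (low + U j * 2 ^ l)
          ≡⟨ cong (λ z → acc + scale * (low + z * 2 ^ l)) (trans (cong U j≡qb+r) (sym (m+[n∸m]≡n (U-mono (m≤m+n (q * b) r))))) ⟩
        acc + scale * (low + (base + segment b U q r) * 2 ^ l)
          ≡⟨ regroup acc scale low base (2 ^ l) (segment b U q r) ⟩
        acc + scale * (low + base * 2 ^ l) + scale * 2 ^ l * segment b U q r  ∎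
        where
        open ≡-Reasoning
        regroup : ∀ a c lo ba p g → a + c * (lo + (ba + g) * p) ≡ a + c * (lo + ba * p) + c * p * g
        regroup = solve-∀

    descend-correct : ∃[ τ ] (Exec descend σ τ × Cursor (26 + i) τ b (segment b U q) rest k r)
    descend-correct = _ ,
      ( low⇓
      ▸ ⇓+ (⇓var (22 + i) A≡ A<) (⇓* (⇓var 10 N≡ N<) (⇓var 1 l≡ l<) ok) (ok′ 23)
      ▸ ⇓-cong quotient (⇓/ (⇓var 1 j≡ j<) (⇓var 10 b≡ b<) ok)
      ▸ ⇓field 8 (⇓+ (⇓var (23 + i) refl A₁<) (⇓* (⇓var 1 refl q<) (⇓var 10 W≡ W<) ok) (ok′ 24)) (⇓var 10 W≡ W<) 2^W< ok base<2^W
          (segments-base b W Q st (block b rest) U high q<Q)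
      ▸ ⇓field 8 (⇓+ (⇓+ (⇓var (23 + i) refl A₁<) (⇓* (⇓var 10 Q≡ Q<) (⇓var 10 W≡ W<) ok) (ok′ 24))
                   (⇓* (⇓var 1 refl q<) (⇓var 10 W≡ W<) ok) (ok′ 25))
               (⇓var 10 W≡ W<) 2^W< ok l′<2^W
          (segments-width b W Q st (block b rest) U high q<Q)
      ▸ ⇓+ (⇓+ (⇓+ (⇓var (23 + i) refl A₁<) (⇓* (⇓var 10 Q≡ Q<) (⇓var 10 W≡ W<) ok) (ok′ 24)) (⇓* (⇓var 10 Q≡ Q<) (⇓var 10 W≡ W<) ok) (ok′ 25))
           (⇓+ (⇓* (⇓var 1 refl q<) (⇓var 10 st≡ st<) ok) (⇓var 8 refl (<-trans base<2^W 2^W<)) ok) (ok′ 26)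
      ▸ ⇓+ (⇓var 1 acc≡ acc<)
           (⇓* (⇓var 1 scale≡ scale<)
               (⇓+ (⇓var 1 refl (fits low⇓)) (⇓* (⇓var 8 refl (<-trans base<2^W 2^W<)) (⇓pow2 1 (⇓var 1 l≡ l<) 2^l< ok) ok) ok) ok) ok
      ▸ ⇓* (⇓var 1 scale≡ scale<) (⇓pow2 1 (⇓var 1 l≡ l<) 2^l< ok) ok
      ▸ ⇓-cong (+-identityʳ l′) (⇓+ (⇓var 8 refl (<-trans l′<2^W 2^W<)) (⇓lit 0 1) ok)
      ▸ ⇓-cong remainder (⇓% (⇓var 1 j≡ j<) (⇓var 10 b≡ b<) ok)
      ▸ [] ) ,
      record
        { A = A₂ ; acc = acc + scale * (low + base * 2 ^ l) ; scale = scale * 2 ^ l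
        ; A≡ = refl ; l≡ = refl ; j≡ = refl ; acc≡ = refl ; scale≡ = refl
        ; A< = A₂<
        ; layout = ≗-weaken room (segments-segment b W Q st (block b rest) U U-mono high q<Q)
        ; mono = segment-mono b q U-mono
        ; 1≤scale = *-mono-≤ 1≤scale (2^-pos l)
        ; scale≤n = ≤-trans (*-monoʳ-≤ scale (2^lowWidth≤ N (v N)))
                      (≤-trans (≤-reflexive (*-distribˡ-⊔ scale 1 (v N)))
                        (⊔-lub (≤-trans (≤-reflexive (*-identityʳ scale)) scale≤n) span≤n))
        ; span≤n = begin
            scale * 2 ^ l * segment b U q b    ≤⟨ *-monoʳ-≤ (scale * 2 ^ l) (≤-trans (m∸n≤m _ base) U≤) ⟩
            scale * 2 ^ l * U N                ≡⟨ *-assoc scale (2 ^ l) (U N) ⟩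
            scale * (2 ^ l * U N)              ≤⟨ *-monoʳ-≤ scale (2^l*u≤ N) ⟩
            scale * v N                        ≤⟨ span≤n ⟩
            n                                  ∎
        ; answer = answer′
        }
      where open ≤-Reasoning

  module _ {σ : Store} {E W₂ K TB : ℕ} {v : ℕ → ℕ} {j : ℕ} .{{_ : NonZero E}}
           (E≡ : σ rE ≡ E) (W₂≡ : σ rW₂ ≡ W₂) (K≡ : σ rK ≡ K) (TB≡ : σ rTable ≡ TB)
           (E< : E < 2 ^ (1 * s)) (W₂< : W₂ < 2 ^ (4 * s)) (K< : K < 2 ^ (6 * s)) (TB< : TB < 2 ^ (4 * s))
           (2^W₂< : 2 ^ W₂ < 2 ^ (8 * s)) (2^K< : 2 ^ K < 2 ^ (6 * s))
           (c : Cursor 30 σ E v (λ u → unaryCode u E) (E + highPart E v E) j)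
           (j<E : j < E) (j≤n : j ≤ n) (K≡3E : K ≡ E + 2 * E) (2E≤2^W₂ : 2 * E ≤ 2 ^ W₂)
           (table : μ [ TB , 2 ^ K * (E * W₂) ]≗ decodeTable E K W₂) where

    open CursorProperties (ok {31}) (s≤s (s≤s z≤n)) c j<E j≤n

    private
      U : ℕ → ℕ
      U = highPart E v

      U-mono : Monotone U
      U-mono = highPart-mono E mono

      A₁ code : ℕ
      A₁   = A + E * l
      code = truncate K (readWord w μ A₁)

      UE< : U E < 2 * E
      UE< = high-< E (v E)

      K≤w : K ≤ w
      K≤w = <⇒≤ (<-≤-trans (2^-cancel-< {K} {6 * s} 2^K<) (*-monoˡ-≤ s (≤ᵇ⇒≤ 6 64 tt)))

      code-bits : ∀ a → a < E + U E → bit code a ≡ unaryCode U E a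
      code-bits a a< = begin
        bit code a                                 ≡⟨ cong (λ z → bit z a) (truncate-fromBits _ K≤w) ⟩
        bit (fromBits K (λ t → μ (A₁ + t))) a      ≡⟨ bit-fromBits K _ a a<K ⟩
        μ (A₁ + a)                                 ≡⟨ block-high E (λ u → unaryCode u E) v layout .at a a< ⟩
        unaryCode U E a                            ∎
        where
        open ≡-Reasoning
        a<K : a < K
        a<K = <-≤-trans a< (≤-trans (+-monoʳ-≤ E (<⇒≤ UE<)) (≤-reflexive (sym K≡3E)))

      Uj< : U j < 2 ^ W₂
      Uj< = <-≤-trans (≤-<-trans (U-mono (<⇒≤ j<E)) UE<) 2E≤2^W₂

      decoded : decode K (bit code) j ≡ U j
      decoded = decode-unaryCode K code U E j U-mono j<E
        (<-≤-trans (+-mono-≤-< (≤-trans (U-mono (<⇒≤ j<E)) (<⇒≤ UE<)) j<E) (≤-reflexive (trans (+-comm (2 * E) E) (sym K≡3E))))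
        code-bits

      entry : μ [ TB + (code * E + j) * W₂ , W₂ ]≗ bit (U j)
      entry = subst₂ (λ a d → μ [ a , W₂ ]≗ bit d) position decoded
        (array-entry E W₂ _ j j<E ≤-refl
          (array-entry (2 ^ K) (E * W₂) _ code (truncate< K (readWord w μ A₁)) ≤-refl table))
        where
        position : TB + code * (E * W₂) + j * W₂ ≡ TB + (code * E + j) * W₂
        position = regroup TB code E W₂ j
          where
          regroup : ∀ t c e w j → t + c * (e * w) + j * w ≡ t + (c * e + j) * w
          regroup = solve-∀

    lookupLeaf-correct : ∃[ τ ] (Exec lookupLeaf σ τ × τ rAnswer ≡ x)
    lookupLeaf-correct = _ ,
      ( low⇓
      ▸ ⇓window 6 (⇓+ (⇓var 30 A≡ A<) (⇓* (⇓var 1 E≡ E<) (⇓var 1 l≡ l<) ok) ok) (⇓var 6 K≡ K<) 2^K< ok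
      ▸ ⇓field 8 (⇓+ (⇓var 4 TB≡ TB<)
                   (⇓* (⇓+ (⇓* (⇓var 6 refl (<-trans (truncate< K (readWord w μ A₁)) 2^K<)) (⇓var 1 E≡ E<) ok) (⇓var 1 j≡ j<) ok)
                       (⇓var 4 W₂≡ W₂<) ok) ok)
               (⇓var 4 W₂≡ W₂<) 2^W₂< ok Uj< entry
      ▸ ⇓+ (⇓var 1 acc≡ acc<)
           (⇓* (⇓var 1 scale≡ scale<)
               (⇓+ (⇓var 1 refl (fits low⇓)) (⇓* (⇓var 8 refl (<-trans Uj< 2^W₂<)) (⇓pow2 1 (⇓var 1 l≡ l<) 2^l< ok) ok) ok) ok) ok
      ▸ [] ) ,
      sym (trans answer (cong (λ z → acc + scale * z) vj))

-- The data structure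

lowWidth-unique : ∀ {m n} l .{{_ : NonZero m}} → m * 2 ^ l ≤ n → n < m * 2 ^ suc l → lowWidth m n ≡ l
lowWidth-unique {m} {n} l lo hi = ≤-antisym upper lower
  where
  lower : l ≤ lowWidth m n
  lower = s≤s⁻¹ (2^-cancel-< {l} (*-cancelˡ-< m _ _ (≤-<-trans lo (lowWidth-< m n))))
  upper : lowWidth m n ≤ l
  upper with lowWidth-≤ m n
  ... | inj₁ eq = ≤-trans (≤-reflexive eq) z≤n
  ... | inj₂ p  = s≤s⁻¹ (2^-cancel-< {lowWidth m n} {suc l} (*-cancelˡ-< m _ _ (≤-<-trans p hi)))

lowWidth-estimate : ∀ m n d .{{_ : NonZero m}} → m ≤ n → n < m * 2 ^ suc d → (∀ d′ → d ≡ suc d′ → m * 2 ^ d′ ≤ n) →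
                    let c = if n <ᵇ m * 2 ^ d then 1 else 0 in c ≤ d × lowWidth m n ≡ d ∸ c
lowWidth-estimate m n d m≤n upper lower with n <ᵇ m * 2 ^ d in eq
... | false = z≤n , lowWidth-unique d (≮⇒≥ (λ n< → subst T eq (<⇒<ᵇ n<))) upper
lowWidth-estimate m n zero    m≤n upper lower | true =
  contradiction (<ᵇ-true eq) (≤⇒≯ (subst (_≤ n) (sym (*-identityʳ m)) m≤n))
lowWidth-estimate m n (suc d) m≤n upper lower | true =
  s≤s z≤n , lowWidth-unique d (lower d refl) (<ᵇ-true eq)

module Layout (ℓ e m : ℕ) where

  E b₁ Q₁ Q₂ W₁ W₂ K st₁ tableStart tableLength : ℕ
  E  = 2 ^ e
  b₁ = E * E * E
  Q₁ = suc (_/_ m b₁ {{m*n≢0 (E * E) E {{m*n≢0 E E {{m^n≢0 2 e}} {{m^n≢0 2 e}}}} {{m^n≢0 2 e}}}})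
  Q₂ = E * E
  W₁ = ℓ + 2
  W₂ = 3 * e + 1
  K  = 3 * E
  st₁ = b₁ + 2 * (Q₂ * W₂)
  tableStart  = suc ℓ + suc e
  tableLength = 2 ^ K * (E * W₂)

  rest₂ rest₁ rest₀ : (ℕ → ℕ) → Memory
  rest₂ u = unaryCode u E
  rest₁   = segments E W₂ Q₂ E (block E rest₂)
  rest₀   = segments b₁ W₁ Q₁ st₁ (block b₁ rest₁)

  tableAndBlock afterℓ contentsOf : (ℕ → ℕ) → Memory
  tableAndBlock X = cat tableLength (decodeTable E K W₂) (block m rest₀ X)
  afterℓ X        = cat (suc e) (_<ᵇ e) (tableAndBlock X)
  contentsOf X    = cat (suc ℓ) (_<ᵇ ℓ) (afterℓ X)

  sizeOf : (ℕ → ℕ) → ℕ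
  sizeOf X = suc ℓ + (suc e + (tableLength + blockLength m X (segmentsLength b₁ W₁ Q₁ st₁ (highPart m X))))

rℓ re rb₁ rd : Register
rℓ  = 10
re  = 11
rb₁ = 13
rd  = 32

-- Registers 1, 2 and 3 hold n, m and the zero-based index. The word length
-- reveals ⌊log₂ n⌋, and ⌊log₂ m⌋ is stored in unary; the low width, which is
-- ⌊log₂ (n / m)⌋, is their difference or one less.
parameters : Block
parameters =
  (rℓ , readUnary (lit 0)) ∷
  (re , readUnary (var rℓ :+ lit 1)) ∷
  (rE , pow2 (var re)) ∷
  (rb₁ , var rE :* var rE :* var rE) ∷
  (rW₂ , lit 3 :* var re :+ lit 1) ∷
  (rK , lit 3 :* var rE) ∷
  (rTable , lit 1 :+ var rℓ :+ (lit 1 :+ var re)) ∷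
  (rd , pop (lit 0 :- lit 1) :/ lit 64 :- lit 1 :- var rℓ) ∷
  (rl , var rd :- bin lt (var 1) (var 2 :* pow2 (var rd))) ∷
  (rA , var rTable :+ pow2 (var rK) :* (var rE :* var rW₂)) ∷
  (rj , var 3 :+ lit 0) ∷
  (rAcc , lit 0) ∷
  (rScale , lit 1) ∷
  (rN , var 2 :+ lit 0) ∷
  (rQ , lit 1 :+ var 2 :/ var rb₁) ∷
  (rW , var rℓ :+ lit 2) ∷
  (rb , var rb₁ :+ lit 0) ∷
  (rst , var rb₁ :+ lit 2 :* (var rE :* var rE :* var rW₂)) ∷ []

parameters₂ : Block
parameters₂ =
  (rN , var rb₁ :+ lit 0) ∷
  (rQ , var rE :* var rE) ∷
  (rW , var rW₂ :+ lit 0) ∷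
  (rb , var rE :+ lit 0) ∷
  (rst , var rE :+ lit 0) ∷ []

selectBlock : Block
selectBlock = parameters ++ descend ++ parameters₂ ++ descend ++ lookupLeaf

module SelectCorrect
  (λ₀ ℓ e n m : ℕ) .{{_ : NonZero m}} (X : ℕ → ℕ) (X-mono : Monotone X) (X≤n : ∀ i → X i ≤ n) (Xm : X m ≡ n)
  (n≥ : 2 ^ λ₀ ≤ n) (n<′ : n < 2 ^ suc λ₀) (m≤n : m ≤ n) (m≥ : 2 ^ ℓ ≤ m) (m< : m < 2 ^ suc ℓ) (E²≤ : 2 ^ e * 2 ^ e ≤ 1 ⊔ ℓ)
  (μ : Memory) (stored : μ [ 0 , Layout.sizeOf ℓ e m X ]≗ Layout.contentsOf ℓ e m X) where

  open Layout ℓ e m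

  private
    s : ℕ
    s = suc λ₀

    1≤s : 1 ≤ s
    1≤s = s≤s z≤n

    1≤n : 1 ≤ n
    1≤n = ≤-trans (2^-pos λ₀) n≥

    2^[1*s] : 2 ^ (1 * s) ≡ 2 ^ s
    2^[1*s] = cong (2 ^_) (*-identityˡ s)

    n< : n < 2 ^ (1 * s)
    n< = subst (n <_) (sym 2^[1*s]) n<′

    instance
      E≢0 : NonZero E
      E≢0 = m^n≢0 2 e

      b₁≢0 : NonZero b₁
      b₁≢0 = m*n≢0 (E * E) E {{m*n≢0 E E}}

  open Evaluation s 1≤s μ public

  private
    ≤n⇒< : ∀ {k} → k ≤ n → k < 2 ^ (1 * s)
    ≤n⇒< p = ≤-<-trans p n<

    ℓ≤n : ℓ ≤ n
    ℓ≤n = ≤-trans (<⇒≤ (n<2^n ℓ)) (≤-trans m≥ m≤n)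

    E≤ : E ≤ 1 ⊔ ℓ
    E≤ = ≤-trans (m≤n*m E E) E²≤

    E≤n : E ≤ n
    E≤n = ≤-trans E≤ (⊔-lub 1≤n ℓ≤n)

    e≤n : e ≤ n
    e≤n = ≤-trans (<⇒≤ (n<2^n e)) E≤n

    ℓ< : ℓ < 2 ^ (1 * s)
    ℓ< = ≤n⇒< ℓ≤n

    e< : e < 2 ^ (1 * s)
    e< = ≤n⇒< e≤n

    E< : E < 2 ^ (1 * s)
    E< = ≤n⇒< E≤n

    b₁< : b₁ < 2 ^ (3 * s)
    b₁< = fits-* {2} {1} (fits-* {1} {1} E< E<) E<

    W₂< : W₂ < 2 ^ (4 * s)
    W₂< = fits-+ {3} {1} (fits-* {2} {1} (fits-lit {2} (≤ᵇ⇒≤ 4 4 tt)) e<) (fits-lit {1} (≤ᵇ⇒≤ 2 2 tt))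

    K< : K < 2 ^ (3 * s)
    K< = fits-* {2} {1} (fits-lit {2} (≤ᵇ⇒≤ 4 4 tt)) E<

    TB< : tableStart < 2 ^ (3 * s)
    TB< = fits-+ {2} {2} (fits-+ {1} {1} 1< ℓ<) (fits-+ {1} {1} 1< e<)
      where 1< = fits-lit {1} (≤ᵇ⇒≤ 2 2 tt)

    2^E< : 2 ^ E < 2 ^ (2 * s)
    2^E< = begin-strict
      2 ^ E              ≤⟨ ^-monoʳ-≤ 2 (≤-trans E≤ (⊔-lub (s≤s z≤n) (n≤1+n ℓ))) ⟩
      2 * 2 ^ ℓ          ≡⟨ cong (2 ^ ℓ +_) (+-identityʳ (2 ^ ℓ)) ⟩
      2 ^ ℓ + 2 ^ ℓ      <⟨ fits-+ {1} {1} 2^ℓ< 2^ℓ< ⟩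
      2 ^ (2 * s)        ∎
      where
      open ≤-Reasoning
      2^ℓ< = ≤n⇒< (≤-trans m≥ m≤n)

    2^K< : 2 ^ K < 2 ^ (6 * s)
    2^K< = subst (_< 2 ^ (6 * s)) eq (fits-* {2} {4} 2^E< (fits-* {2} {2} 2^E< 2^E<))
      where
      eq : 2 ^ E * (2 ^ E * 2 ^ E) ≡ 2 ^ K
      eq = begin
        2 ^ E * (2 ^ E * 2 ^ E)  ≡⟨ cong (2 ^ E *_) (^-distribˡ-+-* 2 E E) ⟨
        2 ^ E * 2 ^ (E + E)      ≡⟨ ^-distribˡ-+-* 2 E (E + E) ⟨
        2 ^ (E + (E + E))        ≡⟨ cong (λ z → 2 ^ (E + (E + z))) (+-identityʳ E) ⟨
        2 ^ K                    ∎
        where open ≡-Reasoning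

    2^W₂ : 2 ^ W₂ ≡ 2 * b₁
    2^W₂ = begin
      2 ^ (3 * e + 1)                ≡⟨ cong (2 ^_) (+-comm (3 * e) 1) ⟩
      2 * 2 ^ (e + (e + (e + 0)))    ≡⟨ cong (λ z → 2 * 2 ^ (e + (e + z))) (+-identityʳ e) ⟩
      2 * 2 ^ (e + (e + e))          ≡⟨ cong (2 *_) (trans (^-distribˡ-+-* 2 e (e + e)) (cong (E *_) (^-distribˡ-+-* 2 e e))) ⟩
      2 * (E * (E * E))              ≡⟨ cong (2 *_) (*-assoc E E E) ⟨
      2 * b₁                         ∎
      where open ≡-Reasoning

    2^W₂< : 2 ^ W₂ < 2 ^ (8 * s)
    2^W₂< = subst (_< 2 ^ (8 * s)) (sym 2^W₂) (fits-≤ {5} (≤ᵇ⇒≤ 5 8 tt) (fits-* {2} {3} (fits-lit {2} (≤ᵇ⇒≤ 3 4 tt)) b₁<))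

    2^W₁ : 2 ^ W₁ ≡ 2 * 2 ^ suc ℓ
    2^W₁ = cong (2 ^_) (+-comm ℓ 2)

    2^W₁< : 2 ^ W₁ < 2 ^ (8 * s)
    2^W₁< = subst (_< 2 ^ (8 * s)) (sym 2^W₁) (fits-≤ {5} (≤ᵇ⇒≤ 5 8 tt)
              (fits-* {2} {3} (fits-lit {2} (≤ᵇ⇒≤ 3 4 tt)) (fits-* {2} {1} (fits-lit {2} (≤ᵇ⇒≤ 3 4 tt)) (≤n⇒< (≤-trans m≥ m≤n)))))

    st₁< : st₁ < 2 ^ (10 * s)
    st₁< = fits-≤ {9} (≤ᵇ⇒≤ 9 10 tt)
      (fits-+ {3} {8} b₁< (fits-* {2} {6} (fits-lit {2} (≤ᵇ⇒≤ 3 4 tt)) (fits-* {2} {4} (fits-* {1} {1} E< E<) W₂<)))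

    A₀ : ℕ
    A₀ = tableStart + tableLength

    A₀< : A₀ < 2 ^ (22 * s)
    A₀< = fits-≤ {12} (≤ᵇ⇒≤ 12 22 tt) (fits-+ {3} {11} TB< (fits-* {6} {5} 2^K< (fits-* {1} {4} E< W₂<)))

    afterℓ-stored : μ [ suc ℓ , _ ]≗ afterℓ X
    afterℓ-stored = cat-right (suc ℓ) _ (_<ᵇ ℓ) (afterℓ X) stored

    tableAndBlock-stored : μ [ tableStart , _ ]≗ tableAndBlock X
    tableAndBlock-stored = cat-right (suc e) _ (_<ᵇ e) (tableAndBlock X) afterℓ-stored

    table-stored : μ [ tableStart , tableLength ]≗ decodeTable E K W₂
    table-stored = cat-left tableLength (decodeTable E K W₂) (block m rest₀ X) (m≤m+n tableLength _) tableAndBlock-stored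

    block-stored : μ [ A₀ , blockLength m X (segmentsLength b₁ W₁ Q₁ st₁ (highPart m X)) ]≗ block m rest₀ X
    block-stored = cat-right tableLength _ (decodeTable E K W₂) (block m rest₀ X) tableAndBlock-stored

    d L : ℕ
    d = λ₀ ∸ ℓ
    L = d ∸ (if n <ᵇ m * 2 ^ d then 1 else 0)

    ℓ≤λ₀ : ℓ ≤ λ₀
    ℓ≤λ₀ = s≤s⁻¹ (2^-cancel-< {ℓ} (≤-<-trans (≤-trans m≥ m≤n) n<′))

    2^ℓ*2^d : 2 ^ ℓ * 2 ^ d ≡ 2 ^ λ₀
    2^ℓ*2^d = trans (sym (^-distribˡ-+-* 2 ℓ d)) (cong (2 ^_) (m+[n∸m]≡n ℓ≤λ₀))

    m*2^d< : m * 2 ^ d < 2 ^ s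
    m*2^d< = begin-strict
      m * 2 ^ d            <⟨ *-monoˡ-< (2 ^ d) {{m^n≢0 2 d}} m< ⟩
      2 * 2 ^ ℓ * 2 ^ d    ≡⟨ *-assoc 2 (2 ^ ℓ) (2 ^ d) ⟩
      2 * (2 ^ ℓ * 2 ^ d)  ≡⟨ cong (2 *_) 2^ℓ*2^d ⟩
      2 ^ s                ∎
      where open ≤-Reasoning

    carry≤d×L≡ : (if n <ᵇ m * 2 ^ d then 1 else 0) ≤ d × lowWidth m n ≡ L
    carry≤d×L≡ = lowWidth-estimate m n d m≤n upper lower
      where
      upper : n < m * 2 ^ suc d
      upper = begin-strict
        n                    <⟨ n<′ ⟩
        2 * 2 ^ λ₀           ≡⟨ cong (2 *_) 2^ℓ*2^d ⟨
        2 * (2 ^ ℓ * 2 ^ d)  ≤⟨ *-monoʳ-≤ 2 (*-monoˡ-≤ (2 ^ d) m≥) ⟩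
        2 * (m * 2 ^ d)      ≡⟨ x∙yz≈y∙xz 2 m (2 ^ d) ⟩
        m * 2 ^ suc d        ∎
        where open ≤-Reasoning
      lower : ∀ d′ → d ≡ suc d′ → m * 2 ^ d′ ≤ n
      lower d′ d≡ = begin
        m * 2 ^ d′           ≤⟨ *-monoˡ-≤ (2 ^ d′) (<⇒≤ m<) ⟩
        2 * 2 ^ ℓ * 2 ^ d′   ≡⟨ trans (*-assoc 2 (2 ^ ℓ) (2 ^ d′)) (x∙yz≈y∙xz 2 (2 ^ ℓ) (2 ^ d′)) ⟩
        2 ^ ℓ * 2 ^ suc d′   ≡⟨ cong (λ z → 2 ^ ℓ * 2 ^ z) d≡ ⟨
        2 ^ ℓ * 2 ^ d        ≡⟨ 2^ℓ*2^d ⟩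
        2 ^ λ₀               ≤⟨ n≥ ⟩
        n                    ∎
        where open ≤-Reasoning

    lowWidth≡L : L ≡ lowWidth m (X m)
    lowWidth≡L = sym (trans (cong (lowWidth m) Xm) (proj₂ carry≤d×L≡))

  record Ready (σ : Store) : Set where
    field
      E≡  : σ rE ≡ E
      b₁≡ : σ rb₁ ≡ b₁
      W₂≡ : σ rW₂ ≡ W₂
      K≡  : σ rK ≡ K
      TB≡ : σ rTable ≡ tableStart
      N≡  : σ rN ≡ m
      Q≡  : σ rQ ≡ Q₁
      W≡  : σ rW ≡ W₁
      b≡  : σ rb ≡ b₁
      st≡ : σ rst ≡ st₁

  module _ {σ : Store} {i : ℕ} (n≡ : σ 1 ≡ n) (m≡ : σ 2 ≡ m) (i≡ : σ 3 ≡ i) (i<m : i < m) where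

    open Descent s 1≤s μ n (X i) 1≤n n< (X≤n i)

    private
      i≤n : i ≤ n
      i≤n = ≤-trans (<⇒≤ i<m) m≤n

      ones≡ : val σ (lit 0 :- lit 1) ≡ 2 ^ w ∸ 1
      ones≡ = begin
        truncate w (truncate w 0 + (2 ^ w ∸ truncate w 1))
          ≡⟨ cong₂ (λ x y → truncate w (x + (2 ^ w ∸ y))) (eval {σ} (⇓lit 0 1)) (eval {σ} (⇓lit 1 1)) ⟩
        truncate w (2 ^ w ∸ 1)
          ≡⟨ truncate-id {w} (∸-monoʳ-< {2 ^ w} {1} {0} (s≤s z≤n) (2^-pos w)) ⟩
        2 ^ w ∸ 1  ∎
        where open ≡-Reasoning

      wordLength⇓ : ∀ {σ} → σ ⊢ pop (lit 0 :- lit 1) ⇓ w ∶ 8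
      wordLength⇓ = ⇓ (trans (cong (truncate w ∘ popcount w) ones≡)
                        (trans (cong (truncate w) (popcount-ones w)) (fits-word {8} ok w<))) w<
        where
        w< : w < 2 ^ (8 * s)
        w< = fits-* {7} {1} (fits-lit {7} {64} (<ᵇ⇒< 64 128 tt)) (subst (s <_) (sym 2^[1*s]) (n<2^n s))

      d⇓ : ∀ {σ} → σ rℓ ≡ ℓ → σ ⊢ pop (lit 0 :- lit 1) :/ lit 64 :- lit 1 :- var rℓ ⇓ d ∶ 8
      d⇓ ℓ≡ = ⇓- (⇓- (⇓-cong w/64 (⇓/ wordLength⇓ (⇓lit 64 7) ok)) (⇓lit 1 1) 1≤s ok) (⇓var 1 ℓ≡ ℓ<) ℓ≤λ₀ ok
        where
        w/64 : w / 64 ≡ s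
        w/64 = trans (cong (_/ 64) (*-comm 64 s)) (m*n/n≡m s 64)

    parameters-correct : ∃[ τ ] (Exec parameters σ τ × Ready τ ×
      Cursor 22 τ m X rest₀ (segmentsLength b₁ W₁ Q₁ st₁ (highPart m X)) i)
    parameters-correct = _ ,
      ( ⇓unary (⇓lit 0 1) ℓ< ℓ<w (cat-left (suc ℓ) (_<ᵇ ℓ) (afterℓ X) (m≤m+n (suc ℓ) _) stored)
      ▸ ⇓unary (⇓-cong (+-comm ℓ 1) (⇓+ (⇓var 1 refl ℓ<) (⇓lit 1 1) ok)) e< e<w
          (cat-left (suc e) (_<ᵇ e) (tableAndBlock X) (m≤m+n (suc e) _) afterℓ-stored)
      ▸ ⇓pow2 1 (⇓var 1 refl e<) E< ok
      ▸ ⇓* (⇓* (⇓var 1 refl E<) (⇓var 1 refl E<) ok) (⇓var 1 refl E<) ok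
      ▸ ⇓+ (⇓* (⇓lit 3 2) (⇓var 1 refl e<) ok) (⇓lit 1 1) ok
      ▸ ⇓* (⇓lit 3 2) (⇓var 1 refl E<) ok
      ▸ ⇓+ (⇓+ (⇓lit 1 1) (⇓var 1 refl ℓ<) ok) (⇓+ (⇓lit 1 1) (⇓var 1 refl e<) ok) ok
      ▸ d⇓ refl
      ▸ ⇓-cong lowWidth≡L
          (⇓- (⇓var 8 refl d<)
              (⇓lt (⇓var 1 n≡ n<) (⇓* (⇓var 1 m≡ (≤n⇒< m≤n)) (⇓pow2 1 (⇓var 8 refl d<) 2^d< ok) ok))
              (proj₁ carry≤d×L≡) ok)
      ▸ ⇓+ (⇓var 3 refl TB<) (⇓* (⇓pow2 6 (⇓var 3 refl K<) 2^K< ok) (⇓* (⇓var 1 refl E<) (⇓var 4 refl W₂<) ok) ok) ok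
      ▸ ⇓-cong (+-identityʳ i) (⇓+ (⇓var 1 i≡ (≤n⇒< i≤n)) (⇓lit 0 1) ok)
      ▸ ⇓lit 0 1
      ▸ ⇓lit 1 1
      ▸ ⇓-cong (+-identityʳ m) (⇓+ (⇓var 1 m≡ (≤n⇒< m≤n)) (⇓lit 0 1) ok)
      ▸ ⇓+ (⇓lit 1 1) (⇓/ (⇓var 1 m≡ (≤n⇒< m≤n)) (⇓var 3 refl b₁<) ok) ok
      ▸ ⇓+ (⇓var 1 refl ℓ<) (⇓lit 2 2) ok
      ▸ ⇓-cong (+-identityʳ b₁) (⇓+ (⇓var 3 refl b₁<) (⇓lit 0 1) ok)
      ▸ ⇓+ (⇓var 3 refl b₁<) (⇓* (⇓lit 2 2) (⇓* (⇓* (⇓var 1 refl E<) (⇓var 1 refl E<) ok) (⇓var 4 refl W₂<) ok) ok) ok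
      ▸ [] ) ,
      record { E≡ = refl ; b₁≡ = refl ; W₂≡ = refl ; K≡ = refl ; TB≡ = refl ; N≡ = refl ; Q≡ = refl ; W≡ = refl ; b≡ = refl ; st≡ = refl } ,
      record
        { A = A₀ ; acc = 0 ; scale = 1
        ; A≡ = refl ; l≡ = refl ; j≡ = refl ; acc≡ = refl ; scale≡ = refl
        ; A< = A₀<
        ; layout = block-stored
        ; mono = X-mono
        ; 1≤scale = ≤-refl
        ; scale≤n = 1≤n
        ; span≤n = ≤-reflexive (trans (*-identityˡ (X m)) Xm)
        ; answer = sym (*-identityˡ (X i))
        }
      where
      d< : d < 2 ^ (8 * s)
      d< = fits (d⇓ {setReg σ rℓ ℓ} refl)
      2^d< : 2 ^ d < 2 ^ (1 * s)
      2^d< = subst (2 ^ d <_) (sym 2^[1*s]) (≤-<-trans (m≤n*m (2 ^ d) m) m*2^d<)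
      ℓ<w : ℓ < w
      ℓ<w = <-≤-trans (s≤s ℓ≤λ₀) (m≤n*m s 64)
      e<w : e < w
      e<w = <-≤-trans (2^-cancel-< {e} {1 * s} E<) (*-monoˡ-≤ s (≤ᵇ⇒≤ 1 64 tt))

    private
      L₁ : ℕ
      L₁ = segmentsLength b₁ W₁ Q₁ st₁ (highPart m X)

      q₁ r₁ q₂ r₂ : ℕ
      q₁ = i / b₁
      r₁ = i % b₁
      q₂ = r₁ / E
      r₂ = r₁ % E

      X₁ X₂ : ℕ → ℕ
      X₁ = segment b₁ (highPart m X) q₁
      X₂ = segment E (highPart b₁ X₁) q₂

      X₁-mono : Monotone X₁
      X₁-mono = segment-mono b₁ q₁ (highPart-mono m X-mono)

      r₁<b₁ : r₁ < b₁
      r₁<b₁ = m%n<n i b₁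

      q₂<Q₂ : q₂ < Q₂
      q₂<Q₂ = m<n*o⇒m/o<n r₁<b₁

      r₁≤n : r₁ ≤ n
      r₁≤n = ≤-trans (m%n≤m i b₁) i≤n

      room₁ : blockLength b₁ X₁ (segmentsLength E W₂ Q₂ E (highPart b₁ X₁)) ≤ st₁ + X₁ b₁
      room₁ = begin
        b₁ * l + (Q₂ * W₂ + (Q₂ * W₂ + (b₁ + X₁ b₁ /2^ l)))    ≡⟨ regroup (b₁ * l) (Q₂ * W₂) b₁ (X₁ b₁ /2^ l) ⟩
        st₁ + (b₁ * l + X₁ b₁ /2^ l)                           ≤⟨ +-monoʳ-≤ st₁ (low+high≤ b₁ (X₁ b₁)) ⟩
        st₁ + X₁ b₁                                            ∎
        where
        open ≤-Reasoning
        l = lowWidth b₁ (X₁ b₁)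
        regroup : ∀ x y b h → x + (y + (y + (b + h))) ≡ b + 2 * y + (x + h)
        regroup = solve-∀

      room₂ : blockLength E X₂ (E + highPart E X₂ E) ≤ E + X₂ E
      room₂ = begin
        E * l + (E + X₂ E /2^ l)   ≡⟨ x∙yz≈y∙xz′ (E * l) E (X₂ E /2^ l) ⟩
        E + (E * l + X₂ E /2^ l)   ≤⟨ +-monoʳ-≤ E (low+high≤ E (X₂ E)) ⟩
        E + X₂ E                   ∎
        where
        open ≤-Reasoning
        l = lowWidth E (X₂ E)
        x∙yz≈y∙xz′ : ∀ x y z → x + (y + z) ≡ y + (x + z)
        x∙yz≈y∙xz′ = solve-∀

      first-descent : ∀ {τ} → Ready τ → Cursor 22 τ m X rest₀ L₁ i →
        ∃[ υ ] (Exec descend τ υ × Cursor 26 υ b₁ X₁ rest₁ (segmentsLength E W₂ Q₂ E (highPart b₁ X₁)) r₁)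
      first-descent R C = descend-correct _ 0 z≤n
        (Ready.N≡ R) (Ready.Q≡ R) (Ready.W≡ R) (Ready.b≡ R) (Ready.st≡ R)
        (fits-≤ {1} (≤ᵇ⇒≤ 1 10 tt) (≤n⇒< m≤n))
        (fits-≤ {2} (≤ᵇ⇒≤ 2 10 tt) (fits-+ {1} {1} (fits-lit {1} (≤ᵇ⇒≤ 2 2 tt)) (≤n⇒< (≤-trans (m/n≤m m b₁) m≤n))))
        (fits-≤ {3} (≤ᵇ⇒≤ 3 10 tt) (fits-+ {1} {2} ℓ< (fits-lit {2} (≤ᵇ⇒≤ 3 4 tt))))
        (fits-≤ {3} (≤ᵇ⇒≤ 3 10 tt) b₁<)
        st₁< 2^W₁< C i<m i≤n (m≡[m/n]*n+m%n i b₁) r₁<b₁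
        (s≤s (/-monoˡ-≤ b₁ (<⇒≤ i<m)))
        (≤-trans (X≤n _) (≤-reflexive (sym Xm)))
        (<-≤-trans (high-< m (X m)) (≤-trans (*-monoʳ-≤ 2 (<⇒≤ m<)) (≤-reflexive (sym 2^W₁))))
        room₁

      second-descent : ∀ {τ} → τ rN ≡ b₁ → τ rQ ≡ Q₂ → τ rW ≡ W₂ → τ rb ≡ E → τ rst ≡ E →
        Cursor 26 τ b₁ X₁ rest₁ (segmentsLength E W₂ Q₂ E (highPart b₁ X₁)) r₁ →
        ∃[ υ ] (Exec descend τ υ × Cursor 30 υ E X₂ rest₂ (E + highPart E X₂ E) r₂)
      second-descent N≡ Q≡ W≡ b≡ st≡ C = descend-correct _ 4 (≤ᵇ⇒≤ 4 8 tt)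
        N≡ Q≡ W≡ b≡ st≡
        (fits-≤ {3} (≤ᵇ⇒≤ 3 10 tt) b₁<)
        (fits-≤ {2} (≤ᵇ⇒≤ 2 10 tt) (fits-* {1} {1} E< E<))
        (fits-≤ {4} (≤ᵇ⇒≤ 4 10 tt) W₂<)
        (fits-≤ {1} (≤ᵇ⇒≤ 1 10 tt) E<)
        (fits-≤ {1} (≤ᵇ⇒≤ 1 10 tt) E<)
        2^W₂< C r₁<b₁ r₁≤n (m≡[m/n]*n+m%n r₁ E) (m%n<n r₁ E) q₂<Q₂
        (X₁-mono (≤-trans (≤-reflexive (+-comm (q₂ * E) E)) (*-monoˡ-≤ E q₂<Q₂)))
        (<-≤-trans (high-< b₁ (X₁ b₁)) (≤-reflexive (sym 2^W₂)))
        room₂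

    selectBlock-correct : ∃[ τ ] (Exec selectBlock σ τ × τ rAnswer ≡ X i)
    selectBlock-correct =
      let τ₁ , x₁ , R , C₁ = parameters-correct
          τ₂ , x₂ , C₂     = first-descent R C₁
          keep₂ : ∀ r → avoids r descend ≡ true → τ₂ r ≡ τ₁ r
          keep₂ r ok = Exec-frame r ok x₂
          E≡₂  = trans (keep₂ rE refl) (Ready.E≡ R)
          W₂≡₂ = trans (keep₂ rW₂ refl) (Ready.W₂≡ R)
          b₁≡₂ = trans (keep₂ rb₁ refl) (Ready.b₁≡ R)
          x₃ = ⇓-cong (+-identityʳ b₁) (⇓+ (⇓var 3 b₁≡₂ b₁<) (⇓lit 0 1) ok)
             ▸ ⇓* (⇓var 1 E≡₂ E<) (⇓var 1 E≡₂ E<) ok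
             ▸ ⇓-cong (+-identityʳ W₂) (⇓+ (⇓var 4 W₂≡₂ W₂<) (⇓lit 0 1) ok)
             ▸ ⇓-cong (+-identityʳ E) (⇓+ (⇓var 1 E≡₂ E<) (⇓lit 0 1) ok)
             ▸ ⇓-cong (+-identityʳ E) (⇓+ (⇓var 1 E≡₂ E<) (⇓lit 0 1) ok)
             ▸ []
          τ₄ , x₄ , C₄ = second-descent refl refl refl refl refl (record { Cursor C₂ })
          keep₄ : ∀ r → avoids r descend ≡ true → avoids r parameters₂ ≡ true → τ₄ r ≡ τ₁ r
          keep₄ r ok ok′ = trans (Exec-frame r ok x₄) (trans (Exec-frame r ok′ x₃) (keep₂ r ok))
          τ₅ , x₅ , answer≡ = lookupLeaf-correct
            (trans (keep₄ rE refl refl) (Ready.E≡ R)) (trans (keep₄ rW₂ refl refl) (Ready.W₂≡ R))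
            (trans (keep₄ rK refl refl) (Ready.K≡ R)) (trans (keep₄ rTable refl refl) (Ready.TB≡ R))
            E< W₂< (fits-≤ {3} (≤ᵇ⇒≤ 3 6 tt) K<) (fits-≤ {3} (≤ᵇ⇒≤ 3 4 tt) TB<) 2^W₂< 2^K< C₄
            (m%n<n r₁ E) (≤-trans (m%n≤m r₁ E) r₁≤n) refl
            (≤-trans (*-monoʳ-≤ 2 (m≤n*m E (E * E) {{m*n≢0 E E}})) (≤-reflexive (sym 2^W₂)))
            table-stored
      in τ₅ , Exec-++ x₁ (Exec-++ x₂ (Exec-++ x₃ (Exec-++ x₄ x₅))) , answer≡

-- The elements of a set in increasing order, followed by copies of n

element : ∀ {n} → Subset n → ℕ → ℕ
element []            i       = 0
element (inside  ∷ S) zero    = 0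
element (inside  ∷ S) (suc i) = suc (element S i)
element (outside ∷ S) i       = suc (element S i)

element-mono : ∀ {n} (S : Subset n) → Monotone (element S)
element-mono []            p       = z≤n
element-mono (inside  ∷ S) {zero}  p       = z≤n
element-mono (inside  ∷ S) {suc i} (s≤s p) = s≤s (element-mono S p)
element-mono (outside ∷ S) p       = s≤s (element-mono S p)

element-≤ : ∀ {n} (S : Subset n) i → element S i ≤ n
element-≤ []            i       = z≤n
element-≤ (inside  ∷ S) zero    = z≤n
element-≤ (inside  ∷ S) (suc i) = s≤s (element-≤ S i)
element-≤ (outside ∷ S) i       = s≤s (element-≤ S i)

element-end : ∀ {n} (S : Subset n) → element S ∣ S ∣ ≡ n
element-end []            = refl
element-end (inside  ∷ S) = cong suc (element-end S)
element-end (outside ∷ S) = cong suc (element-end S)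

element-select : ∀ {n} (S : Subset n) i → element S (toℕ i) ≡ toℕ (select S i)
element-select (inside  ∷ S) zero    = refl
element-select (inside  ∷ S) (suc i) = cong suc (element-select S i)
element-select (outside ∷ S) i       = cong suc (element-select S i)

private
  none : ∀ {n} (S : Subset n) → ∣ S ∩ tabulate (λ _ → false) ∣ ≡ 0
  none []            = refl
  none (inside  ∷ S) = none S
  none (outside ∷ S) = none S

  countBelow : ∀ {n} (S : Subset n) c r → r ≤ ∣ S ∣ →
               (∀ i → i < r → element S i < c) → (∀ i → r ≤ i → i < ∣ S ∣ → c ≤ element S i) →
               ∣ S ∩ tabulate (λ y → toℕ y <ᵇ c) ∣ ≡ r
  countBelow []            c       zero    _       _  _  = refl
  countBelow (s ∷ S)       zero    zero    _       _  _  = none (s ∷ S)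
  countBelow (s ∷ S)       zero    (suc r) _       lo _  = contradiction (lo 0 (s≤s z≤n)) λ ()
  countBelow (inside  ∷ S) (suc c) zero    _       _  hi = contradiction (hi 0 z≤n (s≤s z≤n)) λ ()
  countBelow (inside  ∷ S) (suc c) (suc r) (s≤s p) lo hi =
    cong suc (countBelow S c r p (λ i q → s≤s⁻¹ (lo (suc i) (s≤s q))) (λ i q q′ → s≤s⁻¹ (hi (suc i) (s≤s q) (s≤s q′))))
  countBelow (outside ∷ S) (suc c) r       p       lo hi =
    countBelow S c r p (λ i q → s≤s⁻¹ (lo i q)) (λ i q q′ → s≤s⁻¹ (hi i q q′))

record IsRank (X : ℕ → ℕ) (m x r : ℕ) : Set where
  field
    r≤m   : r ≤ m
    below : ∀ i → i < r → X i ≤ x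
    above : ∀ i → r ≤ i → i < m → x < X i

rank-unique : ∀ {n} (S : Subset n) (x : Fin n) {r} → IsRank (element S) ∣ S ∣ (toℕ x) r → rank x S ≡ r
rank-unique S x {r} h = trans (cong (λ p → ∣ S ∩ p ∣) (tabulate-cong same))
                          (countBelow S (suc (toℕ x)) r r≤m (λ i p → s≤s (below i p)) above)
  where
  open IsRank h
  same : ∀ y → ⌊ y ≤ᶠ? x ⌋ ≡ (toℕ y <ᵇ suc (toℕ x))
  same y with y ≤ᶠ? x
  ... | yes p = sym (T⇒true (<⇒<ᵇ (s≤s p)))
  ... | no ¬p = sym (¬T⇒false (λ q → ¬p (s≤s⁻¹ (<ᵇ⇒< (toℕ y) (suc (toℕ x)) q))))

-- The programs

-- Registers 4 and 5 hold the ends of the interval of the binary search, which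
-- is halved without branching, using the result 7 of the comparison as a number.
selectPreamble rankPreamble rankTest rankStep : Block
selectPreamble = (3 , var 0 :- lit 1) ∷ []
rankPreamble   = (4 , lit 0) ∷ (5 , var 2 :+ lit 0) ∷ []
rankTest       = (6 , bin lt (var 4) (var 5)) ∷ []
rankStep       =
  (3 , (var 4 :+ var 5) :/ lit 2) ∷
  selectBlock ++
  (7 , bin lt (var 0) (var rAnswer)) ∷
  (8 , lit 1 :- var 7) ∷
  (4 , var 8 :* (var 3 :+ lit 1) :+ var 7 :* var 4) ∷
  (5 , var 8 :* var 5 :+ var 7 :* var 3) ∷ []

selectProgramBlock : Block
selectProgramBlock = selectPreamble ++ selectBlock

haltAfter : Block → Register → Program
haltAfter B r = compileBlock B ++ halt r ∷ []

-- A loop which runs the block B as long as register 6 is nonzero after T.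
loop : (P T B : Block) → Register → Program
loop P T B r = p ++ t ++ jz 6 exit ∷ b ++ jump (length p) ∷ halt r ∷ []
  where
  p = compileBlock P
  t = compileBlock T
  b = compileBlock B
  exit = suc (length b + suc (length t + length p))

loopTime : (T B : Block) → ℕ → ℕ
loopTime T B zero    = length (compileBlock T) + 2
loopTime T B (suc k) = length (compileBlock T) + suc (length (compileBlock B) + suc (loopTime T B k))

module Running (w : ℕ) (μ : Memory) where

  open Machine w μ

  record Halts (p : Program) (t : ℕ) (ρ : Store) (v : ℕ) : Set where
    constructor halts
    field halting : run p w t ⟨ 0 , ρ , μ ⟩ ≡ just (v , μ)

  Halts-run : ∀ {p t t′ ρ v} → Halts p t ρ v → t ≤ t′ → run p w t′ ⟨ 0 , ρ , μ ⟩ ≡ just (v , μ)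
  Halts-run {p} (halts h) t≤ = run-mono p t≤ h

  run-haltAfter : ∀ B {r σ τ} → wellFormed B ≡ true → r < firstTemporary → Exec B σ τ →
                  Halts (haltAfter B r) (length (compileBlock B) + 1) σ (τ r)
  run-haltAfter B {r} {σ} wf r< x = halts (go (run-block (haltAfter B r) B 0 1 wf (proj₁ located) x (λ _ _ → refl)))
    where
    located = At-++ (compileBlock B) (At-suffix [] (compileBlock B ++ halt r ∷ []))
    go : ∃[ ρ ] (ρ ≈ _ × run (haltAfter B r) w (length (compileBlock B) + 1) ⟨ 0 , σ , μ ⟩
                         ≡ run (haltAfter B r) w 1 ⟨ length (compileBlock B) + 0 , ρ , μ ⟩) → _
    go (ρ , ρ≈ , eq) rewrite proj₁ (proj₂ located) = trans eq (cong (λ v → just (v , μ)) (ρ≈ r r<))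

  module _ (P T B : Block) (r : Register) (r< : r < firstTemporary)
           (wfP : wellFormed P ≡ true) (wfT : wellFormed T ≡ true) (wfB : wellFormed B ≡ true)
           (State : ℕ → Store → Set) (Done : ℕ → Set)
           (step : ∀ {k σ} → State k σ → ∃[ τ ] (Exec T σ τ ×
             ((τ 6 ≡ 0 × Done (τ r)) ⊎
              (∃[ k′ ] ∃[ υ ] (k ≡ suc k′ × τ 6 ≢ 0 × Exec B τ υ × State k′ υ))))) where

    private
      prog : Program
      prog = loop P T B r

      p = compileBlock P
      t = compileBlock T
      b = compileBlock B

      start : ℕ
      start = length p

      afterT  = At-++ {prog} t (At-suffix p _)
      afterJz = At-++ {prog} b (proj₂ (proj₂ afterT))

      loop-time≥ : ∀ k → loopTime T B 0 ≤ loopTime T B k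
      loop-time≥ zero    = ≤-refl
      loop-time≥ (suc k) = +-monoʳ-≤ (length t)
        (s≤s (≤-trans (s≤s z≤n) (m≤n+m (suc (loopTime T B k)) (length b))))

      run-jz : ∀ f ρ → run prog w (suc f) ⟨ length t + start , ρ , μ ⟩
                       ≡ run prog w f ⟨ (if ρ 6 ≡ᵇ 0 then suc (length b + suc (length t + start)) else suc (length t + start)) , ρ , μ ⟩
      run-jz f ρ rewrite proj₁ (proj₂ afterT) = refl

      run-jump : ∀ f ρ → run prog w (suc f) ⟨ length b + suc (length t + start) , ρ , μ ⟩ ≡ run prog w f ⟨ start , ρ , μ ⟩
      run-jump f ρ rewrite proj₁ (proj₂ afterJz) = refl

      run-halt : ∀ ρ → run prog w 1 ⟨ suc (length b + suc (length t + start)) , ρ , μ ⟩ ≡ just (ρ r , μ)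
      run-halt ρ rewrite proj₁ (proj₂ (proj₂ afterJz)) = refl

      run-loop : ∀ k {σ ρ} → State k σ → ρ ≈ σ →
                 ∃[ v ] (Done v × run prog w (loopTime T B k) ⟨ start , ρ , μ ⟩ ≡ just (v , μ))
      run-loop k {ρ = ρ} st ρ≈ with step st
      ... | τ , xT , inj₁ (τ6≡0 , done) =
        let ρ′ , ρ′≈ , eq = run-block prog T start 2 wfT (proj₁ afterT) xT ρ≈ in
        τ r , done , run-mono prog (loop-time≥ k) (begin
          run prog w (loopTime T B 0) ⟨ start , ρ , μ ⟩   ≡⟨ eq ⟩
          run prog w 2 ⟨ length t + start , ρ′ , μ ⟩      ≡⟨ run-jz 1 ρ′ ⟩
          _                                               ≡⟨ cong (λ z → run prog w 1 ⟨ (if z ≡ᵇ 0 then suc (length b + suc (length t + start)) else suc (length t + start)) , ρ′ , μ ⟩)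
                                                               (trans (ρ′≈ 6 (≤ᵇ⇒≤ 7 40 tt)) τ6≡0) ⟩
          _                                               ≡⟨ run-halt ρ′ ⟩
          just (ρ′ r , μ)                                 ≡⟨ cong (λ v → just (v , μ)) (ρ′≈ r r<) ⟩
          just (τ r , μ)                                  ∎)
        where open ≡-Reasoning
      ... | τ , xT , inj₂ (k′ , υ , refl , τ6≢0 , xB , st′) =
        let fuel = length b + suc (loopTime T B k′)
            ρ′ , ρ′≈ , eq = run-block prog T start (suc fuel) wfT (proj₁ afterT) xT ρ≈
            ρ″ , ρ″≈ , eq′ = run-block prog B (suc (length t + start)) (suc (loopTime T B k′)) wfB (proj₁ afterJz) xB ρ′≈
            v , done , eq″ = run-loop k′ st′ ρ″≈ in
        v , done , (begin
          run prog w (loopTime T B (suc k′)) ⟨ start , ρ , μ ⟩  ≡⟨ eq ⟩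
          _                                                     ≡⟨ run-jz fuel ρ′ ⟩
          _                                                     ≡⟨ cong (λ z → run prog w fuel ⟨ (if z then suc (length b + suc (length t + start)) else suc (length t + start)) , ρ′ , μ ⟩)
                                                                     (¬T⇒false (λ ρ6≡0 → τ6≢0 (trans (sym (ρ′≈ 6 (≤ᵇ⇒≤ 7 40 tt))) (≡ᵇ⇒≡ (ρ′ 6) 0 ρ6≡0)))) ⟩
          _                                                     ≡⟨ eq′ ⟩
          _                                                     ≡⟨ run-jump (loopTime T B k′) ρ″ ⟩
          _                                                     ≡⟨ eq″ ⟩
          just (v , μ)                                          ∎)
        where open ≡-Reasoning

    run-loopProgram : ∀ k {σ τ} → Exec P σ τ → State k τ →
                      ∃[ v ] (Done v × Halts (loop P T B r) (length (compileBlock P) + loopTime T B k) σ v)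
    run-loopProgram k {σ} xP st =
      let ρ , ρ≈ , eq = run-block prog P 0 (loopTime T B k) wfP (proj₁ (At-++ {prog} p (At-suffix [] prog))) xP (λ _ _ → refl)
          v , done , eq′ = run-loop k st ρ≈
      in v , done , halts (trans eq (trans (cong (λ z → run prog w (loopTime T B k) ⟨ z , ρ , μ ⟩) (+-identityʳ (length p))) eq′))

wf-select : wellFormed selectProgramBlock ≡ true
wf-select = refl

wf-step : wellFormed rankStep ≡ true
wf-step = refl

module Queries (s : ℕ) (1≤s : 1 ≤ s) (μ : Memory) {n m : ℕ} (X : ℕ → ℕ)
               (n< : n < 2 ^ (1 * s)) (m≤n : m ≤ n) (X-mono : Monotone X) (X≤n : ∀ i → X i ≤ n) where

  open Evaluation s 1≤s μ
  open Running w μ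

  module _ (select-correct : ∀ {σ i} → σ 1 ≡ n → σ 2 ≡ m → σ 3 ≡ i → i < m →
                             ∃[ τ ] (Exec selectBlock σ τ × τ rAnswer ≡ X i)) where

    private
      <1 : ∀ {k} → k ≤ n → k < 2 ^ (1 * s)
      <1 p = ≤-<-trans p n<

    run-select : ∀ i → i < m →
                 Halts (haltAfter selectProgramBlock rAnswer) (length (compileBlock selectProgramBlock) + 1) (initRegs (suc i) n m) (X i)
    run-select i i<m =
      let τ , x , answer≡ = select-correct {setReg (initRegs (suc i) n m) 3 i} refl refl refl i<m in
      subst (Halts _ _ _) answer≡
        (run-haltAfter selectProgramBlock wf-select (≤ᵇ⇒≤ 10 40 tt)
          (⇓- (⇓var 1 refl (<1 (≤-trans i<m m≤n))) (⇓lit 1 1) (s≤s z≤n) ok ▸ x))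

    module _ (x : ℕ) (x< : x < 2 ^ (1 * s)) where

      record Search (k : ℕ) (σ : Store) : Set where
        field
          lo hi : ℕ
          x≡  : σ 0 ≡ x
          n≡  : σ 1 ≡ n
          m≡  : σ 2 ≡ m
          lo≡ : σ 4 ≡ lo
          hi≡ : σ 5 ≡ hi
          lo≤m  : lo ≤ m
          hi≤m  : hi ≤ m
          close : hi < lo + 2 ^ k
          below : ∀ i → i < lo → X i ≤ x
          above : ∀ i → hi ≤ i → i < m → x < X i

      Outcome : ℕ → Store → Set
      Outcome k τ = (τ 6 ≡ 0 × IsRank X m x (τ 4)) ⊎
                    (∃[ k′ ] ∃[ υ ] (k ≡ suc k′ × τ 6 ≢ 0 × Exec rankStep τ υ × Search k′ υ))

      search-step : ∀ {k σ} → Search k σ → ∃[ τ ] (Exec rankTest σ τ × Outcome k τ)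
      search-step {k} {σ} S = _ , (⇓lt (⇓var 1 lo≡ lo<) (⇓var 1 hi≡ hi<) ▸ []) , go (lo <? hi) k refl
        where
        open Search S
        lo< = <1 (≤-trans lo≤m m≤n)
        hi< = <1 (≤-trans hi≤m m≤n)
        go : Dec (lo < hi) → ∀ k′ → k′ ≡ k → Outcome k (setReg σ 6 (if lo <ᵇ hi then 1 else 0))
        go (no lo≮hi) _ _ = inj₁ (cong (if_then 1 else 0) (¬T⇒false (lo≮hi ∘ <ᵇ⇒< lo hi)) , subst (IsRank X m x) (sym lo≡)
          record { r≤m = lo≤m ; below = below ; above = λ i p → above i (≤-trans (≮⇒≥ lo≮hi) p) })
        go (yes lo<hi) zero refl = contradiction close (≤⇒≯ (≤-trans (≤-reflexive (+-comm lo 1)) lo<hi))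
        go (yes lo<hi) (suc k′) refl = inj₂ (k′ , τ₂ , refl , test≢0 , iteration , next (x <ᵇ X mid) refl)
          where
          τ₀ : Store
          τ₀ = setReg σ 6 (if lo <ᵇ hi then 1 else 0)

          mid : ℕ
          mid = (lo + hi) / 2

          mid≡ : lo + hi ≡ mid * 2 + (lo + hi) % 2
          mid≡ = m≡[m/n]*n+m%n (lo + hi) 2

          2mid≤ : mid * 2 ≤ lo + hi
          2mid≤ = m/n*n≤m (lo + hi) 2

          <2mid+2 : lo + hi < suc mid * 2
          <2mid+2 = begin-strict
            lo + hi                        ≡⟨ mid≡ ⟩
            mid * 2 + (lo + hi) % 2        <⟨ +-monoʳ-< (mid * 2) (m%n<n (lo + hi) 2) ⟩
            mid * 2 + 2                    ≡⟨ +-comm (mid * 2) 2 ⟩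
            suc mid * 2                    ∎
            where open ≤-Reasoning

          mid<hi : mid < hi
          mid<hi = m<n*o⇒m/o<n (<-≤-trans (+-monoˡ-< hi lo<hi) (≤-reflexive (double hi)))
            where
            double : ∀ h → h + h ≡ h * 2
            double = solve-∀

          mid≤n : mid ≤ n
          mid≤n = ≤-trans (<⇒≤ mid<hi) (≤-trans hi≤m m≤n)

          test≢0 : τ₀ 6 ≢ 0
          test≢0 eq = contradiction (trans (sym (cong (if_then 1 else 0) (T⇒true (<⇒<ᵇ lo<hi)))) eq) λ ()

          selection : ∃[ τ ] (Exec selectBlock (setReg τ₀ 3 mid) τ × τ rAnswer ≡ X mid)
          selection = select-correct n≡ m≡ refl (<-≤-trans mid<hi hi≤m)

          τ₁ : Store
          τ₁ = proj₁ selection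

          keep : ∀ r → avoids r selectBlock ≡ true → τ₁ r ≡ setReg τ₀ 3 mid r
          keep r ok = Exec-frame r ok (proj₁ (proj₂ selection))

          isGreater : ℕ
          isGreater = if x <ᵇ X mid then 1 else 0

          x₁≡ = trans (keep 0 refl) x≡
          lo₁≡ = trans (keep 4 refl) lo≡
          hi₁≡ = trans (keep 5 refl) hi≡
          mid₁≡ = keep 3 refl

          gt≤1 : isGreater ≤ 1
          gt≤1 with x <ᵇ X mid
          ... | true  = ≤-refl
          ... | false = z≤n

          gt< : isGreater < 2 ^ (1 * s)
          gt< = fits-lit {1} (s≤s gt≤1)

          τ₂ : Store
          τ₂ = setReg (setReg (setReg (setReg τ₁ 7 isGreater) 8 (1 ∸ isGreater))
                 4 ((1 ∸ isGreater) * (mid + 1) + isGreater * lo))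
                 5 ((1 ∸ isGreater) * hi + isGreater * mid)

          update : Exec _ τ₁ τ₂
          update =
              ⇓lt (⇓var 1 x₁≡ x<) (⇓var 1 (proj₂ (proj₂ selection)) (<1 (X≤n mid)))
            ▸ ⇓- (⇓lit 1 1) (⇓var 1 refl gt<) gt≤1 ok
            ▸ ⇓+ (⇓* (⇓var 1 refl (≤-<-trans (m∸n≤m 1 isGreater) (fits-lit {1} (s≤s (s≤s z≤n)))))
                     (⇓+ (⇓var 1 mid₁≡ (<1 mid≤n)) (⇓lit 1 1) ok) ok)
                 (⇓* (⇓var 1 refl gt<) (⇓var 1 lo₁≡ lo<) ok) ok
            ▸ ⇓+ (⇓* (⇓var 1 refl (≤-<-trans (m∸n≤m 1 isGreater) (fits-lit {1} (s≤s (s≤s z≤n))))) (⇓var 1 hi₁≡ hi<) ok)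
                 (⇓* (⇓var 1 refl gt<) (⇓var 1 mid₁≡ (<1 mid≤n)) ok) ok
            ▸ []

          iteration : Exec rankStep τ₀ τ₂
          iteration =
              ⇓/ (⇓+ (⇓var 1 lo≡ lo<) (⇓var 1 hi≡ hi<) ok) (⇓lit 2 2) ok
            ▸ Exec-++ (proj₁ (proj₂ selection)) update

          blend : ∀ b y z → (x <ᵇ X mid) ≡ b → (1 ∸ isGreater) * y + isGreater * z ≡ (if b then z else y)
          blend b y z eq = trans (cong (λ g → (1 ∸ (if g then 1 else 0)) * y + (if g then 1 else 0) * z) eq) (blended b)
            where
            blended : ∀ b → (1 ∸ (if b then 1 else 0)) * y + (if b then 1 else 0) * z ≡ (if b then z else y)
            blended true  = +-identityʳ z
            blended false = trans (+-identityʳ (y + 0)) (+-identityʳ y)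

          next : ∀ b → (x <ᵇ X mid) ≡ b → Search k′ τ₂
          next true eq = record
            { lo = lo ; hi = mid
            ; x≡ = x₁≡ ; n≡ = trans (keep 1 refl) n≡ ; m≡ = trans (keep 2 refl) m≡
            ; lo≡ = blend true (mid + 1) lo eq ; hi≡ = blend true hi mid eq
            ; lo≤m = lo≤m ; hi≤m = ≤-trans (<⇒≤ mid<hi) hi≤m
            ; close = *-cancelʳ-< 2 mid (lo + 2 ^ k′) (begin-strict
                mid * 2                    ≤⟨ 2mid≤ ⟩
                lo + hi                    <⟨ +-monoʳ-< lo close ⟩
                lo + (lo + 2 * 2 ^ k′)     ≡⟨ regroup lo (2 ^ k′) ⟩
                (lo + 2 ^ k′) * 2          ∎)
            ; below = below
            ; above = λ i p _ → <-≤-trans (<ᵇ-true eq) (X-mono p)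
            }
            where
            open ≤-Reasoning
            regroup : ∀ l p → l + (l + 2 * p) ≡ (l + p) * 2
            regroup = solve-∀
          next false eq = record
            { lo = suc mid ; hi = hi
            ; x≡ = x₁≡ ; n≡ = trans (keep 1 refl) n≡ ; m≡ = trans (keep 2 refl) m≡
            ; lo≡ = trans (blend false (mid + 1) lo eq) (+-comm mid 1) ; hi≡ = blend false hi mid eq
            ; lo≤m = ≤-trans mid<hi hi≤m ; hi≤m = hi≤m
            ; close = *-cancelʳ-< 2 hi (suc mid + 2 ^ k′) (begin-strict
                hi * 2                          ≡⟨ double hi ⟩
                hi + hi                         <⟨ +-monoʳ-< hi close ⟩
                hi + (lo + 2 * 2 ^ k′)          ≡⟨ regroup hi lo (2 ^ k′) ⟩
                lo + hi + 2 ^ k′ * 2            <⟨ +-monoˡ-< (2 ^ k′ * 2) <2mid+2 ⟩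
                suc mid * 2 + 2 ^ k′ * 2        ≡⟨ *-distribʳ-+ 2 (suc mid) (2 ^ k′) ⟨
                (suc mid + 2 ^ k′) * 2          ∎)
            ; below = λ i p → ≤-trans (X-mono (s≤s⁻¹ p)) (≮⇒≥ (λ q → subst T eq (<⇒<ᵇ q)))
            ; above = above
            }
            where
            open ≤-Reasoning
            double : ∀ h → h * 2 ≡ h + h
            double = solve-∀
            regroup : ∀ h l p → h + (l + 2 * p) ≡ l + h + p * 2
            regroup = solve-∀

      run-rank : ∀ k → m < 2 ^ k →
                 ∃[ r ] (IsRank X m x r × Halts (loop rankPreamble rankTest rankStep 4)
                                                (length (compileBlock rankPreamble) + loopTime rankTest rankStep k) (initRegs x n m) r)
      run-rank k m<2^k =
        run-loopProgram rankPreamble rankTest rankStep 4 (≤ᵇ⇒≤ 5 40 tt) refl refl wf-step Search (IsRank X m x) search-step k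
          (⇓lit 0 1 ▸ ⇓-cong (+-identityʳ m) (⇓+ (⇓var 1 refl (<1 m≤n)) (⇓lit 0 1) ok) ▸ [])
          record
            { lo = 0 ; hi = m ; x≡ = refl ; n≡ = refl ; m≡ = refl ; lo≡ = refl ; hi≡ = refl
            ; lo≤m = z≤n ; hi≤m = ≤-refl ; close = m<2^k
            ; below = λ _ () ; above = λ i p q → contradiction q (≤⇒≯ p) }

-- Space

private
  2pq≤p²+q² : ∀ p q → p * q + p * q ≤ p * p + q * q
  2pq≤p²+q² p q with ≤-total p q
  ... | inj₁ p≤q = subst (λ z → p * z + p * z ≤ p * p + z * z) (m+[n∸m]≡n p≤q)
                     (≤-trans (m≤m+n _ ((q ∸ p) * (q ∸ p))) (≤-reflexive (square p (q ∸ p))))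
    where
    square : ∀ p d → p * (p + d) + p * (p + d) + d * d ≡ p * p + (p + d) * (p + d)
    square = solve-∀
  ... | inj₂ q≤p = subst (λ z → z * q + z * q ≤ z * z + q * q) (m+[n∸m]≡n q≤p)
                     (≤-trans (m≤m+n _ ((p ∸ q) * (p ∸ q))) (≤-reflexive (square q (p ∸ q))))
    where
    square : ∀ q d → (q + d) * q + (q + d) * q + d * d ≡ (q + d) * (q + d) + q * q
    square = solve-∀

-- The tangent of x ↦ x ^ (j + 1) at q lies below the graph.
tangent : ∀ j p q → suc j * (p * q ^ j) ≤ p ^ suc j + j * q ^ suc j
tangent zero    p q = ≤-reflexive (base p)
  where
  base : ∀ p → p * 1 + 0 ≡ p * 1 + 0
  base = solve-∀
tangent (suc j) p q = +-cancelʳ-≤ (p * (j * q ^ suc j)) _ _ (begin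
  suc (suc j) * (p * (q * Q)) + p * (j * (q * Q))          ≡⟨ left j p q Q ⟩
  suc j * Q * (p * q + p * q)                              ≤⟨ *-monoʳ-≤ (suc j * Q) (2pq≤p²+q² p q) ⟩
  suc j * Q * (p * p + q * q)                              ≡⟨ middle j p q Q ⟩
  p * (suc j * (p * Q)) + suc j * (q * (q * Q))            ≤⟨ +-monoˡ-≤ _ (*-monoʳ-≤ p (tangent j p q)) ⟩
  p * (p * P + j * (q * Q)) + suc j * (q * (q * Q))        ≡⟨ right j p q P Q ⟩
  p * (p * P) + suc j * (q * (q * Q)) + p * (j * (q * Q))  ∎)
  where
  open ≤-Reasoning
  P = p ^ j
  Q = q ^ j
  left : ∀ j p q Q → suc (suc j) * (p * (q * Q)) + p * (j * (q * Q)) ≡ suc j * Q * (p * q + p * q)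
  left = solve-∀
  middle : ∀ j p q Q → suc j * Q * (p * p + q * q) ≡ p * (suc j * (p * Q)) + suc j * (q * (q * Q))
  middle = solve-∀
  right : ∀ j p q P Q → p * (p * P + j * (q * Q)) + suc j * (q * (q * Q)) ≡ p * (p * P) + suc j * (q * (q * Q)) + p * (j * (q * Q))
  right = solve-∀

^-distribʳ-* : ∀ k m n → (m * n) ^ k ≡ m ^ k * n ^ k
^-distribʳ-* zero    m n = refl
^-distribʳ-* (suc k) m n = trans (cong (m * n *_) (^-distribʳ-* k m n)) ([m*n]*[o*p]≡[m*o]*[n*p] m n (m ^ k) (n ^ k))

-- The induction step of the inequality of arithmetic and geometric means:
-- S is the sum of j numbers, to which x is added.
mean-step : ∀ j S x .{{_ : NonZero j}} → suc j ^ suc j * (S ^ j * x) ≤ (S + x) ^ suc j * j ^ j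
mean-step j S x = *-cancelˡ-≤ j (+-cancelʳ-≤ (j * q ^ suc j) _ _ (begin
  j * (suc j ^ suc j * (S ^ j * x)) + j * q ^ suc j
    ≡⟨ cong (λ z → j * (suc j ^ suc j * (S ^ j * x)) + j * (q * z)) q^j ⟩
  j * (suc j * suc j ^ j * (S ^ j * x)) + j * (q * (suc j ^ j * S ^ j))
    ≡⟨ expand j (suc j ^ j) (S ^ j) S x ⟩
  suc j * (p * (suc j ^ j * S ^ j))
    ≡⟨ cong (λ z → suc j * (p * z)) q^j ⟨
  suc j * (p * q ^ j)
    ≤⟨ tangent j p q ⟩
  p ^ suc j + j * q ^ suc j
    ≡⟨ cong (_+ j * q ^ suc j) (trans (^-distribʳ-* (suc j) j (S + x)) (arrange j (j ^ j) ((S + x) ^ suc j))) ⟩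
  j * ((S + x) ^ suc j * j ^ j) + j * q ^ suc j  ∎))
  where
  open ≤-Reasoning
  p = j * (S + x)
  q = suc j * S
  q^j : q ^ j ≡ suc j ^ j * S ^ j
  q^j = ^-distribʳ-* j (suc j) S
  expand : ∀ j a b S x → j * (suc j * a * (b * x)) + j * (suc j * S * (a * b)) ≡ suc j * (j * (S + x) * (a * b))
  expand = solve-∀
  arrange : ∀ j a b → j * a * b ≡ j * (b * a)
  arrange = solve-∀

-- The inequality of arithmetic and geometric means for k ones and d twos.
ones-and-twos : ∀ k d → (k + d) ^ (k + d) * 2 ^ d ≤ (k + d + d) ^ (k + d)
ones-and-twos k zero    = ≤-reflexive (trans (*-identityʳ _) (cong (_^ (k + 0)) (sym (+-identityʳ (k + 0)))))
ones-and-twos k (suc d) rewrite +-suc k d = go (k + d) refl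
  where
  go : ∀ j → k + d ≡ j → suc j ^ suc j * 2 ^ suc d ≤ (suc j + suc d) ^ suc j
  go zero    eq rewrite m+n≡0⇒n≡0 k eq = ≤-refl
  go j@(suc _) eq = *-cancelʳ-≤ _ _ (j ^ j) {{m^n≢0 j j}} (begin
    suc j ^ suc j * (2 * 2 ^ d) * j ^ j      ≡⟨ rearrange (suc j ^ suc j) (2 ^ d) (j ^ j) ⟩
    suc j ^ suc j * (j ^ j * 2 ^ d * 2)      ≤⟨ *-monoʳ-≤ (suc j ^ suc j) (*-monoˡ-≤ 2 (subst (λ z → z ^ z * 2 ^ d ≤ (z + d) ^ z) eq (ones-and-twos k d))) ⟩
    suc j ^ suc j * ((j + d) ^ j * 2)        ≤⟨ mean-step j (j + d) 2 ⟩
    (j + d + 2) ^ suc j * j ^ j              ≡⟨ cong (λ z → z ^ suc j * j ^ j) (two j d) ⟩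
    (suc j + suc d) ^ suc j * j ^ j          ∎)
    where
    open ≤-Reasoning
    rearrange : ∀ a b c → a * (2 * b) * c ≡ a * (c * b * 2)
    rearrange = solve-∀
    two : ∀ j d → j + d + 2 ≡ suc j + suc d
    two = solve-∀

-- In logarithmic terms, 2 ^ t ≤ 1 + t for 0 ≤ t ≤ 1, where 1 + t = u / m.
m^m*2^u≤ : ∀ {m u} → m ≤ u → u ≤ 2 * m → m ^ m * 2 ^ u ≤ u ^ m * 2 ^ m
m^m*2^u≤ {m} {u} m≤u u≤2m = begin
  m ^ m * 2 ^ u                        ≡⟨ cong (λ z → m ^ m * 2 ^ z) (m+[n∸m]≡n m≤u) ⟨
  m ^ m * 2 ^ (m + d)                  ≡⟨ cong (m ^ m *_) (trans (cong (2 ^_) (+-comm m d)) (^-distribˡ-+-* 2 d m)) ⟩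
  m ^ m * (2 ^ d * 2 ^ m)              ≡⟨ *-assoc (m ^ m) (2 ^ d) (2 ^ m) ⟨
  m ^ m * 2 ^ d * 2 ^ m                ≤⟨ *-monoˡ-≤ (2 ^ m) (subst (λ z → z ^ z * 2 ^ d ≤ (z + d) ^ z) (m∸n+n≡m d≤m) (ones-and-twos (m ∸ d) d)) ⟩
  (m + d) ^ m * 2 ^ m                  ≡⟨ cong (λ z → z ^ m * 2 ^ m) (m+[n∸m]≡n m≤u) ⟩
  u ^ m * 2 ^ m                        ∎
  where
  open ≤-Reasoning
  d = u ∸ m
  d≤m : d ≤ m
  d≤m = ≤-trans (∸-monoˡ-≤ m u≤2m) (≤-reflexive (trans (m+n∸m≡n m (m + 0)) (+-identityʳ m)))

space-bound : ∀ n m b f .{{_ : NonZero m}} → m ≤ n →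
              b ≤ m * lowWidth m n + m + n /2^ lowWidth m n + f → b ≤ m log₂[ n / m ]+ (2 * m + f)
space-bound n m b f m≤n b≤ = begin
  2 ^ b * m ^ m                                  ≤⟨ *-monoˡ-≤ (m ^ m) (^-monoʳ-≤ 2 b≤) ⟩
  2 ^ (m * L + m + u + f) * m ^ m                ≡⟨ cong (_* m ^ m) powers ⟩
  2 ^ (m * L) * 2 ^ m * 2 ^ u * 2 ^ f * m ^ m    ≡⟨ rearrange (2 ^ (m * L)) (2 ^ m) (2 ^ u) (2 ^ f) (m ^ m) ⟩
  2 ^ (m * L) * 2 ^ m * 2 ^ f * (m ^ m * 2 ^ u)  ≤⟨ *-monoʳ-≤ (2 ^ (m * L) * 2 ^ m * 2 ^ f) (m^m*2^u≤ m≤u (<⇒≤ (high-< m n))) ⟩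
  2 ^ (m * L) * 2 ^ m * 2 ^ f * (u ^ m * 2 ^ m)  ≡⟨ rearrange′ (2 ^ (m * L)) (2 ^ m) (2 ^ f) (u ^ m) ⟩
  u ^ m * 2 ^ (m * L) * (2 ^ m * 2 ^ m * 2 ^ f)  ≡⟨ cong₂ _*_ base exponent ⟩
  (u * 2 ^ L) ^ m * 2 ^ (2 * m + f)              ≤⟨ *-monoˡ-≤ (2 ^ (2 * m + f)) (^-monoˡ-≤ m (/2^-*-≤ L n)) ⟩
  n ^ m * 2 ^ (2 * m + f)                        ∎
  where
  open ≤-Reasoning
  L = lowWidth m n
  u = n /2^ L
  m≤u : m ≤ u
  m≤u with lowWidth-≤ m n
  ... | inj₁ eq rewrite eq = ≤-trans m≤n (≤-reflexive (sym (n/1≡n n)))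
  ... | inj₂ p  = ≤-trans (≤-reflexive (sym (m*n/n≡m m (2 ^ L) {{m^n≢0 2 L}}))) (/2^-mono L p)
  powers : 2 ^ (m * L + m + u + f) ≡ 2 ^ (m * L) * 2 ^ m * 2 ^ u * 2 ^ f
  powers = trans (^-distribˡ-+-* 2 (m * L + m + u) f) (cong (_* 2 ^ f)
             (trans (^-distribˡ-+-* 2 (m * L + m) u) (cong (_* 2 ^ u) (^-distribˡ-+-* 2 (m * L) m))))
  rearrange : ∀ a b c d e → a * b * c * d * e ≡ a * b * d * (e * c)
  rearrange = solve-∀
  rearrange′ : ∀ a b d e → a * b * d * (e * b) ≡ e * a * (b * b * d)
  rearrange′ = solve-∀
  base : u ^ m * 2 ^ (m * L) ≡ (u * 2 ^ L) ^ m
  base = trans (cong (u ^ m *_) (trans (cong (2 ^_) (*-comm m L)) (sym (^-*-assoc 2 L m)))) (sym (^-distribʳ-* m u (2 ^ L)))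
  exponent : 2 ^ m * 2 ^ m * 2 ^ f ≡ 2 ^ (2 * m + f)
  exponent = trans (cong (_* 2 ^ f) (trans (sym (^-distribˡ-+-* 2 m m)) (cong (λ z → 2 ^ (m + z)) (sym (+-identityʳ m)))))
               (sym (^-distribˡ-+-* 2 (2 * m) f))

-- Time

log≤rankTime : ∀ n m .{{_ : NonZero m}} → m ≤ n → ⌊log₂ m ⌋ ≤ rankTime n m
log≤rankTime zero zero _ = z≤n
log≤rankTime n@(suc _) m m≤n with ⌊log₂ m ⌋ ≤? suc ⌊log₂ (n / m) ⌋
... | yes p = ≤-trans p (m≤m+n _ _)
... | no ¬p = ≤-trans (≤-trans (≤-reflexive (sym (m*n/n≡m ℓ s))) (/-monoˡ-≤ s ℓs≤ℓ⁴)) (m≤n+m (ℓ ^ 4 / s) (suc ρ))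
  where
  ℓ = ⌊log₂ m ⌋
  ρ = ⌊log₂ (n / m) ⌋
  s = suc ⌊log₂ n ⌋
  n< : n < 2 ^ (suc ℓ + suc ρ)
  n< = begin-strict
    n                          ≡⟨ m≡[m/n]*n+m%n n m ⟩
    n / m * m + n % m          <⟨ +-monoʳ-< (n / m * m) (m%n<n n m) ⟩
    n / m * m + m              ≡⟨ +-comm (n / m * m) m ⟩
    suc (n / m) * m            ≤⟨ *-mono-≤ (<2^[1+log] (n / m)) (<⇒≤ (<2^[1+log] m)) ⟩
    2 ^ suc ρ * 2 ^ suc ℓ      ≡⟨ ^-distribˡ-+-* 2 (suc ρ) (suc ℓ) ⟨
    2 ^ (suc ρ + suc ℓ)        ≡⟨ cong (2 ^_) (+-comm (suc ρ) (suc ℓ)) ⟩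
    2 ^ (suc ℓ + suc ρ)        ∎
    where open ≤-Reasoning
  s≤2ℓ : s ≤ ℓ + ℓ
  s≤2ℓ = begin
    s                ≤⟨ 2^-cancel-< {⌊log₂ n ⌋} (≤-<-trans (2^log≤ n) n<) ⟩
    suc ℓ + suc ρ    ≡⟨ +-suc ℓ (suc ρ) ⟨
    ℓ + suc (suc ρ)  ≤⟨ +-monoʳ-≤ ℓ (≰⇒> ¬p) ⟩
    ℓ + ℓ            ∎
    where open ≤-Reasoning
  2≤ℓ : 2 ≤ ℓ
  2≤ℓ = ≤-trans (s≤s (s≤s z≤n)) (≰⇒> ¬p)
  ℓs≤ℓ⁴ : ℓ * s ≤ ℓ ^ 4
  ℓs≤ℓ⁴ = begin
    ℓ * s                  ≤⟨ *-monoʳ-≤ ℓ s≤2ℓ ⟩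
    ℓ * (ℓ + ℓ)            ≡⟨ twice ℓ ⟩
    ℓ * (ℓ * 2)            ≤⟨ *-monoʳ-≤ ℓ (*-monoʳ-≤ ℓ 2≤ℓ) ⟩
    ℓ * (ℓ * ℓ)            ≤⟨ *-monoʳ-≤ ℓ (*-monoʳ-≤ ℓ (m≤m*n ℓ (ℓ * 1) {{>-nonZero (≤-trans (≤-trans (s≤s z≤n) 2≤ℓ) (≤-reflexive (sym (*-identityʳ ℓ))))}})) ⟩
    ℓ ^ 4                  ∎
    where
    open ≤-Reasoning
    twice : ∀ x → x * (x + x) ≡ x * (x * 2)
    twice = solve-∀

-- Redundancy

private
  n²≤4*2^n : ∀ n → n * n ≤ 4 * 2 ^ n
  n²≤4*2^n zero    = z≤n
  n²≤4*2^n (suc n) = begin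
    suc n * suc n            ≡⟨ square n ⟩
    n * n + (2 * n + 1)      ≤⟨ +-mono-≤ (n²≤4*2^n n) (≤-trans (≤-trans (+-monoʳ-≤ (2 * n) (s≤s z≤n)) (≤-reflexive (sym (*-suc′ n)))) (*-mono-≤ {2} {4} (s≤s (s≤s z≤n)) (n<2^n n))) ⟩
    4 * 2 ^ n + 4 * 2 ^ n    ≡⟨ double (2 ^ n) ⟩
    4 * 2 ^ suc n            ∎
    where
    open ≤-Reasoning
    square : ∀ n → suc n * suc n ≡ n * n + (2 * n + 1)
    square = solve-∀
    *-suc′ : ∀ n → 2 * suc n ≡ 2 * n + 2
    *-suc′ = solve-∀
    double : ∀ p → 4 * p + 4 * p ≡ 4 * (2 * p)
    double = solve-∀

linear≤2^ : ∀ k e → 4 * k ≤ e → k * e ≤ 2 ^ e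
linear≤2^ k e p = *-cancelˡ-≤ 4 (begin
  4 * (k * e)    ≡⟨ *-assoc 4 k e ⟨
  4 * k * e      ≤⟨ *-monoˡ-≤ e p ⟩
  e * e          ≤⟨ n²≤4*2^n e ⟩
  4 * 2 ^ e      ∎)
  where open ≤-Reasoning

-- The parameter e with ℓ between 4 ^ e and 4 ^ (e + 1), where ℓ = ⌊log₂ m ⌋.
halfLogLog : ℕ → ℕ
halfLogLog ℓ = ⌊log₂ ℓ ⌋ / 2

4^halfLogLog≤ : ∀ ℓ → 2 ^ halfLogLog ℓ * 2 ^ halfLogLog ℓ ≤ 1 ⊔ ℓ
4^halfLogLog≤ zero        = ≤-refl
4^halfLogLog≤ ℓ@(suc _) = begin
  2 ^ e * 2 ^ e         ≡⟨ ^-distribˡ-+-* 2 e e ⟨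
  2 ^ (e + e)           ≤⟨ ^-monoʳ-≤ 2 (≤-trans (≤-reflexive (double e)) (m/n*n≤m ⌊log₂ ℓ ⌋ 2)) ⟩
  2 ^ ⌊log₂ ℓ ⌋         ≤⟨ 2^log≤ ℓ ⟩
  ℓ                     ≤⟨ m≤n⊔m 1 ℓ ⟩
  1 ⊔ ℓ                 ∎
  where
  open ≤-Reasoning
  e = halfLogLog ℓ
  double : ∀ e → e + e ≡ e * 2
  double = solve-∀

4^halfLogLog≤′ : ∀ ℓ → 1 ≤ halfLogLog ℓ → 2 ^ halfLogLog ℓ * 2 ^ halfLogLog ℓ ≤ ℓ
4^halfLogLog≤′ (suc ℓ) _ = 4^halfLogLog≤ (suc ℓ)

<4^[1+halfLogLog] : ∀ ℓ → ℓ < 4 * (2 ^ halfLogLog ℓ * 2 ^ halfLogLog ℓ)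
<4^[1+halfLogLog] ℓ = begin-strict
  ℓ                          <⟨ <2^[1+log] ℓ ⟩
  2 ^ suc ⌊log₂ ℓ ⌋          ≤⟨ ^-monoʳ-≤ 2 (≤-trans (s≤s log≤) (≤-reflexive (double e))) ⟩
  2 ^ (2 + (e + e))          ≡⟨ trans (^-distribˡ-+-* 2 2 (e + e)) (cong (4 *_) (^-distribˡ-+-* 2 e e)) ⟩
  4 * (2 ^ e * 2 ^ e)        ∎
  where
  open ≤-Reasoning
  e = halfLogLog ℓ
  log≤ : ⌊log₂ ℓ ⌋ ≤ e * 2 + 1
  log≤ = ≤-trans (≤-reflexive (m≡[m/n]*n+m%n ⌊log₂ ℓ ⌋ 2)) (+-monoʳ-≤ (e * 2) (s≤s⁻¹ (m%n<n ⌊log₂ ℓ ⌋ 2)))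
  double : ∀ e → suc (e * 2 + 1) ≡ 2 + (e + e)
  double = solve-∀

halfLogLog-≥ : ∀ e {m} → 2 ^ 2 ^ (e * 2) ≤ m → e ≤ halfLogLog ⌊log₂ m ⌋
halfLogLog-≥ e {m} p = ≤-trans (≤-reflexive (sym (m*n/n≡m e 2))) (/-monoˡ-≤ 2 e2≤)
  where
  log-≥ : ∀ k {m} → 2 ^ k ≤ m → k ≤ ⌊log₂ m ⌋
  log-≥ k {m} p = ≤-trans (≤-reflexive (sym (⌊log₂[2^n]⌋≡n k))) (⌊log₂⌋-mono-≤ p)
  e2≤ : e * 2 ≤ ⌊log₂ ⌊log₂ m ⌋ ⌋
  e2≤ = log-≥ (e * 2) (log-≥ (2 ^ (e * 2)) p)

module _ (ℓ e m : ℕ) where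

  open Layout ℓ e m

  redundancy : ℕ
  redundancy = (suc ℓ + suc e + tableLength + (W₁ + W₁) + 2 * (Q₂ * W₂) + b₁) + pred Q₁ * ((W₁ + W₁) + 2 * (Q₂ * W₂))

  private
    instance
      E≢0 : NonZero E
      E≢0 = m^n≢0 2 e

      E²≢0 : NonZero (E * E)
      E²≢0 = m*n≢0 E E

      b₁≢0 : NonZero b₁
      b₁≢0 = m*n≢0 (E * E) E

    Mb₁≤m : pred Q₁ * b₁ ≤ m
    Mb₁≤m = m/n*n≤m m b₁

  size-bound : ∀ {n} X → (∀ i → X i ≤ n) → X m ≡ n →
               sizeOf X ≤ m * lowWidth m n + m + n /2^ lowWidth m n + redundancy
  size-bound {n} X X≤n refl = begin
    suc ℓ + (suc e + (tableLength + (m * L + (Q₁ * W₁ + (Q₁ * W₁ + (Q₁ * st₁ + X (Q₁ * b₁) /2^ L))))))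
      ≤⟨ +-monoʳ-≤ (suc ℓ) (+-monoʳ-≤ (suc e) (+-monoʳ-≤ tableLength (+-monoʳ-≤ (m * L) (+-monoʳ-≤ (Q₁ * W₁) (+-monoʳ-≤ (Q₁ * W₁)
           (+-monoʳ-≤ (Q₁ * st₁) (/2^-mono L (X≤n (Q₁ * b₁))))))))) ⟩
    suc ℓ + (suc e + (tableLength + (m * L + (Q₁ * W₁ + (Q₁ * W₁ + (Q₁ * st₁ + n /2^ L))))))
      ≡⟨ rearrange ℓ e tableLength (m * L) (pred Q₁) W₁ b₁ (Q₂ * W₂) (n /2^ L) ⟩
    m * L + pred Q₁ * b₁ + n /2^ L + redundancy
      ≤⟨ +-monoˡ-≤ redundancy (+-monoˡ-≤ (n /2^ L) (+-monoʳ-≤ (m * L) Mb₁≤m)) ⟩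
    m * L + m + n /2^ L + redundancy  ∎
    where
    open ≤-Reasoning
    L = lowWidth m n
    rearrange : ∀ ℓ e t x M w b c u →
      suc ℓ + (suc e + (t + (x + (suc M * w + (suc M * w + (suc M * (b + 2 * c) + u)))))) ≡
      x + M * b + u + ((suc ℓ + suc e + t + (w + w) + 2 * c + b) + M * ((w + w) + 2 * c))
    rearrange = solve-∀

  module _ (1≤e : 1 ≤ e) (ℓ≥ : E * E ≤ ℓ) (ℓ< : ℓ < 4 * (E * E)) (m≥ : 2 ^ ℓ ≤ m) where

    private
      e<E : e < E
      e<E = n<2^n e

      P : ℕ
      P = 2 ^ K

      W₁≤ : W₁ ≤ 5 * (E * E)
      W₁≤ = begin
        ℓ + 2                      ≡⟨ trans (+-suc ℓ 1) (+-comm (suc ℓ) 1) ⟩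
        1 + suc ℓ                  ≤⟨ +-mono-≤ (>-nonZero⁻¹ (E * E)) ℓ< ⟩
        E * E + 4 * (E * E)        ∎
        where open ≤-Reasoning

      W₂≤ : W₂ ≤ 3 * E
      W₂≤ = begin
        3 * e + 1    ≤⟨ +-monoʳ-≤ (3 * e) (s≤s z≤n) ⟩
        3 * e + 3    ≡⟨ trans (+-comm (3 * e) 3) (sym (*-suc 3 e)) ⟩
        3 * suc e    ≤⟨ *-monoʳ-≤ 3 e<E ⟩
        3 * E        ∎
        where open ≤-Reasoning

      U : ℕ
      U = b₁ * P

      b₁≤U : b₁ ≤ U
      b₁≤U = m≤m*n b₁ P {{m^n≢0 2 K}}

      E²≤b₁ : E * E ≤ b₁
      E²≤b₁ = m≤m*n (E * E) E

      E²≤U : E * E ≤ U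
      E²≤U = ≤-trans E²≤b₁ b₁≤U

      Q₂W₂≤ : Q₂ * W₂ ≤ 3 * b₁
      Q₂W₂≤ = ≤-trans (*-monoʳ-≤ (E * E) W₂≤) (≤-reflexive (regroup E))
        where
        regroup : ∀ E → E * E * (3 * E) ≡ 3 * (E * E * E)
        regroup = solve-∀

      table≤ : tableLength ≤ 3 * U
      table≤ = begin
        P * (E * W₂)          ≤⟨ *-monoʳ-≤ P (*-monoʳ-≤ E W₂≤) ⟩
        P * (E * (3 * E))     ≡⟨ regroup P E ⟩
        3 * (E * E * P)       ≤⟨ *-monoʳ-≤ 3 (*-monoˡ-≤ P E²≤b₁) ⟩
        3 * U                 ∎
        where
        open ≤-Reasoning
        regroup : ∀ P E → P * (E * (3 * E)) ≡ 3 * (E * E * P)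
        regroup = solve-∀

      P≡ : 2 ^ E * 2 ^ E * 2 ^ E ≡ P
      P≡ = begin
        2 ^ E * 2 ^ E * 2 ^ E  ≡⟨ cong (_* 2 ^ E) (^-distribˡ-+-* 2 E E) ⟨
        2 ^ (E + E) * 2 ^ E    ≡⟨ ^-distribˡ-+-* 2 (E + E) E ⟨
        2 ^ (E + E + E)        ≡⟨ cong (2 ^_) (triple E) ⟩
        2 ^ K                  ∎
        where
        open ≡-Reasoning
        triple : ∀ E → E + E + E ≡ 3 * E
        triple = solve-∀

      b₁≤P : b₁ ≤ P
      b₁≤P = ≤-trans (*-mono-≤ (*-mono-≤ E≤ E≤) E≤) (≤-reflexive P≡)
        where E≤ = <⇒≤ (n<2^n E)

      rest≤ : suc ℓ + suc e + tableLength + (W₁ + W₁) + 2 * (Q₂ * W₂) + b₁ ≤ 2 ^ (5 + (K + K))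
      rest≤ = begin
        suc ℓ + suc e + tableLength + (W₁ + W₁) + 2 * (Q₂ * W₂) + b₁
          ≤⟨ +-mono-≤ (+-mono-≤ (+-mono-≤ (+-mono-≤ (+-mono-≤
               (≤-trans ℓ< (*-monoʳ-≤ 4 E²≤U)) (≤-trans e<E (≤-trans (m≤m*n E E) E²≤U))) table≤)
               (+-mono-≤ W₁≤U W₁≤U)) (*-monoʳ-≤ 2 (≤-trans Q₂W₂≤ (*-monoʳ-≤ 3 b₁≤U)))) b₁≤U ⟩
        4 * U + U + 3 * U + (5 * U + 5 * U) + 2 * (3 * U) + U   ≡⟨ total U ⟩
        25 * U                                                  ≤⟨ *-mono-≤ (≤ᵇ⇒≤ 25 32 tt) (*-monoˡ-≤ P b₁≤P) ⟩
        32 * (P * P)                                            ≡⟨ cong (32 *_) (^-distribˡ-+-* 2 K K) ⟨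
        32 * 2 ^ (K + K)                                        ≡⟨ ^-distribˡ-+-* 2 5 (K + K) ⟨
        2 ^ (5 + (K + K))                                       ∎
        where
        open ≤-Reasoning
        W₁≤U = ≤-trans W₁≤ (*-monoʳ-≤ 5 E²≤U)
        total : ∀ U → 4 * U + U + 3 * U + (5 * U + 5 * U) + 2 * (3 * U) + U ≡ 25 * U
        total = solve-∀

      perBlock≤ : (W₁ + W₁) + 2 * (Q₂ * W₂) ≤ E * E * (18 * e)
      perBlock≤ = begin
        (W₁ + W₁) + 2 * (E * E * (3 * e + 1))                     ≤⟨ +-monoˡ-≤ _ (+-mono-≤ W₁≤ W₁≤) ⟩
        (5 * (E * E) + 5 * (E * E)) + 2 * (E * E * (3 * e + 1))   ≡⟨ collect (E * E) e ⟩
        E * E * (12 * 1 + 6 * e)                                  ≤⟨ *-monoʳ-≤ (E * E) (+-monoˡ-≤ (6 * e) (*-monoʳ-≤ 12 1≤e)) ⟩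
        E * E * (12 * e + 6 * e)                                  ≡⟨ cong (E * E *_) (*-distribʳ-+ e 12 6) ⟨
        E * E * (18 * e)                                          ∎
        where
        open ≤-Reasoning
        collect : ∀ x e → (5 * x + 5 * x) + 2 * (x * (3 * e + 1)) ≡ x * (12 * 1 + 6 * e)
        collect = solve-∀

    redundancy-small : ∀ k → 4 * (36 * k) ≤ e → 12 + k ≤ e → k * redundancy ≤ m
    redundancy-small k p q = *-cancelˡ-≤ 2 (begin
      2 * (k * (R + M * D))                       ≡⟨ split k R M D ⟩
      2 * k * R + M * (2 * k * D)                 ≤⟨ +-mono-≤ fixed blocks ⟩
      m + m                                       ≡⟨ cong (m +_) (+-identityʳ m) ⟨
      2 * m                                       ∎)
      where
      open ≤-Reasoning
      R = suc ℓ + suc e + tableLength + (W₁ + W₁) + 2 * (Q₂ * W₂) + b₁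
      M = pred Q₁
      D = (W₁ + W₁) + 2 * (Q₂ * W₂)
      split : ∀ k R M D → 2 * (k * (R + M * D)) ≡ 2 * k * R + M * (2 * k * D)
      split = solve-∀
      exponent : suc k + (5 + (K + K)) ≤ ℓ
      exponent = begin
        suc k + (5 + (K + K))        ≡⟨ collect k E ⟩
        6 * E + (6 + k) * 1          ≤⟨ +-monoʳ-≤ (6 * E) (*-monoʳ-≤ (6 + k) (>-nonZero⁻¹ E)) ⟩
        6 * E + (6 + k) * E          ≡⟨ *-distribʳ-+ E 6 (6 + k) ⟨
        (12 + k) * E                 ≤⟨ *-monoˡ-≤ E (≤-trans q (<⇒≤ e<E)) ⟩
        E * E                        ≤⟨ ℓ≥ ⟩
        ℓ                            ∎
        where
        collect : ∀ k E → suc k + (5 + (3 * E + 3 * E)) ≡ 6 * E + (6 + k) * 1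
        collect = solve-∀
      fixed : 2 * k * R ≤ m
      fixed = begin
        2 * k * R                              ≤⟨ *-mono-≤ (*-monoʳ-≤ 2 (<⇒≤ (n<2^n k))) rest≤ ⟩
        2 ^ suc k * 2 ^ (5 + (K + K))          ≡⟨ ^-distribˡ-+-* 2 (suc k) (5 + (K + K)) ⟨
        2 ^ (suc k + (5 + (K + K)))            ≤⟨ ^-monoʳ-≤ 2 exponent ⟩
        2 ^ ℓ                                  ≤⟨ m≥ ⟩
        m                                      ∎
      blocks : M * (2 * k * D) ≤ m
      blocks = begin
        M * (2 * k * D)                        ≤⟨ *-monoʳ-≤ M (*-monoʳ-≤ (2 * k) perBlock≤) ⟩
        M * (2 * k * (E * E * (18 * e)))       ≡⟨ cong (M *_) (collect k (E * E) e) ⟩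
        M * (E * E * (36 * k * e))             ≤⟨ *-monoʳ-≤ M (*-monoʳ-≤ (E * E) (linear≤2^ (36 * k) e p)) ⟩
        M * (E * E * E)                        ≤⟨ Mb₁≤m ⟩
        m                                      ∎
        where
        collect : ∀ k x e → 2 * k * (x * (18 * e)) ≡ x * (36 * k * e)
        collect = solve-∀

sarrayRedundancy : ℕ → ℕ
sarrayRedundancy m = redundancy ℓ (halfLogLog ℓ) m
  where ℓ = ⌊log₂ m ⌋

sarrayRedundancy-littleO : IsLittleO sarrayRedundancy
sarrayRedundancy-littleO k = 2 ^ 2 ^ (e₀ * 2) , bound
  where
  e₀ = 4 * (36 * k) + (12 + k)
  bound : ∀ m → 2 ^ 2 ^ (e₀ * 2) ≤ m → k * sarrayRedundancy m ≤ m
  bound m m₀≤m = redundancy-small ℓ e m (≤-trans (s≤s z≤n) 12≤e) ℓ≥ (<4^[1+halfLogLog] ℓ)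
                   (2^log≤ m {{>-nonZero (≤-trans (2^-pos (2 ^ (e₀ * 2))) m₀≤m)}}) k
                   (≤-trans (m≤m+n _ (12 + k)) e₀≤e) 12≤e
    where
    ℓ = ⌊log₂ m ⌋
    e = halfLogLog ℓ
    e₀≤e : e₀ ≤ e
    e₀≤e = halfLogLog-≥ e₀ m₀≤m
    12≤e : 12 + k ≤ e
    12≤e = ≤-trans (m≤n+m (12 + k) (4 * (36 * k))) e₀≤e
    ℓ≥ : 2 ^ e * 2 ^ e ≤ ℓ
    ℓ≥ = 4^halfLogLog≤′ ℓ (≤-trans (s≤s z≤n) 12≤e)

Holds⇒≗ : ∀ {μ} f k → Holds μ (applyUpTo f k) → μ [ 0 , k ]≗ f
Holds⇒≗ {μ} f k holds .at t t<k = begin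
  μ t                                    ≡⟨ cong μ toℕ-i ⟨
  μ (toℕ i)                              ≡⟨ holds i ⟩
  lookup (applyUpTo f k) i               ≡⟨ lookup-applyUpTo f k i ⟩
  f (toℕ i)                              ≡⟨ cong f toℕ-i ⟩
  f t                                    ∎
  where
  open ≡-Reasoning
  t<length : t < length (applyUpTo f k)
  t<length = <-≤-trans t<k (≤-reflexive (sym (length-applyUpTo f k)))
  i = fromℕ< t<length
  toℕ-i : toℕ i ≡ t
  toℕ-i = toℕ-fromℕ< t<length

loopTime-≤ : ∀ T B p k {R} → 1 ≤ R → k ≤ 2 * R →
             p + loopTime T B k ≤ (p + loopTime T B 0 + 2 * (length (compileBlock T) + suc (suc (length (compileBlock B))))) * R
loopTime-≤ T B p k {R} 1≤R k≤ = begin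
  p + loopTime T B k                       ≡⟨ cong (p +_) (linear k) ⟩
  p + (k * c + loopTime T B 0)             ≤⟨ +-monoʳ-≤ p (+-monoˡ-≤ _ (*-monoˡ-≤ c k≤)) ⟩
  p + (2 * R * c + loopTime T B 0)         ≡⟨ rearrange p (2 * R) c (loopTime T B 0) ⟩
  (p + loopTime T B 0) * 1 + 2 * R * c     ≤⟨ +-monoˡ-≤ _ (*-monoʳ-≤ (p + loopTime T B 0) 1≤R) ⟩
  (p + loopTime T B 0) * R + 2 * R * c     ≡⟨ collect (p + loopTime T B 0) R c ⟩
  (p + loopTime T B 0 + 2 * c) * R         ∎
  where
  open ≤-Reasoning
  t = length (compileBlock T)
  b = length (compileBlock B)
  c = t + suc (suc b)
  linear : ∀ k → loopTime T B k ≡ k * c + loopTime T B 0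
  linear zero    = refl
  linear (suc k) = trans (cong (λ z → t + suc (b + suc z)) (linear k)) (regroup t b (k * c) (loopTime T B 0))
    where
    regroup : ∀ t b x y → t + suc (b + suc (x + y)) ≡ t + suc (suc b) + x + y
    regroup = solve-∀
  rearrange : ∀ p x c d → p + (x * c + d) ≡ (p + d) * 1 + x * c
  rearrange = solve-∀
  collect : ∀ a R c → a * R + 2 * R * c ≡ (a + 2 * c) * R
  collect = solve-∀

-- Abstract, since comparing runs of concrete programs would execute them.
abstract

  sarrayRank sarraySelect : Program
  sarrayRank   = loop rankPreamble rankTest rankStep 4
  sarraySelect = haltAfter selectProgramBlock rAnswer

  sarrayRank-def : sarrayRank ≡ loop rankPreamble rankTest rankStep 4
  sarrayRank-def = refl

  sarraySelect-def : sarraySelect ≡ haltAfter selectProgramBlock rAnswer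
  sarraySelect-def = refl

  rankSteps selectSteps : ℕ
  rankSteps   = length (compileBlock rankPreamble) + loopTime rankTest rankStep 0
              + 2 * (length (compileBlock rankTest) + suc (suc (length (compileBlock rankStep))))
  selectSteps = length (compileBlock selectProgramBlock) + 1

  selectSteps-≤ : ∀ {t} → selectSteps ≤ t → length (compileBlock selectProgramBlock) + 1 ≤ t
  selectSteps-≤ p = p

  rankSteps-≤ : ∀ {R t} k → 1 ≤ R → k ≤ 2 * R → rankSteps * R ≤ t →
                length (compileBlock rankPreamble) + loopTime rankTest rankStep k ≤ t
  rankSteps-≤ k 1≤R k≤ p = ≤-trans (loopTime-≤ rankTest rankStep (length (compileBlock rankPreamble)) k 1≤R k≤) p

module _ (s : ℕ) (1≤s : 1 ≤ s) (μ : Memory) {n m : ℕ} (X : ℕ → ℕ)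
         (n< : n < 2 ^ (1 * s)) (m≤n : m ≤ n) (X-mono : Monotone X) (X≤n : ∀ i → X i ≤ n)
         (select-correct : ∀ {σ i} → σ 1 ≡ n → σ 2 ≡ m → σ 3 ≡ i → i < m →
                           ∃[ τ ] (Machine.Exec (64 * s) μ selectBlock σ τ × τ rAnswer ≡ X i)) where

  open Queries s 1≤s μ X n< m≤n X-mono X≤n
  open Running (64 * s) μ

  sarraySelect-correct : ∀ i t → i < m → selectSteps ≤ t →
                         run sarraySelect (64 * s) t ⟨ 0 , initRegs (suc i) n m , μ ⟩ ≡ just (X i , μ)
  sarraySelect-correct i t i<m t≥ =
    Halts-run (subst (λ p → Halts p (length (compileBlock selectProgramBlock) + 1) (initRegs (suc i) n m) (X i))
                     (sym sarraySelect-def) (run-select select-correct i i<m))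
              (selectSteps-≤ t≥)

  sarrayRank-correct : ∀ x t R → x < 2 ^ (1 * s) → 1 ≤ R → suc ⌊log₂ m ⌋ ≤ 2 * R → rankSteps * R ≤ t →
                       ∃[ r ] (IsRank X m x r × run sarrayRank (64 * s) t ⟨ 0 , initRegs x n m , μ ⟩ ≡ just (r , μ))
  sarrayRank-correct x t R x< 1≤R log≤ t≥ =
    let r , isRank , h = run-rank select-correct x x< (suc ⌊log₂ m ⌋) (<2^[1+log] m) in
    r , isRank ,
    Halts-run (subst (λ p → Halts p (length (compileBlock rankPreamble) + loopTime rankTest rankStep (suc ⌊log₂ m ⌋)) (initRegs x n m) r)
                     (sym sarrayRank-def) h)
              (rankSteps-≤ (suc ⌊log₂ m ⌋) 1≤R log≤ t≥)

setLayout : ∀ {n} → Subset n → ℕ × Memory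
setLayout S = sizeOf (element S) , contentsOf (element S)
  where
  ℓ = ⌊log₂ ∣ S ∣ ⌋
  open Layout ℓ (halfLogLog ℓ) ∣ S ∣

sarray : RankSelectStructure
sarray = record
  { wordFactor    = 64
  ; wordFactor≢0  = _
  ; encode        = λ S → applyUpTo (proj₂ (setLayout S)) (proj₁ (setLayout S))
  ; rankProgram   = sarrayRank
  ; selectProgram = sarraySelect
  }

module _ {n : ℕ} (S : Subset n) .{{_ : NonZero ∣ S ∣}} where

  open RankSelectStructure sarray

  private
    m ℓ : ℕ
    m = ∣ S ∣
    ℓ = ⌊log₂ m ⌋

    X : ℕ → ℕ
    X = element S

    m≤n : m ≤ n
    m≤n = ∣p∣≤n S

    instance
      n≢0 : NonZero n
      n≢0 = >-nonZero (≤-trans (>-nonZero⁻¹ m) m≤n)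

    s : ℕ
    s = suc ⌊log₂ n ⌋

    n< : n < 2 ^ (1 * s)
    n< = subst (λ z → n < 2 ^ z) (sym (*-identityˡ s)) (<2^[1+log] n)

    selects : ∀ μ → Holds μ (encode S) → ∀ {σ i} → σ 1 ≡ n → σ 2 ≡ m → σ 3 ≡ i → i < m →
              ∃[ τ ] (Machine.Exec (64 * s) μ selectBlock σ τ × τ rAnswer ≡ X i)
    selects μ holds = selectBlock-correct
      where
      open SelectCorrect ⌊log₂ n ⌋ ℓ (halfLogLog ℓ) n m X (element-mono S) (element-≤ S) (element-end S)
             (2^log≤ n) (<2^[1+log] n) m≤n (2^log≤ m) (<2^[1+log] m) (4^halfLogLog≤ ℓ) μ
             (Holds⇒≗ {μ} (proj₂ (setLayout S)) (proj₁ (setLayout S)) holds)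

  sarray-size : size S ≤ m log₂[ n / m ]+ (2 * m + sarrayRedundancy m)
  sarray-size = space-bound n m (size S) (sarrayRedundancy m) m≤n
    (≤-trans (≤-reflexive (length-applyUpTo (proj₂ (setLayout S)) (proj₁ (setLayout S))))
             (size-bound ℓ (halfLogLog ℓ) m X (element-≤ S) (element-end S)))

  sarray-select : ∀ i → AnswersSelect S i ((rankSteps + selectSteps) * selectTime n m)
  sarray-select i μ holds = μ ,
    trans (sarraySelect-correct s (s≤s z≤n) μ X n< m≤n (element-mono S) (element-≤ S) (selects μ holds)
             (toℕ i) ((rankSteps + selectSteps) * selectTime n m) (toℕ<n i)
             (≤-trans (m≤n+m selectSteps rankSteps) (m≤m*n (rankSteps + selectSteps) (selectTime n m))))
          (cong (λ a → just (a , μ)) (element-select S i)) ,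
    holds

  sarray-rank : ∀ x → AnswersRank S x ((rankSteps + selectSteps) * rankTime n m)
  sarray-rank x μ holds =
    let r , isRank , halts-with-r = sarrayRank-correct s (s≤s z≤n) μ X n< m≤n (element-mono S) (element-≤ S) (selects μ holds)
             (toℕ x) ((rankSteps + selectSteps) * rankTime n m) (rankTime n m) (<-trans (toℕ<n x) n<) (s≤s z≤n)
             (≤-trans (+-mono-≤ {1} {rankTime n m} (s≤s z≤n) (log≤rankTime n m m≤n))
                      (≤-reflexive (cong (rankTime n m +_) (sym (+-identityʳ (rankTime n m))))))
             (*-monoˡ-≤ (rankTime n m) (m≤m+n rankSteps selectSteps))
    in μ , trans halts-with-r (cong (λ a → just (a , μ)) (sym (rank-unique S x isRank))) , holds

mainTheorem4 : Σ[ D ∈ RankSelectStructure ] Σ[ f ∈ (ℕ → ℕ) ] Σ[ C ∈ ℕ ]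
    let open RankSelectStructure D in
    IsLittleO f ×
    (∀ (n m : ℕ) .{{_ : NonZero m}} (S : Subset n) → ∣ S ∣ ≡ m →
    (size S ≤ m log₂[ n / m ]+ (2 * m + f m)) ×
    (∀ (x : Fin n) → AnswersRank S x (C * rankTime n m)) ×
    (∀ (i : Fin ∣ S ∣) → AnswersSelect S i (C * selectTime n m)))
mainTheorem4 =
  sarray , sarrayRedundancy , rankSteps + selectSteps , sarrayRedundancy-littleO ,
  λ { n m S refl → sarray-size S , sarray-rank S , sarray-select S }
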